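{- In the cell-probe model with words of $w=\Theta(\log N)$ bits, every deterministic data structure that answers suffix array queries for all binary strings of length at most $N$ and uses at most $S(N)=\Omega(N)$ bits of space has worst-case query time $$Q(N)\ \ge\ \Omega\!\left(\frac{\log\log N}{\log\big((S(N)/N)\log\log N\big)}\right)$$ for all sufficiently large $N$. Explicitly: for all constants $a_1,a_2,a_3>0$ there exist constants $c>0$ and $N_0$ such that the following holds for every integer $N\ge N_0$. Let $w$ be an integer with $a_1\log N\le w\le a_2\log N$ and let $S\ge a_3N$. If a deterministic static cell-probe data structure with $w$-bit cells uses at most $S$ bits of space on every binary string $T\in\{0,1\}^*$ with $2\le|T|\le N$, and for every such $T$ and every $i\in\{1,\dots,|T|\}$ answers the query $i\mapsto \mathrm{SA}_T[i]$ using at most $Q$ cell probes, then $$Q\ \ge\ c\cdot\frac{\log\log N}{\log\big((S/N)\log\log N\big)} .$$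
   Context: Logarithms are base 2. For a nonempty string $T$ of length $n$ over an ordered alphabet, the suffix array $\mathrm{SA}_T[1..n]$ is the permutation of $\{1,\dots,n\}$ such that $T[\mathrm{SA}_T[1]..n]\prec T[\mathrm{SA}_T[2]..n]\prec\cdots\prec T[\mathrm{SA}_T[n]..n]$ in lexicographic order, where a proper prefix of a string is smaller than that string. A suffix array query takes $i\in\{1,\dots,n\}$ and returns $\mathrm{SA}_T[i]$. Static cell-probe model with $w$-bit words: a preprocessing function (with no restriction on its computational cost) maps the input $T$ to a memory, i.e., a sequence of cells of $w$ bits each; the space in bits is $w$ times the number of cells. A deterministic query algorithm, given the query, adaptively reads (probes) cells, each probe's address depending on the query and the contents of cells probed so far, and outputs the answer as a function of the query and the probed contents. The query time is the worst-case number of probes; all other computation is free. -}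

module Defs where

import Algebra.Definitions.RawSemiring
open import Data.Bool.Base using (Bool)
import Data.Bool.Base as Bool
import Data.Bool.Properties as Bool
open import Data.Empty using (⊥)
open import Data.Fin.Base as Fin using (Fin; zero; suc; toℕ)
import Data.Fin.Properties as Fin
open import Data.Fin.Permutation
  using (Permutation′; permutation; _⟨$⟩ʳ_)
open import Data.Integer.Base as ℤ using (ℤ; +_; -[1+_])
open import Data.List.Base using (List; _∷_; length; drop; head; lookup; allFin)
import Data.List.Membership.Propositional.Properties as List
import Data.List.Properties as List
open import Data.List.Relation.Binary.Lex.Strict using (Lex-<; <-strictTotalOrder)
open import Data.List.Relation.Binary.Permutation.Propositional using (↭-sym; ↭⇒↭ₛ)
import Data.List.Relation.Binary.Permutation.Propositional.Properties as Perm
import Data.List.Relation.Binary.Permutation.Setoid.Properties as Permₛ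
open import Data.List.Relation.Binary.Pointwise using (Pointwise-length)
import Data.List.Relation.Unary.All as All
open import Data.List.Relation.Unary.AllPairs using (AllPairs; []; _∷_)
open import Data.List.Relation.Unary.Any using (index)
open import Data.List.Relation.Unary.Any.Properties using (lookup-index)
open import Data.List.Relation.Unary.Linked.Properties using (Linked⇒AllPairs)
open import Data.List.Relation.Unary.Unique.Propositional using (Unique)
open import Data.List.Relation.Unary.Unique.Propositional.Properties using (allFin⁺)
import Data.List.Sort as Sort
open import Data.Maybe.Base as Maybe using (Maybe; just; _>>=_)
open import Data.Nat.Base as ℕ using (ℕ; zero; suc)
import Data.Nat.Properties as ℕ
open import Data.Product using (_×_; _,_; ∃-syntax; map₂)
open import Data.Rational.Base as ℚ using (ℚ; 0ℚ; 1ℚ; +-*-rawSemiring)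
open import Data.Sum.Base using (_⊎_; inj₁; inj₂)
open import Data.Vec.Base using (Vec)
open import Function.Bundles using (_⇔_)
open import Relation.Binary.Bundles using (DecTotalOrder; StrictTotalOrder)
import Relation.Binary.Construct.On as On
open import Relation.Binary.Definitions using (tri<; tri≈; tri>)
open import Relation.Binary.PropositionalEquality
open import Relation.Binary.Properties.StrictTotalOrder using (decTotalOrder)
open import Relation.Nullary using (contradiction)

-- A pair of sets of rationals; a real number is a cut satisfying Real.
-- The operations below are the usual Dedekind-cut operations, defined on
-- arbitrary cuts so that they carry no proof arguments; recip and log₂ are
-- meaningful for positive arguments only.

record Cut : Set₁ where
  field
    lower : ℚ → Set  -- the q with q < x
    upper : ℚ → Set  -- the q with x < q

open Cut public

record Real (x : Cut) : Set where
  field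
    lower-inhabited : ∃[ q ] lower x q
    upper-inhabited : ∃[ q ] upper x q
    lower-rounded   : ∀ {q} → lower x q ⇔ (∃[ r ] q ℚ.< r × lower x r)
    upper-rounded   : ∀ {q} → upper x q ⇔ (∃[ r ] r ℚ.< q × upper x r)
    disjoint        : ∀ {q} → lower x q → upper x q → ⊥
    located         : ∀ {q r} → q ℚ.< r → lower x q ⊎ upper x r

infix  4 _<ᴿ_ _≤ᴿ_
infixl 7 _*ᴿ_ _/ᴿ_

_<ᴿ_ : Cut → Cut → Set
x <ᴿ y = ∃[ q ] upper x q × lower y q

_≤ᴿ_ : Cut → Cut → Set
x ≤ᴿ y = ∀ q → lower x q → lower y q

fromℚ : ℚ → Cut
fromℚ p .lower q = q ℚ.< p
fromℚ p .upper q = p ℚ.< q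

fromℕ : ℕ → Cut
fromℕ n = fromℚ (+ n ℚ./ 1)

0ᴿ : Cut
0ᴿ = fromℕ 0

-- Interval multiplication: for a < x < b and c < y < d, the product xy lies
-- strictly between the least and the greatest of ac, ad, bc, bd, whatever
-- the signs.

_*ᴿ_ : Cut → Cut → Cut
(x *ᴿ y) .lower q =
  ∃[ a ] ∃[ b ] ∃[ c ] ∃[ d ]
    (lower x a × upper x b × lower y c × upper y d) ×
    (q ℚ.< a ℚ.* c × q ℚ.< a ℚ.* d × q ℚ.< b ℚ.* c × q ℚ.< b ℚ.* d)
(x *ᴿ y) .upper q =
  ∃[ a ] ∃[ b ] ∃[ c ] ∃[ d ]
    (lower x a × upper x b × lower y c × upper y d) ×
    (a ℚ.* c ℚ.< q × a ℚ.* d ℚ.< q × b ℚ.* c ℚ.< q × b ℚ.* d ℚ.< q)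

-- For x > 0, q < 1/x iff qr < 1 for some rational
-- r > x, and 1/x < q iff 1 < qr for some rational 0 < r < x.

recip : Cut → Cut
recip x .lower q = ∃[ r ] upper x r × 0ℚ ℚ.< r × q ℚ.* r ℚ.< 1ℚ
recip x .upper q = ∃[ r ] lower x r × 0ℚ ℚ.< r × 1ℚ ℚ.< q ℚ.* r

_/ᴿ_ : Cut → Cut → Cut
x /ᴿ y = x *ᴿ recip y

open Algebra.Definitions.RawSemiring +-*-rawSemiring using (_^_)

2^ : ℤ → ℚ
2^ (+ n)    = (+ 2 ℚ./ 1) ^ n
2^ -[1+ n ] = ℚ.½ ^ suc n

-- For a rational q = m/d and r > 0,
-- q < log₂ r iff 2^m < r^d, and log₂ r < q iff r^d < 2^m.

log₂ : Cut → Cut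
log₂ x .lower q = ∃[ r ] lower x r × 0ℚ ℚ.< r × 2^ (ℚ.↥ q) ℚ.< r ^ ℚ.↧ₙ q
log₂ x .upper q = ∃[ r ] upper x r × 0ℚ ℚ.< r × r ^ ℚ.↧ₙ q ℚ.< 2^ (ℚ.↥ q)

-- Lexicographic order with false < true; a proper prefix is smaller.

_≺_ : List Bool → List Bool → Set
_≺_ = Lex-< _≡_ Bool._<_

-- Positions are counted from 0 here, so suffix T j is T[j+1..n].

suffix : (T : List Bool) → Fin (length T) → List Bool
suffix T j = drop (toℕ j) T

IsSuffixArray : (T : List Bool) → Permutation′ (length T) → Set
IsSuffixArray T σ =
  ∀ {i j} → i Fin.< j → suffix T (σ ⟨$⟩ʳ i) ≺ suffix T (σ ⟨$⟩ʳ j)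

private
  module Sorting (T : List Bool) where
    n = length T

    ≺-sto = <-strictTotalOrder Bool.<-strictTotalOrder
    open StrictTotalOrder ≺-sto using (_≈_)

    suffix-injective : ∀ {i j} → suffix T i ≈ suffix T j → i ≡ j
    suffix-injective {i} {j} eq = Fin.toℕ-injective
      (ℕ.∸-cancelˡ-≡ (ℕ.<⇒≤ (Fin.toℕ<n i)) (ℕ.<⇒≤ (Fin.toℕ<n j))
        (trans (sym (List.length-drop (toℕ i) T))
          (trans (Pointwise-length eq) (List.length-drop (toℕ j) T))))

    positions = On.decTotalOrder (decTotalOrder ≺-sto) (suffix T)
    open Sort positions

    xs = sort (allFin n)

    eq : n ≡ length xs
    eq = sym (trans (Perm.↭-length (sort-↭ (allFin n))) (List.length-tabulate _))

    _⊏_ : Fin n → Fin n → Set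
    i ⊏ j = suffix T i ≺ suffix T j

    strict : ∀ {ys} → AllPairs (λ i j → i ⊏ j ⊎ suffix T i ≈ suffix T j) ys →
             Unique ys → AllPairs _⊏_ ys
    strict [] [] = []
    strict (p ∷ ps) (u ∷ us) = All.zipWith step (p , u) ∷ strict ps us
      where
      step : ∀ {i j} → (i ⊏ j ⊎ suffix T i ≈ suffix T j) × i ≢ j → i ⊏ j
      step (inj₁ lt , _)   = lt
      step (inj₂ eq , i≢j) = contradiction (suffix-injective eq) i≢j

    lookup-mono : ∀ {ys} → AllPairs _⊏_ ys →
                  ∀ {i j} → i Fin.< j → lookup ys i ⊏ lookup ys j
    lookup-mono {_ ∷ ys} (p ∷ _) {zero} {suc j} _ = All.lookup p (List.∈-lookup {xs = ys} j)
    lookup-mono (_ ∷ ps) {suc i} {suc j} (ℕ.s≤s lt) = lookup-mono ps lt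

    unique : Unique xs
    unique = Permₛ.Unique-resp-↭ (setoid (Fin n))
      (↭⇒↭ₛ (↭-sym (sort-↭ (allFin n)))) (allFin⁺ n)

    sorted : AllPairs _⊏_ xs
    sorted = strict (Linked⇒AllPairs
      (λ {i} {j} {k} → DecTotalOrder.trans positions {i} {j} {k})
      (sort-↗ (allFin n))) unique

    to : Fin n → Fin n
    to i = lookup xs (Fin.cast eq i)

    to-mono : ∀ {i j} → i Fin.< j → to i ⊏ to j
    to-mono {i} {j} lt = lookup-mono sorted
      (subst₂ ℕ._<_ (sym (Fin.toℕ-cast eq i)) (sym (Fin.toℕ-cast eq j)) lt)

    irrefl : ∀ {i j} → i ≡ j → i ⊏ j → ⊥
    irrefl refl = StrictTotalOrder.irrefl ≺-sto (StrictTotalOrder.Eq.refl ≺-sto)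

    to-injective : ∀ {i j} → to i ≡ to j → i ≡ j
    to-injective {i} {j} e with Fin.<-cmp i j
    ... | tri< lt _ _ = contradiction (to-mono lt) (irrefl e)
    ... | tri≈ _ e′ _ = e′
    ... | tri> _ _ gt = contradiction (to-mono gt) (irrefl (sym e))

    from : Fin n → Fin n
    from j = Fin.cast (sym eq)
      (index (Perm.∈-resp-↭ (↭-sym (sort-↭ (allFin n))) (List.∈-allFin j)))

    to-from : ∀ j → to (from j) ≡ j
    to-from j = trans (cong (lookup xs) (Fin.cast-involutive eq (sym eq) _))
      (sym (lookup-index (Perm.∈-resp-↭ (↭-sym (sort-↭ (allFin n))) (List.∈-allFin j))))

abstract
  SA : (T : List Bool) → Permutation′ (length T)
  SA T = permutation to from to-from (λ i → to-injective (to-from (to i)))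
    where open Sorting T

  SA-isSuffixArray : ∀ T → IsSuffixArray T (SA T)
  SA-isSuffixArray T = Sorting.to-mono T

Word : ℕ → Set
Word w = Vec Bool w

Memory : ℕ → Set
Memory w = List (Word w)

bits : ∀ {w} → Memory w → ℕ
bits {w} M = w ℕ.* length M

-- An adaptive algorithm is a decision tree: `probe a k` reads the cell with
-- address a (counted from 0) and continues as k prescribes on its contents.

data Algorithm (w : ℕ) (A : Set) : Set where
  output : A → Algorithm w A
  probe  : ℕ → (Word w → Algorithm w A) → Algorithm w A

-- The output together with the number of probes; a run that probes an
-- address outside the memory yields nothing.

run : ∀ {w A} → Algorithm w A → Memory w → Maybe (A × ℕ)
run (output x)  M = just (x , 0)
run (probe a k) M = head (drop a M) >>= λ c → Maybe.map (map₂ suc) (run (k c) M)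

record CellProbeStructure (w : ℕ) (Input Query Answer : Set) : Set where
  field
    preprocess : Input → Memory w
    query      : Query → Algorithm w Answer

open CellProbeStructure public

-- For every index i of T, the query i returns SA_T[i] after at most Q probes
-- (indices and positions are counted from 1 in queries and answers).

AnswersSA : ∀ {w} → CellProbeStructure w (List Bool) ℕ ℕ → List Bool → ℕ → Set
AnswersSA D T Q = (i : Fin (length T)) →
  ∃[ t ] run (query D (suc (toℕ i))) (preprocess D T)
           ≡ just (suc (toℕ (SA T ⟨$⟩ʳ i)) , t)
         × t ℕ.≤ Q

-- The hard strings spell out a butterfly network: h layers of switches permute
-- 2^(h+e) tokens, and the block of a token lists, in reverse, the bits it is
-- assigned by the h layers, followed by the token itself.  The tokens occupy
-- each position of a layer exactly once, so the number of suffixes below a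
-- given one does not depend on the switches, and a suffix array query asks
-- which token sits at a given position of a given layer.
--
-- Suppose that Q probes suffice.  The layers are cut into nested windows of
-- scales 0, 1, …, where a window of scale t+1 is a buffer without queries
-- followed by K windows of scale t.  In round t one publishes the cells that
-- too many queries probe in their step t+1, and greedily chosen cells that are
-- met in many windows.  A window of scale t+1 then still lacks a query with
-- t+1 known probes only if its subwindows were lost before, or probe a cell met
-- earlier on the same path (a collision), or probe fresh cells, which the
-- greedy choice makes rare.  Collisions are rare as well: given the path up to
-- the buffer, a collision determines the path through the buffer up to few
-- choices, so the number of collisions has a small exponential moment, even
-- when summed over all published contents.  After Q rounds the published cells
-- answer some query in most windows of scale Q.  The moment bound, applied to
-- the event that the answer is the token itself, excludes this, because the
-- published cells hold far fewer bits than there are switches.  With K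
-- polynomial in Q and S/N, the argument needs only K^O(Q) ≤ log N layers.

module Submission where

open import Defs
import Algebra.Definitions.RawSemiring
import Algebra.Properties.CommutativeMonoid.Sum
import Algebra.Properties.Semiring.Exp
open import Algebra.Bundles using (module CommutativeRing)
open import Data.Bool.Base using (Bool; true; false; not; _∧_; _∨_; if_then_else_; _xor_; T; f<t)
open import Data.Bool.ListAction using (any)
import Data.Bool.Properties as Bool
open import Data.Empty using (⊥; ⊥-elim)
open import Data.Fin.Base as Fin using (Fin; zero; suc; toℕ; fromℕ<)
open import Data.Fin.Permutation using (_⟨$⟩ʳ_; _⟨$⟩ˡ_; inverseʳ)
import Data.Fin.Properties as Fin
open import Data.List.Base
  using (List; []; _∷_; _++_; length; map; concatMap; cartesianProduct; cartesianProductWith; take; drop; downFrom; head;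
         reverse)
open import Data.List.Membership.Propositional using (_∈_; lose)
open import Data.List.Membership.Propositional.Properties
  using (∈-++⁺ˡ; ∈-++⁺ʳ; ∈-map⁺; ∈-map⁻; ∈-cartesianProductWith⁺; ∈-concatMap⁺)
import Data.List.Properties as List
open import Data.List.Relation.Binary.Lex.Core using (base; halt; this; next)
open import Data.List.Relation.Unary.All as All using (All; []; _∷_)
import Data.List.Relation.Unary.All.Properties as All
open import Data.List.Relation.Unary.Any using (here; there)
open import Data.Maybe.Base using (Maybe; just; nothing; fromMaybe)
open import Data.Maybe.Properties using (just-injective)
open import Data.Nat
open import Data.Nat.Coprimality using (Coprime; 1-coprimeTo) renaming (sym to coprime-sym)
open import Data.Nat.DivMod using (_/_; _%_; m≡m%n+[m/n]*n; m%n<n; m/n*n≤m; /-monoˡ-≤; m*n/n≡m)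
open import Data.Nat.Properties
open import Data.Nat.Tactic.RingSolver using (solve-∀)
open import Data.Product.Base using (_×_; _,_; proj₁; proj₂; ∃-syntax)
import Data.Product.Properties as Product
open import Data.Sum.Base using (_⊎_; inj₁; inj₂)
open import Data.Unit.Base using (⊤; tt)
open import Data.Vec.Base as Vec using (Vec; []; _∷_; toList; replicate)
import Data.Vec.Properties as Vec
open import Function.Bundles using (mk⇔; module Equivalence)
open import Relation.Binary.Definitions using (DecidableEquality; tri<; tri≈; tri>)
open import Relation.Binary.PropositionalEquality
open import Relation.Nullary using (Dec; yes; no; does; contradiction; ¬_)
open import Relation.Nullary.Decidable using (toWitness)

-- The published contents depend on the whole network, so nothing about the paths is independent of
-- what is known. For one fixed content `μ`, however, a label is a function of level, position and
-- token, and the number of collisions is a sum over tokens of functions of a single path each. The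
-- moment is therefore bounded for fixed `μ` and multiplied by the number of contents. A collision
-- weighs 2^b′, so 2^C contents raise the mean number of collisions only by about C/b′: longer
-- buffers allow heavier weights, and heavier weights pay for more published bits. Tokens share
-- switches, so the mean of a product over tokens does not factor. Cauchy-Schwarz at each switch
-- bounds its square by the product of the mean squares over independent uniform paths; this is why
-- squares run through the moment estimates. Means are written as sums, with the number `Z` of
-- networks on the other side. In the last step the correct answers play the part of a cell that was
-- met before the path began.

module Sum = Algebra.Properties.CommutativeMonoid.Sum +-0-commutativeMonoid

private variable
  𝔸 𝔹 : Set

-- Finite sums and products

∑ : List 𝔸 → (𝔸 → ℕ) → ℕ
∑ []       f = 0
∑ (x ∷ xs) f = f x + ∑ xs f

∏ : List 𝔸 → (𝔸 → ℕ) → ℕ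
∏ []       f = 1
∏ (x ∷ xs) f = f x * ∏ xs f

syntax ∑ xs (λ x → e) = ∑[ x ∈ xs ] e
syntax ∏ xs (λ x → e) = ∏[ x ∈ xs ] e

𝟙 : Bool → ℕ
𝟙 true  = 1
𝟙 false = 0

sq : ℕ → ℕ
sq n = n * n

∑-cong : ∀ (xs : List 𝔸) {f g : 𝔸 → ℕ} → (∀ x → f x ≡ g x) → ∑ xs f ≡ ∑ xs g
∑-cong []       e = refl
∑-cong (x ∷ xs) e = cong₂ _+_ (e x) (∑-cong xs e)

∏-cong : ∀ (xs : List 𝔸) {f g : 𝔸 → ℕ} → (∀ x → f x ≡ g x) → ∏ xs f ≡ ∏ xs g
∏-cong []       e = refl
∏-cong (x ∷ xs) e = cong₂ _*_ (e x) (∏-cong xs e)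

∑-mono : ∀ (xs : List 𝔸) {f g : 𝔸 → ℕ} → (∀ x → f x ≤ g x) → ∑ xs f ≤ ∑ xs g
∑-mono []       e = z≤n
∑-mono (x ∷ xs) e = +-mono-≤ (e x) (∑-mono xs e)

∏-mono : ∀ (xs : List 𝔸) {f g : 𝔸 → ℕ} → (∀ x → f x ≤ g x) → ∏ xs f ≤ ∏ xs g
∏-mono []       e = ≤-refl
∏-mono (x ∷ xs) e = *-mono-≤ (e x) (∏-mono xs e)

∑-++ : ∀ (xs ys : List 𝔸) {f : 𝔸 → ℕ} → ∑ (xs ++ ys) f ≡ ∑ xs f + ∑ ys f
∑-++ []       ys = refl
∑-++ (x ∷ xs) ys {f} = trans (cong (f x +_) (∑-++ xs ys)) (sym (+-assoc (f x) _ _))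

∏-++ : ∀ (xs ys : List 𝔸) {f : 𝔸 → ℕ} → ∏ (xs ++ ys) f ≡ ∏ xs f * ∏ ys f
∏-++ []       ys = sym (+-identityʳ _)
∏-++ (x ∷ xs) ys {f} = trans (cong (f x *_) (∏-++ xs ys)) (sym (*-assoc (f x) _ _))

∑-map : ∀ (g : 𝔸 → 𝔹) (xs : List 𝔸) {f : 𝔹 → ℕ} → ∑ (map g xs) f ≡ ∑[ x ∈ xs ] f (g x)
∑-map g []       = refl
∑-map g (x ∷ xs) {f} = cong (f (g x) +_) (∑-map g xs)

∏-map : ∀ (g : 𝔸 → 𝔹) (xs : List 𝔸) {f : 𝔹 → ℕ} → ∏ (map g xs) f ≡ ∏[ x ∈ xs ] f (g x)
∏-map g []       = refl
∏-map g (x ∷ xs) {f} = cong (f (g x) *_) (∏-map g xs)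

∑-concatMap : ∀ (g : 𝔸 → List 𝔹) (xs : List 𝔸) {f : 𝔹 → ℕ} →
              ∑ (concatMap g xs) f ≡ ∑[ x ∈ xs ] ∑ (g x) f
∑-concatMap g []       = refl
∑-concatMap g (x ∷ xs) {f} =
  trans (∑-++ (g x) (concatMap g xs)) (cong (∑ (g x) f +_) (∑-concatMap g xs))

∏-concatMap : ∀ (g : 𝔸 → List 𝔹) (xs : List 𝔸) {f : 𝔹 → ℕ} →
              ∏ (concatMap g xs) f ≡ ∏[ x ∈ xs ] ∏ (g x) f
∏-concatMap g []       = refl
∏-concatMap g (x ∷ xs) {f} =
  trans (∏-++ (g x) (concatMap g xs)) (cong (∏ (g x) f *_) (∏-concatMap g xs))

∑-cartesianProduct : ∀ (xs : List 𝔸) (ys : List 𝔹) {f : 𝔸 × 𝔹 → ℕ} →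
                     ∑ (cartesianProduct xs ys) f ≡ ∑[ x ∈ xs ] ∑[ y ∈ ys ] f (x , y)
∑-cartesianProduct []       ys = refl
∑-cartesianProduct (x ∷ xs) ys = trans (∑-++ (map (x ,_) ys) _)
  (cong₂ _+_ (∑-map (x ,_) ys) (∑-cartesianProduct xs ys))

∑-+ : ∀ (xs : List 𝔸) {f g : 𝔸 → ℕ} → ∑[ x ∈ xs ] (f x + g x) ≡ ∑ xs f + ∑ xs g
∑-+ []       = refl
∑-+ (x ∷ xs) {f} {g} = trans (cong (f x + g x +_) (∑-+ xs)) (lem (f x) (g x) _ _)
  where
  lem : ∀ a b c d → a + b + (c + d) ≡ a + c + (b + d)
  lem = solve-∀

∏-* : ∀ (xs : List 𝔸) {f g : 𝔸 → ℕ} → ∏[ x ∈ xs ] (f x * g x) ≡ ∏ xs f * ∏ xs g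
∏-* []       = refl
∏-* (x ∷ xs) {f} {g} = trans (cong (f x * g x *_) (∏-* xs)) (lem (f x) (g x) _ _)
  where
  lem : ∀ a b c d → a * b * (c * d) ≡ a * c * (b * d)
  lem = solve-∀

∑-*ˡ : ∀ (xs : List 𝔸) c {f : 𝔸 → ℕ} → ∑[ x ∈ xs ] (c * f x) ≡ c * ∑ xs f
∑-*ˡ []       c = sym (*-zeroʳ c)
∑-*ˡ (x ∷ xs) c {f} = trans (cong (c * f x +_) (∑-*ˡ xs c)) (sym (*-distribˡ-+ c (f x) _))

∑-*ʳ : ∀ (xs : List 𝔸) c {f : 𝔸 → ℕ} → ∑[ x ∈ xs ] (f x * c) ≡ ∑ xs f * c
∑-*ʳ xs c {f} = trans (∑-cong xs (λ x → *-comm (f x) c)) (trans (∑-*ˡ xs c) (*-comm c _))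

∑-const : ∀ (xs : List 𝔸) c → ∑[ _ ∈ xs ] c ≡ length xs * c
∑-const []       c = refl
∑-const (x ∷ xs) c = cong (c +_) (∑-const xs c)

∏-const : ∀ (xs : List 𝔸) c → ∏[ _ ∈ xs ] c ≡ c ^ length xs
∏-const []       c = refl
∏-const (x ∷ xs) c = cong (c *_) (∏-const xs c)

∑-zero : ∀ (xs : List 𝔸) {f : 𝔸 → ℕ} → (∀ x → f x ≡ 0) → ∑ xs f ≡ 0
∑-zero xs e = trans (∑-cong xs e) (trans (∑-const xs 0) (*-zeroʳ (length xs)))

∑-swap : ∀ (xs : List 𝔸) (ys : List 𝔹) {f : 𝔸 → 𝔹 → ℕ} →
         ∑[ x ∈ xs ] ∑[ y ∈ ys ] f x y ≡ ∑[ y ∈ ys ] ∑[ x ∈ xs ] f x y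
∑-swap []       ys = sym (∑-zero ys (λ _ → refl))
∑-swap (x ∷ xs) ys {f} = trans (cong (∑ ys (f x) +_) (∑-swap xs ys)) (sym (∑-+ ys))

∑-product : ∀ (xs : List 𝔸) (ys : List 𝔹) {f : 𝔸 → ℕ} {g : 𝔹 → ℕ} →
            ∑[ x ∈ xs ] ∑[ y ∈ ys ] (f x * g y) ≡ ∑ xs f * ∑ ys g
∑-product xs ys {f} {g} = trans (∑-cong xs (λ x → ∑-*ˡ ys (f x))) (∑-*ʳ xs (∑ ys g))

^-∑ : ∀ (xs : List 𝔸) c {f : 𝔸 → ℕ} → c ^ ∑ xs f ≡ ∏[ x ∈ xs ] (c ^ f x)
^-∑ []       c = refl
^-∑ (x ∷ xs) c {f} = trans (^-distribˡ-+-* c (f x) _) (cong (c ^ f x *_) (^-∑ xs c))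

∏-sq : ∀ (xs : List 𝔸) {f : 𝔸 → ℕ} → ∏[ x ∈ xs ] sq (f x) ≡ sq (∏ xs f)
∏-sq xs = ∏-* xs

sq-cancel-≤ : ∀ {m n} → sq m ≤ sq n → m ≤ n
sq-cancel-≤ {m} {n} p = ≮⇒≥ λ n<m → <⇒≱ (*-mono-< n<m n<m) p

sq-* : ∀ m n → sq (m * n) ≡ sq m * sq n
sq-* = lem
  where
  lem : ∀ m n → m * n * (m * n) ≡ m * m * (n * n)
  lem = solve-∀

am-gm : ∀ {x y z} → sq x ≤ y * z → 2 * x ≤ y + z
am-gm {x} {y} {z} p = sq-cancel-≤ (≤-trans (≤-trans (≤-reflexive (e₁ x)) (*-monoʳ-≤ 4 p)) (four-≤ y z))
  where
  e₁ : ∀ x → 2 * x * (2 * x) ≡ 4 * (x * x)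
  e₁ = solve-∀
  e₂ : ∀ y d → 4 * (y * (y + d)) + d * d ≡ (y + (y + d)) * (y + (y + d))
  e₂ = solve-∀
  ordered : ∀ y d → 4 * (y * (y + d)) ≤ sq (y + (y + d))
  ordered y d = ≤-trans (m≤m+n _ (d * d)) (≤-reflexive (e₂ y d))
  four-≤ : ∀ y z → 4 * (y * z) ≤ sq (y + z)
  four-≤ y z with ≤-total y z
  ... | inj₁ y≤z = subst (λ z → 4 * (y * z) ≤ sq (y + z)) (m+[n∸m]≡n y≤z) (ordered y (z ∸ y))
  ... | inj₂ z≤y = subst₂ _≤_ (cong (4 *_) (*-comm z y)) (cong sq (+-comm z y))
    (subst (λ y → 4 * (z * y) ≤ sq (z + y)) (m+[n∸m]≡n z≤y) (ordered z (y ∸ z)))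

-- The butterfly network

bits↓ : ∀ n → List (Vec Bool n)
bits↓ zero    = [] ∷ []
bits↓ (suc n) = map (false ∷_) (bits↓ n) ++ map (true ∷_) (bits↓ n)

∑-bits : ∀ n {f : Vec Bool (suc n) → ℕ} →
         ∑ (bits↓ (suc n)) f ≡ ∑[ v ∈ bits↓ n ] f (false ∷ v) + ∑[ v ∈ bits↓ n ] f (true ∷ v)
∑-bits n = trans (∑-++ (map (false ∷_) (bits↓ n)) _)
  (cong₂ _+_ (∑-map (false ∷_) (bits↓ n)) (∑-map (true ∷_) (bits↓ n)))

∏-bits : ∀ n {f : Vec Bool (suc n) → ℕ} →
         ∏ (bits↓ (suc n)) f ≡ ∏[ v ∈ bits↓ n ] (f (false ∷ v) * f (true ∷ v))
∏-bits n = trans (∏-++ (map (false ∷_) (bits↓ n)) _)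
  (trans (cong₂ _*_ (∏-map (false ∷_) (bits↓ n)) (∏-map (true ∷_) (bits↓ n))) (sym (∏-* (bits↓ n))))

length-bits : ∀ n → length (bits↓ n) ≡ 2 ^ n
length-bits zero    = refl
length-bits (suc n) = begin
  length (bits↓ (suc n)) ≡⟨ List.length-++ (map (false ∷_) (bits↓ n)) ⟩
  length (map (false ∷_) (bits↓ n)) + length (map (true ∷_) (bits↓ n))
    ≡⟨ cong₂ _+_ (List.length-map _ (bits↓ n)) (List.length-map _ (bits↓ n)) ⟩
  length (bits↓ n) + length (bits↓ n) ≡⟨ cong₂ _+_ (length-bits n) (length-bits n) ⟩
  2 ^ n + 2 ^ n ≡⟨ cong (2 ^ n +_) (+-identityʳ (2 ^ n)) ⟨
  2 ^ suc n ∎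
  where open ≡-Reasoning

∑-bits-++ : ∀ m n {f : List Bool → ℕ} →
            ∑[ v ∈ bits↓ (m + n) ] f (toList v) ≡
            ∑[ u ∈ bits↓ m ] ∑[ v ∈ bits↓ n ] f (toList u ++ toList v)
∑-bits-++ zero    n = sym (+-identityʳ _)
∑-bits-++ (suc m) n {f} = trans (∑-bits (m + n))
  (trans (cong₂ _+_ (∑-bits-++ m n {λ l → f (false ∷ l)}) (∑-bits-++ m n {λ l → f (true ∷ l)}))
    (sym (∑-bits m)))

-- A full binary tree rather than a function on `Vec Bool n`: all trees can then be listed by
-- iterated cartesian products, and a sum over them splits into sums over the two subtrees.
Tree : Set → ℕ → Set
Tree 𝔸 zero    = 𝔸
Tree 𝔸 (suc n) = Tree 𝔸 n × Tree 𝔸 n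

leaf : ∀ {n} → Tree 𝔸 n → Vec Bool n → 𝔸
leaf t       []          = t
leaf (l , r) (false ∷ v) = leaf l v
leaf (l , r) (true ∷ v)  = leaf r v

trees : ∀ n → List (Tree Bool n)
trees zero    = false ∷ true ∷ []
trees (suc n) = cartesianProduct (trees n) (trees n)

-- The switches of a butterfly network with h layers on 2^(h+e) wires.  Layer i
-- may flip bit i of the position of a token; the two tokens that meet at a
-- switch differ in that bit only and leave it on different sides.
Net : ℕ → ℕ → Set
Net e zero    = ⊤
Net e (suc h) = Tree Bool (h + e) × (Net e h × Net e h)

nets : ∀ e h → List (Net e h)
nets e zero    = tt ∷ []
nets e (suc h) = cartesianProduct (trees (h + e)) (cartesianProduct (nets e h) (nets e h))

branch : Bool → 𝔸 × 𝔸 → 𝔸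
branch false = proj₁
branch true  = proj₂

-- The switch is addressed by the coordinates that the token has not yet exchanged; the bit it
-- receives selects which of the two remaining subnetworks carries it on.
path : ∀ {e} h → Net e h → Vec Bool (h + e) → Vec Bool h
path zero    _        _       = []
path (suc h) (s , ns) (c ∷ y) = let b = c xor leaf s y in b ∷ path h (branch b ns) y

-- Leaves are summed out one at a time. The constant `c` carries the factors of the other leaves:
-- `H` of those whose setting is still fixed, `G` of those already summed out. So only the estimate
-- `pair` for a single leaf is needed.
∑-trees-sq : ∀ n (U : Tree Bool n → ℕ) (H : Vec Bool n → Bool → ℕ) (G : Vec Bool n → ℕ) c →
  (∀ v c x y → sq x ≤ c * H v false → sq y ≤ c * H v true → sq (x + y) ≤ c * G v) →
  (∀ t → sq (U t) ≤ c * ∏[ v ∈ bits↓ n ] H v (leaf t v)) →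
  sq (∑ (trees n) U) ≤ c * ∏ (bits↓ n) G
∑-trees-sq zero U H G c pair hyp =
  subst₂ _≤_ (cong (λ z → sq (U false + z)) (sym (+-identityʳ (U true))))
    (cong (c *_) (sym (*-identityʳ (G []))))
    (pair [] c (U false) (U true) (subst (λ z → sq (U false) ≤ c * z) (*-identityʳ _) (hyp false))
      (subst (λ z → sq (U true) ≤ c * z) (*-identityʳ _) (hyp true)))
∑-trees-sq (suc n) U H G c pair hyp =
  subst₂ _≤_ (cong sq (sym (∑-cartesianProduct (trees n) (trees n))))
    (cong (c *_) (sym (∏-split G)))
    (subst (sq (∑[ l ∈ trees n ] ∑[ r ∈ trees n ] U (l , r)) ≤_) (rearrange c _ _) left)
  where
  ∏-split : ∀ (F : Vec Bool (suc n) → ℕ) →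
            ∏ (bits↓ (suc n)) F ≡ ∏[ v ∈ bits↓ n ] F (false ∷ v) * ∏[ v ∈ bits↓ n ] F (true ∷ v)
  ∏-split F = trans (∏-bits n) (∏-* (bits↓ n))
  G₁ : ℕ
  G₁ = ∏[ v ∈ bits↓ n ] G (true ∷ v)
  rearrange : ∀ a b c → a * c * b ≡ a * (b * c)
  rearrange = solve-∀
  right : ∀ l → sq (∑[ r ∈ trees n ] U (l , r)) ≤
          c * (∏[ v ∈ bits↓ n ] H (false ∷ v) (leaf l v)) * G₁
  right l = ∑-trees-sq n (λ r → U (l , r)) (λ v → H (true ∷ v)) (λ v → G (true ∷ v))
    (c * ∏[ v ∈ bits↓ n ] H (false ∷ v) (leaf l v))
    (λ v → pair (true ∷ v))
    (λ r → ≤-trans (hyp (l , r)) (≤-reflexive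
      (trans (cong (c *_) (∏-split (λ v → H v (leaf {n = suc n} (l , r) v))))
        (sym (*-assoc c (∏[ v ∈ bits↓ n ] H (false ∷ v) (leaf l v)) _)))))
  left : sq (∑[ l ∈ trees n ] ∑[ r ∈ trees n ] U (l , r)) ≤
         c * G₁ * ∏[ v ∈ bits↓ n ] G (false ∷ v)
  left = ∑-trees-sq n (λ l → ∑[ r ∈ trees n ] U (l , r)) (λ v → H (false ∷ v))
    (λ v → G (false ∷ v)) (c * G₁) (λ v → pair (false ∷ v))
    (λ l → ≤-trans (right l) (≤-reflexive (sym (swap c G₁ _))))
    where
    swap : ∀ a b c → a * b * c ≡ a * c * b
    swap = solve-∀

-- With `a c b` the mass of the paths that enter with bit `c` and leave with bit `b`, `x` belongs to
-- the straight and `y` to the crossed setting. The right side expands into four terms. The squares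
-- of `x` and `y` take two of them, and the cross term is at most the sum of the other two by the
-- inequality of the means, since both pairs have the same product.
switch-sq : ∀ (a : Bool → Bool → ℕ) c x y →
  sq x ≤ c * (a false false * a true true) → sq y ≤ c * (a true false * a false true) →
  sq (x + y) ≤ c * ((a false false + a false true) * (a true false + a true true))
switch-sq a c x y p q = begin
  sq (x + y) ≡⟨ expand x y ⟩
  sq x + sq y + 2 * (x * y) ≤⟨ +-mono-≤ (+-mono-≤ p q) (am-gm {x * y} {c * (f₀ * t₀)} {c * (f₁ * t₁)} cross) ⟩
  c * (f₀ * t₁) + c * (t₀ * f₁) + (c * (f₀ * t₀) + c * (f₁ * t₁))
                                         ≡⟨ collect c f₀ f₁ t₀ t₁ ⟩
  c * ((f₀ + f₁) * (t₀ + t₁)) ∎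
  where
  open ≤-Reasoning
  f₀ = a false false
  f₁ = a false true
  t₀ = a true false
  t₁ = a true true
  expand : ∀ x y → (x + y) * (x + y) ≡ x * x + y * y + 2 * (x * y)
  expand = solve-∀
  collect : ∀ c p q r s →
    c * (p * s) + c * (r * q) + (c * (p * r) + c * (q * s)) ≡ c * ((p + q) * (r + s))
  collect = solve-∀
  regroup : ∀ c p q r s → c * (p * s) * (c * (r * q)) ≡ c * (p * r) * (c * (q * s))
  regroup = solve-∀
  cross : sq (x * y) ≤ c * (f₀ * t₀) * (c * (f₁ * t₁))
  cross = begin
    sq (x * y) ≡⟨ sq-* x y ⟩
    sq x * sq y ≤⟨ *-mono-≤ p q ⟩
    c * (f₀ * t₁) * (c * (t₀ * f₁)) ≡⟨ regroup c f₀ f₁ t₀ t₁ ⟩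
    c * (f₀ * t₀) * (c * (f₁ * t₁)) ∎

-- The paths of different tokens are dependent, but by the Cauchy–Schwarz
-- inequality at every switch a product over all tokens is bounded as if they
-- were independent.
∑-nets-sq : ∀ e h (F : Vec Bool (h + e) → Vec Bool h → ℕ) →
  sq (∑[ n ∈ nets e h ] ∏[ x ∈ bits↓ (h + e) ] F x (path h n x)) ≤
  ∏[ x ∈ bits↓ (h + e) ] ∑[ p ∈ bits↓ h ] sq (F x p)
∑-nets-sq e zero F = ≤-reflexive (trans (cong sq (+-identityʳ (∏[ x ∈ bits↓ e ] F x [])))
  (trans (sym (∏-sq (bits↓ e) {λ x → F x []}))
    (∏-cong (bits↓ e) (λ x → sym (+-identityʳ (sq (F x [])))))))
∑-nets-sq e (suc h) F = subst₂ _≤_ (cong sq (sym sum-eq))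
  (trans (*-identityˡ _) (sym prod-eq))
  (∑-trees-sq (h + e) U H G 1 (λ v c x y → switch-sq (a v) c x y) hyp)
  where
  a : Vec Bool (h + e) → Bool → Bool → ℕ
  a y c b = ∑[ p ∈ bits↓ h ] sq (F (c ∷ y) (b ∷ p))
  H : Vec Bool (h + e) → Bool → ℕ
  H y b = a y b false * a y (not b) true
  G : Vec Bool (h + e) → ℕ
  G y = (a y false false + a y false true) * (a y true false + a y true true)
  prod-eq : ∏[ x ∈ bits↓ (suc h + e) ] ∑[ p ∈ bits↓ (suc h) ] sq (F x p) ≡ ∏ (bits↓ (h + e)) G
  prod-eq = trans (∏-bits (h + e))
    (∏-cong (bits↓ (h + e)) (λ y → cong₂ _*_ (∑-bits h) (∑-bits h)))
  -- Tokens are grouped by the side on which they leave, so that each group runs through one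
  -- subnetwork. The token leaving switch `y` on side false entered it with bit `leaf s y`.
  G₀ G₁ : Tree Bool (h + e) → Vec Bool (h + e) → Vec Bool h → ℕ
  G₀ s y p = F (leaf s y ∷ y) (false ∷ p)
  G₁ s y p = F (not (leaf s y) ∷ y) (true ∷ p)
  P₀ P₁ : Tree Bool (h + e) → Net e h → ℕ
  P₀ s n = ∏[ y ∈ bits↓ (h + e) ] G₀ s y (path h n y)
  P₁ s n = ∏[ y ∈ bits↓ (h + e) ] G₁ s y (path h n y)
  U : Tree Bool (h + e) → ℕ
  U s = ∑ (nets e h) (P₀ s) * ∑ (nets e h) (P₁ s)
  token : ∀ s ns y → F (false ∷ y) (path (suc h) (s , ns) (false ∷ y)) *
    F (true ∷ y) (path (suc h) (s , ns) (true ∷ y)) ≡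
    G₀ s y (path h (proj₁ ns) y) * G₁ s y (path h (proj₂ ns) y)
  token s ns y with leaf s y
  ... | false = refl
  ... | true  = *-comm (F (false ∷ y) _) _
  sum-eq : ∑[ n ∈ nets e (suc h) ] ∏[ x ∈ bits↓ (suc h + e) ] F x (path (suc h) n x) ≡
           ∑ (trees (h + e)) U
  sum-eq = trans (∑-cartesianProduct (trees (h + e)) _) (∑-cong (trees (h + e)) (λ s →
    trans (∑-cartesianProduct (nets e h) (nets e h))
      (trans (∑-cong (nets e h) (λ n₀ → ∑-cong (nets e h) (λ n₁ →
          trans (∏-bits (h + e)) (trans (∏-cong (bits↓ (h + e)) (token s (n₀ , n₁)))
            (∏-* (bits↓ (h + e)))))))
        (∑-product (nets e h) (nets e h)))))
  hyp : ∀ s → sq (U s) ≤ 1 * ∏[ y ∈ bits↓ (h + e) ] H y (leaf s y)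
  hyp s = begin
    sq (U s) ≡⟨ sq-* (∑ (nets e h) (P₀ s)) _ ⟩
    sq (∑ (nets e h) (P₀ s)) * sq (∑ (nets e h) (P₁ s))
      ≤⟨ *-mono-≤ (∑-nets-sq e h (G₀ s)) (∑-nets-sq e h (G₁ s)) ⟩
    ∏[ y ∈ bits↓ (h + e) ] a y (leaf s y) false * ∏[ y ∈ bits↓ (h + e) ] a y (not (leaf s y)) true
      ≡⟨ ∏-* (bits↓ (h + e)) ⟨
    ∏[ y ∈ bits↓ (h + e) ] H y (leaf s y) ≡⟨ *-identityˡ _ ⟨
    1 * ∏[ y ∈ bits↓ (h + e) ] H y (leaf s y) ∎
    where open ≤-Reasoning

length-cartesianProductWith : ∀ {A B C : Set} (f : A → B → C) xs ys →
  length (cartesianProductWith f xs ys) ≡ length xs * length ys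
length-cartesianProductWith f []       ys = refl
length-cartesianProductWith f (x ∷ xs) ys = trans (List.length-++ (map (f x) ys))
  (cong₂ _+_ (List.length-map _ ys) (length-cartesianProductWith f xs ys))

length-cartesianProduct : ∀ (xs : List 𝔸) (ys : List 𝔹) →
  length (cartesianProduct xs ys) ≡ length xs * length ys
length-cartesianProduct = length-cartesianProductWith _,_

length-trees : ∀ n → length (trees n) ≡ 2 ^ (2 ^ n)
length-trees zero    = refl
length-trees (suc n) = trans (length-cartesianProduct (trees n) (trees n))
  (trans (cong₂ _*_ (length-trees n) (length-trees n))
    (trans (sym (^-distribˡ-+-* 2 (2 ^ n) (2 ^ n)))
      (cong (λ z → 2 ^ (2 ^ n + z)) (sym (+-identityʳ (2 ^ n))))))

-- A layer on 2^L wires has 2^(L-1) switches, so the square of the count is the number (2^h)^(2^L)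
-- of ways to assign unrelated paths to all tokens. This is the normalisation under which
-- `∑-nets-sq` compares means without any loss.
sq-length-nets : ∀ e h → sq (length (nets e h)) ≡ 2 ^ (h * 2 ^ (h + e))
sq-length-nets e zero    = refl
sq-length-nets e (suc h) = begin
  sq (length (nets e (suc h)))
    ≡⟨ cong sq (trans (length-cartesianProduct (trees (h + e)) _)
         (cong₂ _*_ (length-trees (h + e)) (length-cartesianProduct (nets e h) (nets e h)))) ⟩
  sq (t * (z * z)) ≡⟨ lem t z ⟩
  (t * t) * (sq z * sq z) ≡⟨ cong (λ q → t * t * (q * q)) (sq-length-nets e h) ⟩
  (t * t) * (2 ^ (h * m) * 2 ^ (h * m)) ≡⟨ cong₂ _*_ (^-distribˡ-+-* 2 m m) (^-distribˡ-+-* 2 (h * m) (h * m)) ⟨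
  2 ^ (m + m) * 2 ^ (h * m + h * m) ≡⟨ ^-distribˡ-+-* 2 (m + m) _ ⟨
  2 ^ (m + m + (h * m + h * m)) ≡⟨ cong (2 ^_) (lem₂ h m) ⟩
  2 ^ (suc h * (2 * m)) ∎
  where
  open ≡-Reasoning
  m = 2 ^ (h + e)
  t = 2 ^ m
  z = length (nets e h)
  lem : ∀ t z → t * (z * z) * (t * (z * z)) ≡ t * t * (z * z * (z * z))
  lem = solve-∀
  lem₂ : ∀ h m → m + m + (h * m + h * m) ≡ (1 + h) * (2 * m)
  lem₂ = solve-∀

-- Positions of the tokens inside the network

pos : ℕ → List Bool → List Bool → List Bool
pos i p x = take i p ++ drop i x

route : ∀ {e} h → Net e h → ℕ → Vec Bool (h + e) → Vec Bool (h + e)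
route zero    _        _       y       = y
route (suc h) _        zero    y       = y
route (suc h) (s , ns) (suc i) (c ∷ y) = let b = c xor leaf s y in b ∷ route h (branch b ns) i y

-- The later layers are undone first, because the switch of the current layer is addressed by the
-- coordinates `y` that the token had before them.
unroute : ∀ {e} h → Net e h → ℕ → Vec Bool (h + e) → Vec Bool (h + e)
unroute zero    _        _       y       = y
unroute (suc h) _        zero    y       = y
unroute (suc h) (s , ns) (suc i) (b ∷ u) = let y = unroute h (branch b ns) i u in (b xor leaf s y) ∷ y

xor-cancel : ∀ a b → (a xor b) xor b ≡ a
xor-cancel false false = refl
xor-cancel false true  = refl
xor-cancel true  false = refl
xor-cancel true  true  = refl

unroute-route : ∀ {e} h (n : Net e h) i x → unroute h n i (route h n i x) ≡ x
unroute-route zero    n i x = refl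
unroute-route (suc h) n zero x = refl
unroute-route (suc h) (s , ns) (suc i) (c ∷ y)
  rewrite unroute-route h (branch (c xor leaf s y) ns) i y = cong (_∷ y) (xor-cancel c (leaf s y))

route-unroute : ∀ {e} h (n : Net e h) i y → route h n i (unroute h n i y) ≡ y
route-unroute zero    n i y = refl
route-unroute (suc h) n zero y = refl
route-unroute (suc h) (s , ns) (suc i) (b ∷ u)
  rewrite xor-cancel b (leaf s (unroute h (branch b ns) i u)) =
  cong (b ∷_) (route-unroute h (branch b ns) i u)

toList-route : ∀ {e} h (n : Net e h) i x → i ≤ h →
               toList (route h n i x) ≡ pos i (toList (path h n x)) (toList x)
toList-route zero    n zero x _ = refl
toList-route (suc h) n zero x _ = refl
toList-route (suc h) (s , ns) (suc i) (c ∷ y) (s≤s i≤h) = cong (_ ∷_) (toList-route h _ i y i≤h)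

-- Greedy choice of cells

missedBy : (𝔸 → ℕ → Bool) → List ℕ → 𝔸 → Bool
missedBy C R τ = not (any (C τ) R)

abstract
  -- A cell contained in more than a 1/r fraction of the sets is chosen as long as there is one.
  greedy : (τs : List 𝔸) (C : 𝔸 → ℕ → Bool) (M r : ℕ) →
    ∃[ R ] length R ≤ r ×
      (∀ c → c < M → r * ∑[ τ ∈ τs ] 𝟙 (C τ c ∧ missedBy C R τ) ≤ length τs)
  greedy τs C M r = go r [] ≤-refl
    (≤-reflexive (cong (r *_) (trans (∑-const τs 1) (*-identityʳ _))))
    where
    hits : List ℕ → ℕ → ℕ
    hits R c = ∑[ τ ∈ τs ] 𝟙 (C τ c ∧ missedBy C R τ)
    missed : List ℕ → ℕ
    missed R = ∑[ τ ∈ τs ] 𝟙 (missedBy C R τ)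
    hits≤missed : ∀ R c → hits R c ≤ missed R
    hits≤missed R c = ∑-mono τs λ τ → lem (C τ c) (missedBy C R τ)
      where
      lem : ∀ a b → 𝟙 (a ∧ b) ≤ 𝟙 b
      lem false b = z≤n
      lem true  b = ≤-refl
    search : ∀ R M → (∀ c → c < M → r * hits R c ≤ length τs) ⊎ (∃[ c ] length τs < r * hits R c)
    search R zero = inj₁ λ c ()
    search R (suc M) with r * hits R M ≤? length τs | search R M
    ... | no ¬p | _      = inj₂ (M , ≰⇒> ¬p)
    ... | yes p | inj₂ w  = inj₂ w
    ... | yes p | inj₁ f  = inj₁ λ c c<1+M → cover c (m≤n⇒m<n∨m≡n (s≤s⁻¹ c<1+M))
      where
      cover : ∀ c → c < M ⊎ c ≡ M → r * hits R c ≤ length τs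
      cover c (inj₁ c<M)  = f c c<M
      cover c (inj₂ refl) = p
    split : ∀ R c → missed (c ∷ R) + hits R c ≡ missed R
    split R c = trans (sym (∑-+ τs)) (∑-cong τs λ τ → lem (C τ c) (any (C τ) R))
      where
      lem : ∀ a b → 𝟙 (not (a ∨ b)) + 𝟙 (a ∧ not b) ≡ 𝟙 (not b)
      lem false b     = +-identityʳ _
      lem true  false = refl
      lem true  true  = refl
    -- Every chosen cell occurs in more than a 1/r fraction of the sets, none of them met before. So
    -- the bound on `r * missed R` drops by `length τs` with each choice and is zero once the fuel
    -- is gone.
    go : ∀ fuel R → length R + fuel ≤ r → r * missed R ≤ fuel * length τs →
         ∃[ R ] length R ≤ r × (∀ c → c < M → r * hits R c ≤ length τs)
    go zero R len bound = R , ≤-trans (m≤m+n _ 0) len , λ c _ →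
      ≤-trans (*-monoʳ-≤ r (hits≤missed R c)) (≤-trans bound z≤n)
    go (suc fuel) R len bound with search R M
    ... | inj₁ done = R , ≤-trans (m≤m+n _ (suc fuel)) len , done
    ... | inj₂ (c , many) = go fuel (c ∷ R) (≤-trans (≤-reflexive (sym (+-suc (length R) fuel))) len)
      (+-cancelˡ-≤ (length τs) _ _ (begin
        length τs + r * missed (c ∷ R) ≤⟨ +-monoˡ-≤ _ (<⇒≤ many) ⟩
        r * hits R c + r * missed (c ∷ R) ≡⟨ *-distribˡ-+ r (hits R c) _ ⟨
        r * (hits R c + missed (c ∷ R)) ≡⟨ cong (r *_) (trans (+-comm (hits R c) _) (split R c)) ⟩
        r * missed R ≤⟨ bound ⟩
        length τs + fuel * length τs ∎))
      where open ≤-Reasoning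

-- Windows and collisions

∏-cong-All : ∀ {A : Set} {P : A → Set} {xs : List A} {f g : A → ℕ} → All P xs →
             (∀ x → P x → f x ≡ g x) → ∏ xs f ≡ ∏ xs g
∏-cong-All []       e = refl
∏-cong-All (p ∷ ps) e = cong₂ _*_ (e _ p) (∏-cong-All ps e)

take-prefix : ∀ i (a c : List Bool) → i ≤ length a → take i (a ++ c) ≡ take i a
take-prefix zero    a       c _         = refl
take-prefix (suc i) (x ∷ a) c (s≤s i≤a) = cong (x ∷_) (take-prefix i a c i≤a)

length-++-toList : ∀ (a : List Bool) {n} (v : Vec Bool n) → length (a ++ toList v) ≡ length a + n
length-++-toList a v = trans (List.length-++ a) (cong (length a +_) (Vec.length-toList v))

slots : ℕ → ℕ → ℕ → List ℕ
slots w zero    s = []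
slots w (suc k) s = s ∷ slots w k (s + w)

length-slots : ∀ w k s → length (slots w k s) ≡ k
length-slots w zero    s = refl
length-slots w (suc k) s = cong suc (length-slots w k (s + w))

All-slots : ∀ w k s → All (λ σ → s ≤ σ × σ + w ≤ s + k * w) (slots w k s)
All-slots w zero    s = []
All-slots w (suc k) s = (≤-refl , +-monoʳ-≤ s (m≤m+n w (k * w))) ∷
  All.map (λ { (p , q) → ≤-trans (m≤m+n s w) p , ≤-trans q (≤-reflexive (+-assoc s w (k * w))) })
    (All-slots w k (s + w))

-- A window stays useful as soon as one of its queries advances, so a single labelled query level
-- can represent it.
firstLabel : (ℕ → Maybe ℕ) → List ℕ → Maybe ℕ
firstLabel l []       = nothing
firstLabel l (i ∷ is) with l i
... | just c  = just c
... | nothing = firstLabel l is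

firstLabel-cong : ∀ {P : ℕ → Set} {l l′ is} → All P is → (∀ i → P i → l i ≡ l′ i) →
                  firstLabel l is ≡ firstLabel l′ is
firstLabel-cong []       e = refl
firstLabel-cong {l = l} {l′} {is = i ∷ _} (p ∷ ps) e with l i | l′ i | e i p
... | just _  | _ | refl = refl
... | nothing | _ | refl = firstLabel-cong ps e

collides : List ℕ → Maybe ℕ → ℕ
collides past nothing  = 0
collides past (just c) = 𝟙 (any (_≡ᵇ c) past)

push : Maybe ℕ → List ℕ → List ℕ
push nothing  past = past
push (just c) past = c ∷ past

length-push : ∀ m past → length (push m past) ≤ suc (length past)
length-push nothing  past = n≤1+n _
length-push (just c) past = ≤-refl

collisions : List ℕ → List (Maybe ℕ) → ℕ
collisions past []       = 0
collisions past (m ∷ ms) = collides past m + collisions (push m past) ms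

_is_ : Maybe ℕ → ℕ → Bool
nothing is c = false
just c′ is c = c′ ≡ᵇ c

≡ᵇ-comm : ∀ m n → (m ≡ᵇ n) ≡ (n ≡ᵇ m)
≡ᵇ-comm zero    zero    = refl
≡ᵇ-comm zero    (suc n) = refl
≡ᵇ-comm (suc m) zero    = refl
≡ᵇ-comm (suc m) (suc n) = ≡ᵇ-comm m n

-- The exponential weight is replaced by a union bound linear in the indicators, so that only the
-- number of window contents leading to one given cell matters.
weight≤ : ∀ β past m → β ^ collides past m ≤ 1 + ∑[ c ∈ past ] (β * 𝟙 (m is c))
weight≤ β past       nothing  = s≤s z≤n
weight≤ β []         (just d) = s≤s z≤n
weight≤ β (c ∷ past) (just d) rewrite ≡ᵇ-comm d c with c ≡ᵇ d
... | false = ≤-trans (weight≤ β past (just d)) (s≤s (m≤n+m _ (β * 0)))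
... | true  = ≤-trans (m≤m+n (β * 1) _) (n≤1+n _)

-- A window of scale 0 is a buffer of b 0 levels followed by a query level.  A
-- window of scale t+1 is a buffer of b (t+1) levels without queries followed by
-- K windows of scale t.
module Windows (b : ℕ → ℕ) (K : ℕ) where

  W body : ℕ → ℕ
  W t = b t + body t
  body zero    = 0
  body (suc t) = K * W t

  kids : ℕ → ℕ → List ℕ
  kids t s = slots (W t) K (s + b (suc t))

  queryLevels : ℕ → ℕ → List ℕ
  queryLevels zero    s = s + W 0 ∷ []
  queryLevels (suc t) s = concatMap (queryLevels t) (kids t s)

  starts : ℕ → ℕ → List ℕ
  starts zero    t = 0 ∷ []
  starts (suc d) t = concatMap (kids t) (starts d (suc t))

  top : ℕ → ℕ → ℕ
  top zero    t = t
  top (suc d) t = top d (suc t)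

  top-+ : ∀ d t → top d t ≡ d + t
  top-+ zero    t = refl
  top-+ (suc d) t = trans (top-+ d (suc t)) (+-suc d t)

  length-starts : ∀ d t → length (starts d t) ≡ K ^ d
  length-starts zero    t = refl
  length-starts (suc d) t = begin
    length (starts (suc d) t) ≡⟨ trans (∑-const (starts (suc d) t) 1) (*-identityʳ _) ⟨
    ∑[ _ ∈ starts (suc d) t ] 1 ≡⟨ ∑-concatMap (kids t) (starts d (suc t)) ⟩
    ∑[ s ∈ starts d (suc t) ] ∑[ _ ∈ kids t s ] 1
      ≡⟨ ∑-cong (starts d (suc t)) (λ s → trans (∑-const (kids t s) 1)
           (trans (*-identityʳ _) (length-slots (W t) K _))) ⟩
    ∑[ _ ∈ starts d (suc t) ] K ≡⟨ ∑-const (starts d (suc t)) K ⟩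
    length (starts d (suc t)) * K ≡⟨ cong (_* K) (length-starts d (suc t)) ⟩
    K ^ d * K ≡⟨ *-comm (K ^ d) K ⟩
    K ^ suc d ∎
    where open ≡-Reasoning

  All-kids : ∀ t s → All (λ σ → s + b (suc t) ≤ σ × σ + W t ≤ s + W (suc t)) (kids t s)
  All-kids t s = All.map (λ { (p , q) → p , ≤-trans q (≤-reflexive (+-assoc s _ _)) })
    (All-slots (W t) K (s + b (suc t)))

  All-queryLevels : ∀ t s → All (λ i → s + b t ≤ i × i ≤ s + W t) (queryLevels t s)
  All-queryLevels zero    s = (+-monoʳ-≤ s (m≤m+n (b 0) 0) , ≤-refl) ∷ []
  All-queryLevels (suc t) s = All.concat⁺ (All.map⁺ (All.map (λ { {σ} (p , q) →
    All.map (λ { (p′ , q′) → ≤-trans p (≤-trans (m≤m+n σ (b t)) p′) , ≤-trans q′ q })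
      (All-queryLevels t σ) }) (All-kids t s)))

  All-starts : ∀ d t → All (λ s → s + W t ≤ W (top d t)) (starts d t)
  All-starts zero    t = ≤-refl ∷ []
  All-starts (suc d) t = All.concat⁺ (All.map⁺ (All.map (λ { {s} p →
    All.map (λ (_ , q) → ≤-trans q p) (All-kids t s) }) (All-starts d (suc t))))

  -- A supermartingale condition: `φ s` looks no further than the end of its window, and for every
  -- path `a` before the window its mean over the bits of the window is at most `G`. The bounds of
  -- successive windows then multiply although a label may depend on the whole earlier path.
  record Bounded (t : ℕ) (φ : ℕ → List Bool → ℕ) (G : ℕ) : Set where
    field
      local : ∀ s a c → s + W t ≤ length a → φ s (a ++ c) ≡ φ s a
      bound : ∀ s a → length a ≡ s →
              ∑[ v ∈ bits↓ (W t) ] φ s (a ++ toList v) ≤ 2 ^ W t * G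

  open Bounded

  buffered : ∀ t s a (f : List Bool → ℕ) G → length a ≡ s →
    (∀ a → length a ≡ s + b t → ∑[ v ∈ bits↓ (body t) ] f (a ++ toList v) ≤ 2 ^ body t * G) →
    ∑[ v ∈ bits↓ (W t) ] f (a ++ toList v) ≤ 2 ^ W t * G
  buffered t s a f G len hyp = begin
    ∑[ v ∈ bits↓ (W t) ] f (a ++ toList v) ≡⟨ ∑-bits-++ (b t) (body t) {λ l → f (a ++ l)} ⟩
    ∑[ u ∈ bits↓ (b t) ] ∑[ v ∈ bits↓ (body t) ] f (a ++ (toList u ++ toList v))
      ≤⟨ ∑-mono (bits↓ (b t)) (λ u → ≤-trans
           (≤-reflexive (∑-cong (bits↓ (body t)) λ v → cong f (sym (List.++-assoc a (toList u) _))))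
           (hyp (a ++ toList u) (trans (length-++-toList a u) (cong (_+ b t) len)))) ⟩
    ∑[ _ ∈ bits↓ (b t) ] (2 ^ body t * G) ≡⟨ ∑-const (bits↓ (b t)) _ ⟩
    length (bits↓ (b t)) * (2 ^ body t * G) ≡⟨ cong (_* (2 ^ body t * G)) (length-bits (b t)) ⟩
    2 ^ b t * (2 ^ body t * G) ≡⟨ *-assoc (2 ^ b t) _ G ⟨
    2 ^ b t * 2 ^ body t * G ≡⟨ cong (_* G) (^-distribˡ-+-* 2 (b t) (body t)) ⟨
    2 ^ W t * G ∎
    where open ≤-Reasoning

  -- The later windows are summed first: their bound is uniform in the past, and the factor of the
  -- first window does not depend on their bits.
  slots-bound : ∀ {t φ G} → Bounded t φ G → ∀ k s a → length a ≡ s →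
    ∑[ v ∈ bits↓ (k * W t) ] ∏[ σ ∈ slots (W t) k s ] φ σ (a ++ toList v) ≤ 2 ^ (k * W t) * G ^ k
  slots-bound B zero s a len = ≤-refl
  slots-bound {t} {φ} {G} B (suc k) s a len = begin
    ∑[ v ∈ bits↓ (w + k * w) ] f (toList v) ≡⟨ ∑-bits-++ w (k * w) {f} ⟩
    ∑[ u ∈ bits↓ w ] ∑[ v ∈ bits↓ (k * w) ] f (toList u ++ toList v)
      ≤⟨ ∑-mono (bits↓ w) (λ u → ≤-trans (≤-reflexive (trans
             (∑-cong (bits↓ (k * w)) (λ v → cong₂ _*_ (first u (toList v)) (others u (toList v))))
             (∑-*ˡ (bits↓ (k * w)) (φ s (a ++ toList u)))))
           (*-monoʳ-≤ (φ s (a ++ toList u)) (slots-bound B k (s + w) (a ++ toList u) (len′ u)))) ⟩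
    ∑[ u ∈ bits↓ w ] (φ s (a ++ toList u) * (2 ^ (k * w) * G ^ k))
      ≡⟨ ∑-*ʳ (bits↓ w) _ ⟩
    ∑[ u ∈ bits↓ w ] φ s (a ++ toList u) * (2 ^ (k * w) * G ^ k)
      ≤⟨ *-monoˡ-≤ _ (B .bound s a len) ⟩
    2 ^ w * G * (2 ^ (k * w) * G ^ k) ≡⟨ lem (2 ^ w) G (2 ^ (k * w)) (G ^ k) ⟩
    2 ^ w * 2 ^ (k * w) * (G * G ^ k) ≡⟨ cong (_* G ^ suc k) (^-distribˡ-+-* 2 w (k * w)) ⟨
    2 ^ (suc k * w) * G ^ suc k ∎
    where
    open ≤-Reasoning
    w = W t
    f : List Bool → ℕ
    f l = ∏[ σ ∈ slots w (suc k) s ] φ σ (a ++ l)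
    lem : ∀ p q r s → p * q * (r * s) ≡ p * r * (q * s)
    lem = solve-∀
    len′ : ∀ (u : Vec Bool w) → length (a ++ toList u) ≡ s + w
    len′ u = trans (length-++-toList a u) (cong (_+ w) len)
    first : ∀ u l → φ s (a ++ (toList u ++ l)) ≡ φ s (a ++ toList u)
    first u l = trans (cong (φ s) (sym (List.++-assoc a (toList u) l)))
      (B .local s _ l (≤-reflexive (sym (len′ u))))
    others : ∀ (u : Vec Bool w) l → ∏[ σ ∈ slots w k (s + w) ] φ σ (a ++ (toList u ++ l)) ≡
           ∏[ σ ∈ slots w k (s + w) ] φ σ ((a ++ toList u) ++ l)
    others u l = cong (λ z → ∏[ σ ∈ slots w k (s + w) ] φ σ z) (sym (List.++-assoc a (toList u) l))

  kids-bounded : ∀ {t φ G} → Bounded t φ G →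
                 Bounded (suc t) (λ s p → ∏[ σ ∈ kids t s ] φ σ p) (G ^ K)
  kids-bounded {t} {φ} B .local s a c len = ∏-cong-All (All-kids t s)
    (λ σ (_ , q) → B .local σ a c (≤-trans q len))
  kids-bounded {t} {φ} {G} B .bound s a len =
    buffered (suc t) s a (λ p → ∏[ σ ∈ kids t s ] φ σ p) (G ^ K) len
      (slots-bound B K (s + b (suc t)))

  starts-bound : ∀ d {t φ G} → Bounded t φ G →
    ∑[ p ∈ bits↓ (W (top d t)) ] ∏[ s ∈ starts d t ] φ s (toList p) ≤ 2 ^ W (top d t) * G ^ (K ^ d)
  starts-bound zero {t} {φ} {G} B = subst₂ _≤_
    (∑-cong (bits↓ (W t)) (λ p → sym (*-identityʳ _)))
    (cong (2 ^ W t *_) (sym (*-identityʳ G))) (B .bound 0 [] refl)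
  starts-bound (suc d) {t} {φ} {G} B = subst₂ _≤_
    (∑-cong (bits↓ (W (top (suc d) t))) (λ p → sym (∏-concatMap (kids t) (starts d (suc t)))))
    (cong (2 ^ W (top (suc d) t) *_) (^-*-assoc G K (K ^ d)))
    (starts-bound d (kids-bounded B))

  module Labels (lab : ℕ → List Bool → Maybe ℕ) where

    label : ℕ → ℕ → List Bool → Maybe ℕ
    label t s p = firstLabel (λ i → lab i (take i p)) (queryLevels t s)

    label-local : ∀ t s a c → s + W t ≤ length a → label t s (a ++ c) ≡ label t s a
    label-local t s a c len = firstLabel-cong (All-queryLevels t s)
      (λ i (_ , i≤) → cong (lab i) (take-prefix i a c (≤-trans i≤ len)))

    kidLabels : ℕ → ℕ → List Bool → List (Maybe ℕ)
    kidLabels t s p = map (λ σ → label t σ p) (kids t s)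

    totalCollisions : ℕ → List ℕ → ℕ → List Bool → ℕ
    totalCollisions t init d p = ∑[ s ∈ starts d (suc t) ] collisions init (kidLabels t s p)

    module _ (t β Λ : ℕ) (init : List ℕ)
      (load : ∀ c s a → length a ≡ s →
              ∑[ v ∈ bits↓ (W t) ] 𝟙 (label t s (a ++ toList v) is c) ≤ Λ * 2 ^ body t)
      (small : (length init + K) * (β * Λ) ≤ 2 ^ b t) where

      private w = W t

      -- A given past cell is the label for at most a fraction `Λ / 2 ^ b t` of the window contents,
      -- so by `small` the weighted union over all past cells adds at most 1 to the mean. A factor 2
      -- per window is the whole price of the weight `β`.
      label-weight : ∀ past s a → length past ≤ length init + K → length a ≡ s →
        ∑[ v ∈ bits↓ w ] (β ^ collides past (label t s (a ++ toList v))) ≤ 2 ^ w * 2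
      label-weight past s a short len = begin
        ∑[ v ∈ bits↓ w ] (β ^ collides past (label t s (a ++ toList v)))
          ≤⟨ ∑-mono (bits↓ w) (λ v → weight≤ β past (label t s (a ++ toList v))) ⟩
        ∑[ v ∈ bits↓ w ] (1 + ∑[ c ∈ past ] (β * 𝟙 (label t s (a ++ toList v) is c)))
          ≡⟨ ∑-+ (bits↓ w) ⟩
        ∑[ _ ∈ bits↓ w ] 1 + ∑[ v ∈ bits↓ w ] ∑[ c ∈ past ] (β * 𝟙 (label t s (a ++ toList v) is c))
          ≡⟨ cong₂ _+_ (trans (∑-const (bits↓ w) 1) (trans (*-identityʳ _) (length-bits w)))
               (∑-swap (bits↓ w) past) ⟩
        2 ^ w + ∑[ c ∈ past ] ∑[ v ∈ bits↓ w ] (β * 𝟙 (label t s (a ++ toList v) is c))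
          ≤⟨ +-monoʳ-≤ (2 ^ w) (∑-mono past (λ c → ≤-trans (≤-reflexive (∑-*ˡ (bits↓ w) β))
               (*-monoʳ-≤ β (load c s a len)))) ⟩
        2 ^ w + ∑[ _ ∈ past ] (β * (Λ * 2 ^ body t))
          ≡⟨ cong (2 ^ w +_) (∑-const past _) ⟩
        2 ^ w + length past * (β * (Λ * 2 ^ body t))
          ≡⟨ cong (2 ^ w +_) (lem (length past) β Λ (2 ^ body t)) ⟩
        2 ^ w + length past * (β * Λ) * 2 ^ body t
          ≤⟨ +-monoʳ-≤ (2 ^ w) (*-monoˡ-≤ (2 ^ body t) (≤-trans (*-monoˡ-≤ (β * Λ) short) small)) ⟩
        2 ^ w + 2 ^ b t * 2 ^ body t
          ≡⟨ cong (2 ^ w +_) (^-distribˡ-+-* 2 (b t) (body t)) ⟨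
        2 ^ w + 2 ^ w ≡⟨ double (2 ^ w) ⟩
        2 ^ w * 2 ∎
        where
        open ≤-Reasoning
        lem : ∀ p q r s → p * (q * (r * s)) ≡ p * (q * r) * s
        lem = solve-∀
        double : ∀ x → x + x ≡ x * 2
        double = solve-∀

      -- The past grows by at most one label per window; the hypothesis on `length past + k` keeps
      -- it short enough for `label-weight` throughout.
      collisions-weight : ∀ k past s a → length past + k ≤ length init + K → length a ≡ s →
        ∑[ v ∈ bits↓ (k * w) ] (β ^ collisions past (map (λ σ → label t σ (a ++ toList v)) (slots w k s)))
        ≤ 2 ^ (k * w) * 2 ^ k
      collisions-weight zero    past s a short len = ≤-refl
      collisions-weight (suc k) past s a short len = begin
        ∑[ v ∈ bits↓ (w + k * w) ] f (toList v) ≡⟨ ∑-bits-++ w (k * w) {f} ⟩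
        ∑[ u ∈ bits↓ w ] ∑[ v ∈ bits↓ (k * w) ] f (toList u ++ toList v)
          ≤⟨ ∑-mono (bits↓ w) (λ u → ≤-trans (≤-reflexive (trans
                 (∑-cong (bits↓ (k * w)) (λ v → split u (toList v)))
                 (∑-*ˡ (bits↓ (k * w)) (g u))))
               (*-monoʳ-≤ (g u) (collisions-weight k (push (m u) past) (s + w) (a ++ toList u)
                 (short′ u) (len′ u)))) ⟩
        ∑[ u ∈ bits↓ w ] (g u * (2 ^ (k * w) * 2 ^ k)) ≡⟨ ∑-*ʳ (bits↓ w) _ ⟩
        ∑ (bits↓ w) g * (2 ^ (k * w) * 2 ^ k)
          ≤⟨ *-monoˡ-≤ _ (label-weight past s a (m+n≤o⇒m≤o _ short) len) ⟩
        2 ^ w * 2 * (2 ^ (k * w) * 2 ^ k) ≡⟨ lem (2 ^ w) 2 (2 ^ (k * w)) (2 ^ k) ⟩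
        2 ^ w * 2 ^ (k * w) * (2 * 2 ^ k) ≡⟨ cong (_* 2 ^ suc k) (^-distribˡ-+-* 2 w (k * w)) ⟨
        2 ^ (suc k * w) * 2 ^ suc k ∎
        where
        open ≤-Reasoning
        lem : ∀ p q r s → p * q * (r * s) ≡ p * r * (q * s)
        lem = solve-∀
        f : List Bool → ℕ
        f l = β ^ collisions past (map (λ σ → label t σ (a ++ l)) (slots w (suc k) s))
        m : Vec Bool w → Maybe ℕ
        m u = label t s (a ++ toList u)
        g : Vec Bool w → ℕ
        g u = β ^ collides past (m u)
        len′ : ∀ (u : Vec Bool w) → length (a ++ toList u) ≡ s + w
        len′ u = trans (length-++-toList a u) (cong (_+ w) len)
        short′ : ∀ u → length (push (m u) past) + k ≤ length init + K
        short′ u = ≤-trans (+-monoˡ-≤ k (length-push (m u) past))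
          (≤-trans (≤-reflexive (sym (+-suc (length past) k))) short)
        split : ∀ u l → f (toList u ++ l) ≡ g u *
          β ^ collisions (push (m u) past) (map (λ σ → label t σ ((a ++ toList u) ++ l)) (slots w k (s + w)))
        split u l
          rewrite sym (List.++-assoc a (toList u) l)
                | label-local t s (a ++ toList u) l (≤-reflexive (sym (len′ u))) =
          ^-distribˡ-+-* β (collides past (m u)) _

      collisions-bounded : Bounded (suc t) (λ s p → β ^ collisions init (kidLabels t s p)) (2 ^ K)
      collisions-bounded .local s a c len = cong (λ z → β ^ collisions init z)
        (map-cong-All (All-kids t s) (λ σ (_ , q) → label-local t σ a c (≤-trans q len)))
        where
        map-cong-All : ∀ {P : ℕ → Set} {xs : List ℕ} {f g : ℕ → Maybe ℕ} → All P xs →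
                       (∀ x → P x → f x ≡ g x) → map f xs ≡ map g xs
        map-cong-All []       e = refl
        map-cong-All (p ∷ ps) e = cong₂ _∷_ (e _ p) (map-cong-All ps e)
      collisions-bounded .bound s a len =
        buffered (suc t) s a (λ p → β ^ collisions init (kidLabels t s p)) (2 ^ K) len
          (λ a′ → collisions-weight K init (s + b (suc t)) a′ ≤-refl)

      -- There are `K ^ suc d` windows of scale `t` in the top window, and each contributes a factor
      -- 2.
      totalCollisions-bound : ∀ d →
        ∑[ p ∈ bits↓ (W (top d (suc t))) ] (β ^ totalCollisions t init d (toList p)) ≤
        2 ^ (W (top d (suc t)) + K ^ suc d)
      totalCollisions-bound d = begin
        ∑[ p ∈ bits↓ h ] (β ^ totalCollisions t init d (toList p))
          ≡⟨ ∑-cong (bits↓ h) (λ p → ^-∑ (starts d (suc t)) β) ⟩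
        ∑[ p ∈ bits↓ h ] ∏[ s ∈ starts d (suc t) ] (β ^ collisions init (kidLabels t s (toList p)))
          ≤⟨ starts-bound d collisions-bounded ⟩
        2 ^ h * (2 ^ K) ^ (K ^ d) ≡⟨ cong (2 ^ h *_) (^-*-assoc 2 K (K ^ d)) ⟩
        2 ^ h * 2 ^ (K ^ suc d) ≡⟨ ^-distribˡ-+-* 2 h _ ⟨
        2 ^ (h + K ^ suc d) ∎
        where
        open ≤-Reasoning
        h = W (top d (suc t))

-- Counting labels, and the load of a single cell

≤⇒≤ᵇ≡true : ∀ {m n} → m ≤ n → (m ≤ᵇ n) ≡ true
≤⇒≤ᵇ≡true {m} {n} p with m ≤ᵇ n in eq
... | true  = refl
... | false = contradiction (subst T eq (≤⇒≤ᵇ p)) (λ ())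

≡ᵇ-refl : ∀ n → (n ≡ᵇ n) ≡ true
≡ᵇ-refl zero    = refl
≡ᵇ-refl (suc n) = ≡ᵇ-refl n

≡ᵇ-sound : ∀ m n → (m ≡ᵇ n) ≡ true → m ≡ n
≡ᵇ-sound zero    zero    _ = refl
≡ᵇ-sound (suc m) (suc n) e = cong suc (≡ᵇ-sound m n e)

is-sound : ∀ m c → (m is c) ≡ true → m ≡ just c
is-sound (just c′) c e = cong just (≡ᵇ-sound c′ c e)

∑-downFrom-term : ∀ n i {f : ℕ → ℕ} → i < n → f i ≤ ∑ (downFrom n) f
∑-downFrom-term (suc n) i {f} i<1+n with m≤n⇒m<n∨m≡n (s≤s⁻¹ i<1+n)
... | inj₁ i<n  = ≤-trans (∑-downFrom-term n i i<n) (m≤n+m _ (f n))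
... | inj₂ refl = m≤m+n (f n) _

∑-bits-term : ∀ n {f : List Bool → ℕ} l → length l ≡ n → f l ≤ ∑[ v ∈ bits↓ n ] f (toList v)
∑-bits-term zero    []          _ = m≤m+n _ 0
∑-bits-term (suc n) {f} (false ∷ l) e = ≤-trans (∑-bits-term n {λ l → f (false ∷ l)} l (suc-injective e))
  (≤-trans (m≤m+n _ _) (≤-reflexive (sym (∑-bits n))))
∑-bits-term (suc n) {f} (true ∷ l)  e = ≤-trans (∑-bits-term n {λ l → f (true ∷ l)} l (suc-injective e))
  (≤-trans (m≤n+m _ (∑[ v ∈ bits↓ n ] f (false ∷ toList v))) (≤-reflexive (sym (∑-bits n))))

𝟙≤ : ∀ {b n} → (b ≡ true → 1 ≤ n) → 𝟙 b ≤ n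
𝟙≤ {true}  f = f refl
𝟙≤ {false} f = z≤n

firstLabel-just : ∀ {P : ℕ → Set} {l is c} → All P is → firstLabel l is ≡ just c →
                  ∃[ i ] P i × l i ≡ just c
firstLabel-just {l = l} {i ∷ _} (p ∷ ps) e with l i in eq
... | just _  = i , p , trans eq e
... | nothing = firstLabel-just ps e

firstLabel-nothing : ∀ {l is} → firstLabel l is ≡ nothing → All (λ i → l i ≡ nothing) is
firstLabel-nothing {is = []} e = []
firstLabel-nothing {l} {i ∷ is} e with l i in eq
... | nothing = eq ∷ firstLabel-nothing e

isNothing : Maybe ℕ → Bool
isNothing nothing  = true
isNothing (just _) = false

firstLabel-isNothing : ∀ {l is} → isNothing (firstLabel l is) ≡ true → All (λ i → l i ≡ nothing) is
firstLabel-isNothing {l} {is} e with firstLabel l is in eq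
... | nothing = firstLabel-nothing eq

_bounded-by_ : Maybe ℕ → ℕ → Set
m bounded-by n = ∀ c → m ≡ just c → c < n

-- A label is absent, or it collides, or it is the first one with its value.
labels-count : ∀ M past ms → All (_bounded-by M) ms →
  length ms ≤ ∑[ m ∈ ms ] 𝟙 (isNothing m) + collisions past ms +
              ∑[ c ∈ downFrom M ] 𝟙 (any (_is c) ms ∧ not (any (_≡ᵇ c) past))
labels-count M past [] _ = z≤n
labels-count M past (nothing ∷ ms) (_ ∷ ok) = s≤s (labels-count M past ms ok)
labels-count M past (just d ∷ ms) (d<M ∷ ok) = begin
  suc (length ms)
    ≤⟨ s≤s (labels-count M (d ∷ past) ms ok) ⟩
  suc (N + collisions (d ∷ past) ms + ∑ (downFrom M) new)
    ≡⟨ lem N (collisions (d ∷ past) ms) (∑ (downFrom M) new) ⟩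
  N + collisions (d ∷ past) ms + (1 + ∑ (downFrom M) new)
    ≤⟨ +-monoʳ-≤ (N + collisions (d ∷ past) ms) (seen (any (_≡ᵇ d) past) refl) ⟩
  N + collisions (d ∷ past) ms + (𝟙 (any (_≡ᵇ d) past) + ∑ (downFrom M) old)
    ≡⟨ lem₂ N (collisions (d ∷ past) ms) (𝟙 (any (_≡ᵇ d) past)) _ ⟩
  N + (𝟙 (any (_≡ᵇ d) past) + collisions (d ∷ past) ms) + ∑ (downFrom M) old ∎
  where
  open ≤-Reasoning
  N = ∑[ m ∈ ms ] 𝟙 (isNothing m)
  new old : ℕ → ℕ
  new c = 𝟙 (any (_is c) ms ∧ not (any (_≡ᵇ c) (d ∷ past)))
  old c = 𝟙 (any (_is c) (just d ∷ ms) ∧ not (any (_≡ᵇ c) past))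
  lem : ∀ a b c → suc (a + b + c) ≡ a + b + (1 + c)
  lem = solve-∀
  lem₂ : ∀ a b c d → a + b + (c + d) ≡ a + (c + b) + d
  lem₂ = solve-∀
  new≤old : ∀ c → new c ≤ old c
  new≤old c with d ≡ᵇ c | any (_is c) ms | any (_≡ᵇ c) past
  ... | true  | true  | _     = z≤n
  ... | true  | false | _     = z≤n
  ... | false | _     | _     = ≤-refl
  step : any (_≡ᵇ d) past ≡ false → ∀ c → 𝟙 (d ≡ᵇ c) + new c ≤ old c
  step e c with d ≡ᵇ c in eq
  ... | false = ≤-refl
  ... | true with ≡ᵇ-sound d c eq
  ...   | refl rewrite e with any (_is d) ms
  ...     | true  = ≤-refl
  ...     | false = ≤-refl
  seen : ∀ v → any (_≡ᵇ d) past ≡ v → 1 + ∑ (downFrom M) new ≤ 𝟙 v + ∑ (downFrom M) old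
  seen true  e = s≤s (∑-mono (downFrom M) new≤old)
  seen false e = ≤-trans (+-monoˡ-≤ _ (≤-trans (≤-reflexive (cong 𝟙 (sym (≡ᵇ-refl d))))
      (∑-downFrom-term M d {λ c → 𝟙 (d ≡ᵇ c)} (d<M d refl))))
    (≤-trans (≤-reflexive (sym (∑-+ (downFrom M)))) (∑-mono (downFrom M) (step e)))

take-++-+ : ∀ (a l : List Bool) k → take (length a + k) (a ++ l) ≡ a ++ take k l
take-++-+ []      l k = refl
take-++-+ (x ∷ a) l k = cong (x ∷_) (take-++-+ a l k)

module _ (b : ℕ → ℕ) (K : ℕ) where
  open Windows b K

  -- Distinct contents of the buffer of a window lead to distinct queries at every later level.
  module Load (h e Λ : ℕ) (LAB : ℕ → List Bool → Maybe ℕ) (x : Vec Bool (h + e))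
    (guard : ∀ i y c → LAB i y ≡ just c → i ≤ h)
    (total : ∀ c → ∑[ i ∈ downFrom (suc h) ] ∑[ y ∈ bits↓ (h + e) ] 𝟙 (LAB i (toList y) is c) ≤ Λ)
    where

    lab : ℕ → List Bool → Maybe ℕ
    lab i q = LAB i (q ++ drop i (toList x))

    open Labels lab

    -- With the rest `v` of the path fixed, the position at a level after the buffer is
    -- `a ++ u ++ z` with `z` independent of the buffer bits `u`. Different `u` thus address
    -- different queries, and the sum over `u` is part of the sum over all positions.
    level-load : ∀ t s a c j → length a ≡ s → s + (b t + j) ≤ h → j ≤ body t → ∀ (v : Vec Bool (body t)) →
      ∑[ u ∈ bits↓ (b t) ] 𝟙 (lab (s + (b t + j)) (take (s + (b t + j)) (a ++ (toList u ++ toList v))) is c) ≤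
      ∑[ y ∈ bits↓ (h + e) ] 𝟙 (LAB (s + (b t + j)) (toList y) is c)
    level-load t s a c j len i≤h j≤ v = main
      where
      i = s + (b t + j)
      o = j + (h + e ∸ i)
      z = take j (toList v) ++ drop i (toList x)
      f : List Bool → ℕ
      f y = 𝟙 (LAB i y is c)
      lenz : length z ≡ o
      lenz = trans (List.length-++ (take j (toList v))) (cong₂ _+_
        (trans (List.length-take j (toList v)) (trans (cong (j ⊓_) (Vec.length-toList v)) (m≤n⇒m⊓n≡m j≤)))
        (trans (List.length-drop i (toList x)) (cong (_∸ i) (Vec.length-toList x))))
      size : s + (b t + o) ≡ h + e
      size = trans (lem s (b t) j _) (m+[n∸m]≡n (≤-trans i≤h (m≤m+n h e)))
        where
        lem : ∀ a b c d → a + (b + (c + d)) ≡ a + (b + c) + d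
        lem = solve-∀
      position : ∀ (u : Vec Bool (b t)) → take i (a ++ (toList u ++ toList v)) ++ drop i (toList x) ≡
                 a ++ (toList u ++ z)
      position u = begin
        take i (a ++ (toList u ++ toList v)) ++ drop i (toList x)
          ≡⟨ cong (λ k → take (k + (b t + j)) (a ++ (toList u ++ toList v)) ++ drop i (toList x)) (sym len) ⟩
        take (length a + (b t + j)) (a ++ (toList u ++ toList v)) ++ drop i (toList x)
          ≡⟨ cong (_++ drop i (toList x)) (take-++-+ a _ (b t + j)) ⟩
        (a ++ take (b t + j) (toList u ++ toList v)) ++ drop i (toList x)
          ≡⟨ cong (λ k → (a ++ take (k + j) (toList u ++ toList v)) ++ drop i (toList x))
               (sym (Vec.length-toList u)) ⟩
        (a ++ take (length (toList u) + j) (toList u ++ toList v)) ++ drop i (toList x)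
          ≡⟨ cong (λ l → (a ++ l) ++ drop i (toList x)) (take-++-+ (toList u) _ j) ⟩
        (a ++ (toList u ++ take j (toList v))) ++ drop i (toList x)
          ≡⟨ List.++-assoc a _ _ ⟩
        a ++ ((toList u ++ take j (toList v)) ++ drop i (toList x))
          ≡⟨ cong (a ++_) (List.++-assoc (toList u) _ _) ⟩
        a ++ (toList u ++ z) ∎
        where open ≡-Reasoning
      main : ∑[ u ∈ bits↓ (b t) ] 𝟙 (lab i (take i (a ++ (toList u ++ toList v))) is c) ≤
             ∑[ y ∈ bits↓ (h + e) ] 𝟙 (LAB i (toList y) is c)
      main = begin
        ∑[ u ∈ bits↓ (b t) ] 𝟙 (lab i (take i (a ++ (toList u ++ toList v))) is c)
          ≡⟨ ∑-cong (bits↓ (b t)) (λ u → cong f (position u)) ⟩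
        ∑[ u ∈ bits↓ (b t) ] f (a ++ (toList u ++ z))
          ≤⟨ ∑-mono (bits↓ (b t)) (λ u → ∑-bits-term o {λ l → f (a ++ (toList u ++ l))} z lenz) ⟩
        ∑[ u ∈ bits↓ (b t) ] ∑[ l ∈ bits↓ o ] f (a ++ (toList u ++ toList l))
          ≡⟨ ∑-bits-++ (b t) o {λ l → f (a ++ l)} ⟨
        ∑[ l ∈ bits↓ (b t + o) ] f (a ++ toList l)
          ≤⟨ ∑-bits-term s {λ a → ∑[ l ∈ bits↓ (b t + o) ] f (a ++ toList l)} a len ⟩
        ∑[ a ∈ bits↓ s ] ∑[ l ∈ bits↓ (b t + o) ] f (toList a ++ toList l)
          ≡⟨ ∑-bits-++ s (b t + o) {f} ⟨
        ∑[ y ∈ bits↓ (s + (b t + o)) ] f (toList y)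
          ≡⟨ cong (λ z → ∑[ y ∈ bits↓ z ] f (toList y)) size ⟩
        ∑[ y ∈ bits↓ (h + e) ] f (toList y) ∎
        where open ≤-Reasoning

    load : ∀ t c s a → length a ≡ s →
           ∑[ v ∈ bits↓ (W t) ] 𝟙 (label t s (a ++ toList v) is c) ≤ Λ * 2 ^ body t
    load t c s a len = begin
      ∑[ v ∈ bits↓ (W t) ] 𝟙 (label t s (a ++ toList v) is c)
        ≤⟨ ∑-mono (bits↓ (W t)) (λ v → 𝟙≤ (found v)) ⟩
      ∑[ v ∈ bits↓ (W t) ] ∑[ i ∈ downFrom (suc h) ] hit i (toList v)
        ≡⟨ ∑-swap (bits↓ (W t)) (downFrom (suc h)) ⟩
      ∑[ i ∈ downFrom (suc h) ] ∑[ v ∈ bits↓ (W t) ] hit i (toList v)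
        ≤⟨ ∑-mono (downFrom (suc h)) level ⟩
      ∑[ i ∈ downFrom (suc h) ] (cost i * 2 ^ body t)
        ≡⟨ ∑-*ʳ (downFrom (suc h)) (2 ^ body t) {cost} ⟩
      ∑ (downFrom (suc h)) cost * 2 ^ body t
        ≤⟨ *-monoˡ-≤ (2 ^ body t) (total c) ⟩
      Λ * 2 ^ body t ∎
      where
      open ≤-Reasoning
      cost : ℕ → ℕ
      cost i = ∑[ y ∈ bits↓ (h + e) ] 𝟙 (LAB i (toList y) is c)
      -- The two comparisons keep the levels inside the window whose position contains the complete
      -- buffer; only there is the injectivity in the buffer bits available.
      hit : ℕ → List Bool → ℕ
      hit i v = 𝟙 ((s + b t ≤ᵇ i) ∧ ((i ≤ᵇ s + W t) ∧ (lab i (take i (a ++ v)) is c)))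
      found : ∀ v → (label t s (a ++ toList v) is c) ≡ true →
              1 ≤ ∑[ i ∈ downFrom (suc h) ] hit i (toList v)
      found v e with firstLabel-just (All-queryLevels t s) (is-sound _ c e)
      ... | i , (p , q) , eq = ≤-trans (≤-reflexive (sym one))
        (∑-downFrom-term (suc h) i (s≤s (guard i _ c eq)))
        where
        one : hit i (toList v) ≡ 1
        one rewrite ≤⇒≤ᵇ≡true p | ≤⇒≤ᵇ≡true q | eq | ≡ᵇ-refl c = refl
      drop-∧ : ∀ p q r → 𝟙 (p ∧ (q ∧ r)) ≤ 𝟙 r
      drop-∧ true  true  r = ≤-refl
      drop-∧ true  false r = z≤n
      drop-∧ false q     r = z≤n
      outside : ∀ i → (∀ v → hit i v ≡ 0) → ∑[ v ∈ bits↓ (W t) ] hit i (toList v) ≤ cost i * 2 ^ body t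
      outside i e = ≤-trans (≤-reflexive (∑-zero (bits↓ (W t)) (λ v → e (toList v)))) z≤n
      inside : ∀ j → s + (b t + j) ≤ h → j ≤ body t →
               ∑[ v ∈ bits↓ (W t) ] hit (s + (b t + j)) (toList v) ≤ cost (s + (b t + j)) * 2 ^ body t
      inside j i≤h j≤ = begin
        ∑[ v ∈ bits↓ (W t) ] hit i (toList v)
          ≡⟨ ∑-bits-++ (b t) (body t) {hit i} ⟩
        ∑[ u ∈ bits↓ (b t) ] ∑[ v ∈ bits↓ (body t) ] hit i (toList u ++ toList v)
          ≡⟨ ∑-swap (bits↓ (b t)) (bits↓ (body t)) ⟩
        ∑[ v ∈ bits↓ (body t) ] ∑[ u ∈ bits↓ (b t) ] hit i (toList u ++ toList v)
          ≤⟨ ∑-mono (bits↓ (body t)) (λ v → ≤-trans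
               (∑-mono (bits↓ (b t)) (λ u → drop-∧ (s + b t ≤ᵇ i) (i ≤ᵇ s + W t) _))
               (level-load t s a c j len i≤h j≤ v)) ⟩
        ∑[ _ ∈ bits↓ (body t) ] cost i ≡⟨ ∑-const (bits↓ (body t)) (cost i) ⟩
        length (bits↓ (body t)) * cost i ≡⟨ cong (_* cost i) (length-bits (body t)) ⟩
        2 ^ body t * cost i ≡⟨ *-comm (2 ^ body t) (cost i) ⟩
        cost i * 2 ^ body t ∎
        where i = s + (b t + j)
      level : ∀ i → ∑[ v ∈ bits↓ (W t) ] hit i (toList v) ≤ cost i * 2 ^ body t
      level i with s + b t ≤? i | i ≤? s + W t | i ≤? h
      ... | no ¬p | _ | _ = outside i none
        where
        none : ∀ v → hit i v ≡ 0
        none v with s + b t ≤ᵇ i in eq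
        ... | false = refl
        ... | true  = contradiction (≤ᵇ⇒≤ _ _ (subst T (sym eq) tt)) ¬p
      ... | yes p | no ¬q | _ = outside i none
        where
        none : ∀ v → hit i v ≡ 0
        none v with s + b t ≤ᵇ i
        ... | false = refl
        ... | true with i ≤ᵇ s + W t in eq
        ...   | false = refl
        ...   | true  = contradiction (≤ᵇ⇒≤ _ _ (subst T (sym eq) tt)) ¬q
      ... | yes p | yes q | no ¬g = outside i none
        where
        none : ∀ v → hit i v ≡ 0
        none v with s + b t ≤ᵇ i | i ≤ᵇ s + W t | lab i (take i (a ++ v)) in eq
        ... | false | _     | _       = refl
        ... | true  | false | _       = refl
        ... | true  | true  | nothing = refl
        ... | true  | true  | just c′ = contradiction (guard i _ c′ eq) ¬g
      ... | yes p | yes q | yes g = subst (λ i → ∑[ v ∈ bits↓ (W t) ] hit i (toList v) ≤ cost i * 2 ^ body t)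
          i≡ (inside j (subst (_≤ h) (sym i≡) g) j≤)
        where
        j = i ∸ (s + b t)
        i≡ : s + (b t + j) ≡ i
        i≡ = trans (sym (+-assoc s (b t) j)) (m+[n∸m]≡n p)
        j≤ : j ≤ body t
        j≤ = ≤-trans (∸-monoˡ-≤ (s + b t) q) (≤-reflexive
          (trans (cong (_∸ (s + b t)) (sym (+-assoc s (b t) (body t)))) (m+n∸m≡n (s + b t) (body t))))

private variable
  w : ℕ

-- Known cells

any-true : ∀ (f : 𝔸 → Bool) xs → any f xs ≡ true → ∃[ x ] x ∈ xs × f x ≡ true
any-true f (x ∷ xs) e with f x in eq
... | true  = x , here refl , eq
... | false with any-true f xs e
...   | y , y∈ , eq′ = y , there y∈ , eq′

any-∈ : ∀ (f : 𝔸 → Bool) {x xs} → x ∈ xs → f x ≡ true → any f xs ≡ true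
any-∈ f (here refl) e rewrite e = refl
any-∈ f {xs = y ∷ _} (there x∈) e with f y
... | true  = refl
... | false = any-∈ f x∈ e

bits-complete : ∀ {n} (v : Vec Bool n) → v ∈ bits↓ n
bits-complete []          = here refl
bits-complete (false ∷ v) = ∈-++⁺ˡ (∈-map⁺ _ (bits-complete v))
bits-complete (true ∷ v)  = ∈-++⁺ʳ _ (∈-map⁺ _ (bits-complete v))

Known : ℕ → Set
Known w = List (ℕ × Word w)

find : ℕ → Known w → Maybe (Word w)
find a []             = nothing
find a ((a′ , c) ∷ μ) = if a ≡ᵇ a′ then just c else find a μ

-- Only cells inside the memory are ever relevant; the others are read as zeros.
cell : Memory w → ℕ → Word w
cell M a = fromMaybe (replicate _ false) (head (drop a M))

excerpt : Memory w → List ℕ → Known w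
excerpt M = map (λ a → a , cell M a)

_⊑_ : Known w → Memory w → Set
μ ⊑ M = ∀ a c → find a μ ≡ just c → c ≡ cell M a

find-++ : ∀ a (μ ν : Known w) {c} → find a μ ≡ just c → find a (μ ++ ν) ≡ just c
find-++ a ((a′ , _) ∷ μ) ν e with a ≡ᵇ a′
... | true  = e
... | false = find-++ a μ ν e

find-excerpt : ∀ (μ : Known w) M {a as} → a ∈ as → ∃[ c ] find a (μ ++ excerpt M as) ≡ just c
find-excerpt [] M {a} (here refl) rewrite ≡ᵇ-refl a = _ , refl
find-excerpt [] M {a} {a′ ∷ _} (there a∈) with a ≡ᵇ a′
... | true  = _ , refl
... | false = find-excerpt [] M a∈
find-excerpt ((a′ , _) ∷ μ) M {a} a∈ with a ≡ᵇ a′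
... | true  = _ , refl
... | false = find-excerpt μ M a∈

find-++⁻ : ∀ a (μ ν : Known w) {c} → find a (μ ++ ν) ≡ just c → find a μ ≡ just c ⊎ find a ν ≡ just c
find-++⁻ a []             ν e = inj₂ e
find-++⁻ a ((a′ , _) ∷ μ) ν e with a ≡ᵇ a′
... | true  = inj₁ e
... | false = find-++⁻ a μ ν e

find-excerpt⁻ : ∀ (M : Memory w) as {a c} → find a (excerpt M as) ≡ just c → c ≡ cell M a
find-excerpt⁻ M (a′ ∷ as) {a} e with a ≡ᵇ a′ in eq
... | true  rewrite ≡ᵇ-sound a a′ eq = sym (just-injective e)
... | false = find-excerpt⁻ M as e

⊑-excerpt : ∀ (μ : Known w) M as → μ ⊑ M → (μ ++ excerpt M as) ⊑ M
⊑-excerpt μ M as μ⊑M a c e with find-++⁻ a μ (excerpt M as) e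
... | inj₁ f = μ⊑M a c f
... | inj₂ f = find-excerpt⁻ M as f

-- An algorithm that outputs before step `t` counts as reached, so short runs are never lost.
reach : ∀ {B} → Known w → ℕ → Algorithm w B → Bool
reach μ zero    _           = true
reach μ (suc t) (output _)  = true
reach μ (suc t) (probe a k) with find a μ
... | just c  = reach μ t (k c)
... | nothing = false

nextCell : ∀ {B} → Known w → ℕ → Algorithm w B → Maybe ℕ
nextCell μ t       (output _)  = nothing
nextCell μ zero    (probe a k) = just a
nextCell μ (suc t) (probe a k) with find a μ
... | just c  = nextCell μ t (k c)
... | nothing = nothing

outcome : ∀ {B} → Known w → Algorithm w B → Maybe B
outcome μ (output y)  = just y
outcome μ (probe a k) with find a μ
... | just c  = outcome μ (k c)
... | nothing = nothing

run-probe : ∀ {B} a (k : Word w → Algorithm w B) M {y n} → run (probe a k) M ≡ just (y , n) →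
            a < length M × ∃[ n′ ] n ≡ suc n′ × run (k (cell M a)) M ≡ just (y , n′)
run-probe a k M e with head (drop a M) in eq
... | just c with run (k c) M
run-probe a k M refl | just c | just (y , n′) = inside a M eq , n′ , refl , refl
  where
  inside : ∀ a M {c} → head (drop a M) ≡ just c → a < length M
  inside zero    (_ ∷ _) _ = s≤s z≤n
  inside (suc a) (_ ∷ M) e = s≤s (inside a M e)

next-valid : ∀ {B} {μ : Known w} {M} t (alg : Algorithm w B) {r a} → μ ⊑ M →
             run alg M ≡ just r → nextCell μ t alg ≡ just a → a < length M
next-valid {M = M} zero (probe a k) snd e refl = proj₁ (run-probe a k M e)
next-valid {μ = μ} {M} (suc t) (probe a k) snd e f with find a μ in eq
... | just c rewrite snd a c eq =
  next-valid t (k (cell M a)) snd (proj₂ (proj₂ (proj₂ (run-probe a k M e)))) f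

reach-next : ∀ {B} (μ : Known w) t (alg : Algorithm w B) {a} → nextCell μ t alg ≡ just a → reach μ t alg ≡ true
reach-next μ zero    alg         e = refl
reach-next μ (suc t) (probe a k) e with find a μ
... | just c = reach-next μ t (k c) e

reach-suc : ∀ {B} (μ ν : Known w) t (alg : Algorithm w B) → reach μ t alg ≡ true →
            (∀ a → nextCell μ t alg ≡ just a → ∃[ c ] find a (μ ++ ν) ≡ just c) →
            reach (μ ++ ν) (suc t) alg ≡ true
reach-suc μ ν t       (output _)  r f = refl
reach-suc μ ν zero    (probe a k) r f with f a refl
... | c , e rewrite e = refl
reach-suc μ ν (suc t) (probe a k) r f with find a μ in eq
... | just c rewrite find-++ a μ ν eq = reach-suc μ ν t (k c) r f

outcome-sound : ∀ {B} {μ : Known w} {M} (alg : Algorithm w B) {y n z} → μ ⊑ M →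
                run alg M ≡ just (y , n) → outcome μ alg ≡ just z → z ≡ y
outcome-sound (output x) snd refl refl = refl
outcome-sound {μ = μ} {M} (probe a k) snd e f with find a μ in eq
... | just c rewrite snd a c eq =
  outcome-sound (k (cell M a)) snd (proj₂ (proj₂ (proj₂ (run-probe a k M e)))) f

-- Once `t` is at least the number of probes of the run, the known probes contain the entire run.
outcome-reach : ∀ {B} {μ : Known w} {M} t (alg : Algorithm w B) {y n} → μ ⊑ M →
                run alg M ≡ just (y , n) → n ≤ t → reach μ t alg ≡ true → outcome μ alg ≡ just y
outcome-reach t (output x) snd refl _ _ = refl
outcome-reach {M = M} zero (probe a k) snd e n≤t _ with run-probe a k M e
outcome-reach {M = M} zero (probe a k) snd e () _ | _ , n′ , refl , _
outcome-reach {μ = μ} {M} (suc t) (probe a k) snd e n≤t r with find a μ in eq | run-probe a k M e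
... | just c | _ , n′ , refl , e′ rewrite snd a c eq = outcome-reach t (k (cell M a)) snd e′ (s≤s⁻¹ n≤t) r

fillings : ∀ w → List ℕ → List (Known w)
fillings w []       = [] ∷ []
fillings w (a ∷ as) = cartesianProductWith (λ c μ → (a , c) ∷ μ) (bits↓ w) (fillings w as)

length-fillings : ∀ w as → length (fillings w as) ≡ 2 ^ (w * length as)
length-fillings w []       = cong (2 ^_) (sym (*-zeroʳ w))
length-fillings w (a ∷ as) = trans (length-cartesianProductWith _ (bits↓ w) (fillings w as))
  (trans (cong₂ _*_ (length-bits w) (length-fillings w as))
    (trans (sym (^-distribˡ-+-* 2 w _)) (cong (2 ^_) (sym (*-suc w (length as))))))

excerpt-∈ : ∀ (M : Memory w) as → excerpt M as ∈ fillings w as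
excerpt-∈ M []       = here refl
excerpt-∈ M (a ∷ as) = ∈-cartesianProductWith⁺ _ (bits-complete (cell M a)) (excerpt-∈ M as)

-- Averaging over networks

∑-member : ∀ {x : 𝔸} {xs} (f : 𝔸 → ℕ) → x ∈ xs → f x ≤ ∑ xs f
∑-member f (here refl) = m≤m+n _ _
∑-member {xs = y ∷ _} f (there x∈) = ≤-trans (∑-member f x∈) (m≤n+m _ (f y))

-- A union bound over the contents: for fixed `μ` the summand is a fixed function of `n`, and the
-- restriction to the class of `μ` is dropped. The bound `F` is asked only for contents that occur
-- for some `n`, which matters because the load of a cell is controlled only for those.
∑-classes : (_≟_ : DecidableEquality 𝔹) (ns : List 𝔸) (P : 𝔸 → 𝔹) (g : 𝔹 → 𝔸 → ℕ) (cover : List 𝔹) →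
  (∀ n → P n ∈ cover) → ∀ F → (∀ n → ∑ ns (g (P n)) ≤ F) → ∑[ n ∈ ns ] g (P n) n ≤ length cover * F
∑-classes _≟_ ns P g cover covers F bound = begin
  ∑[ n ∈ ns ] g (P n) n ≤⟨ ∑-mono ns (λ n →
                                                         ≤-trans (own n) (∑-member _ (covers n))) ⟩
  ∑[ n ∈ ns ] ∑[ μ ∈ cover ] (𝟙 (does (P n ≟ μ)) * g μ n) ≡⟨ ∑-swap ns cover ⟩
  ∑[ μ ∈ cover ] ∑[ n ∈ ns ] (𝟙 (does (P n ≟ μ)) * g μ n) ≤⟨ ∑-mono cover (λ μ → class μ ns bound) ⟩
  ∑[ _ ∈ cover ] F ≡⟨ ∑-const cover F ⟩
  length cover * F ∎
  where
  open ≤-Reasoning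
  own : ∀ n → g (P n) n ≤ 𝟙 (does (P n ≟ P n)) * g (P n) n
  own n with P n ≟ P n
  ... | yes _ = m≤m+n _ 0
  ... | no ¬p = contradiction refl ¬p
  class : ∀ μ ns → (∀ n → ∑ ns (g (P n)) ≤ F) → ∑[ n ∈ ns ] (𝟙 (does (P n ≟ μ)) * g μ n) ≤ F
  class μ []       bd = z≤n
  class μ (n ∷ ns) bd with P n ≟ μ
  ... | yes refl = ≤-trans (+-mono-≤ (≤-reflexive (+-identityʳ _)) (∑-mono ns (λ m → 𝟙-* (does (P m ≟ P n)) _))) (bd n)
    where
    𝟙-* : ∀ b k → 𝟙 b * k ≤ k
    𝟙-* true  k = ≤-reflexive (+-identityʳ k)
    𝟙-* false k = z≤n
  ... | no _ = class μ ns (λ m → ≤-trans (m≤n+m _ (g (P m) n)) (bd m))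

n<2^n : ∀ n → n < 2 ^ n
n<2^n zero    = s≤s z≤n
n<2^n (suc n) = begin-strict
  suc n <⟨ s≤s (n<2^n n) ⟩
  1 + 2 ^ n ≤⟨ +-monoˡ-≤ (2 ^ n) (m^n>0 2 n) ⟩
  2 ^ n + 2 ^ n ≡⟨ cong (2 ^ n +_) (+-identityʳ (2 ^ n)) ⟨
  2 ^ suc n ∎
  where open ≤-Reasoning

-- Jensen's inequality in an elementary form: the pointwise bound `y * B ^ E ≤ E * B ^ E + B ^ y`
-- replaces convexity and costs one unit in the mean.
∑-exponential : ∀ (ns : List 𝔸) (y : 𝔸 → ℕ) B E → 2 ≤ B →
  ∑[ n ∈ ns ] (B ^ y n) ≤ length ns * B ^ E → ∑ ns y ≤ length ns * suc E
∑-exponential ns y B E 2≤B moment = *-cancelʳ-≤ _ _ (B ^ E) {{m^n≢0 B E {{>-nonZero (≤-trans (s≤s z≤n) 2≤B)}}}} (begin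
  ∑ ns y * B ^ E ≡⟨ ∑-*ʳ ns (B ^ E) ⟨
  ∑[ n ∈ ns ] (y n * B ^ E) ≤⟨ ∑-mono ns (λ n → point (y n)) ⟩
  ∑[ n ∈ ns ] (E * B ^ E + B ^ y n) ≡⟨ ∑-+ ns ⟩
  ∑[ _ ∈ ns ] (E * B ^ E) + ∑[ n ∈ ns ] (B ^ y n) ≤⟨ +-mono-≤ (≤-reflexive (∑-const ns _)) moment ⟩
  length ns * (E * B ^ E) + length ns * B ^ E ≡⟨ lem (length ns) E (B ^ E) ⟩
  length ns * suc E * B ^ E ∎)
  where
  open ≤-Reasoning
  lem : ∀ n e b → n * (e * b) + n * b ≡ n * (1 + e) * b
  lem = solve-∀
  point : ∀ y → y * B ^ E ≤ E * B ^ E + B ^ y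
  point y with ≤-total y E
  ... | inj₁ y≤E = ≤-trans (*-monoˡ-≤ (B ^ E) y≤E) (m≤m+n _ _)
  ... | inj₂ E≤y = begin
    y * B ^ E ≡⟨ cong (_* B ^ E) (m+[n∸m]≡n E≤y) ⟨
    (E + d) * B ^ E ≡⟨ *-distribʳ-+ (B ^ E) E d ⟩
    E * B ^ E + d * B ^ E ≤⟨ +-monoʳ-≤ (E * B ^ E) (*-monoˡ-≤ (B ^ E)
                                            (≤-trans (<⇒≤ (n<2^n d)) (^-monoˡ-≤ d 2≤B))) ⟩
    E * B ^ E + B ^ d * B ^ E ≡⟨ cong (E * B ^ E +_) (trans (sym (^-distribˡ-+-* B d E))
                                            (cong (B ^_) (m∸n+n≡m E≤y))) ⟩
    E * B ^ E + B ^ y ∎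
    where d = y ∸ E

sq-^ : ∀ B n → sq (B ^ n) ≡ sq B ^ n
sq-^ B zero    = refl
sq-^ B (suc n) = trans (sq-* B (B ^ n)) (cong (sq B *_) (sq-^ B n))

∏-^-bound : ∀ (xs : List 𝔸) {f c} → (∀ x → f x ≤ 2 ^ c) → ∏ xs f ≤ 2 ^ (c * length xs)
∏-^-bound xs {f} {c} bd = ≤-trans (∏-mono xs bd)
  (≤-reflexive (trans (∏-const xs (2 ^ c)) (^-*-assoc 2 c (length xs))))

known-≟ : ∀ {w} → DecidableEquality (Known w)
known-≟ = List.≡-dec (Product.≡-dec _≟_ (Vec.≡-dec Bool._≟_))

-- Collisions averaged over all networks

module Collide (b : ℕ → ℕ) (K e T : ℕ) where
  open Windows b K

  h L m Z : ℕ
  h = W T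
  L = h + e
  m = 2 ^ L
  Z = length (nets e h)

  module _ {w : ℕ} (P : Net e h → Known w) (cover : List (Known w)) (covers : ∀ n → P n ∈ cover)
    (b′ Λ E : ℕ) (t d : ℕ) (scale : d + suc t ≡ T) (init : List ℕ) (short : length init ≤ 1)
    (LAB : Known w → Vec Bool L → ℕ → List Bool → Maybe ℕ)
    (guard : ∀ μ x i y c → LAB μ x i y ≡ just c → i ≤ h)
    (total : ∀ n x c → ∑[ i ∈ downFrom (suc h) ] ∑[ y ∈ bits↓ L ] 𝟙 (LAB (P n) x i (toList y) is c) ≤ Λ)
    (1≤b′ : 1 ≤ b′) (small : suc K * (2 ^ b′ * 2 ^ b′ * Λ) ≤ 2 ^ b t)
    (C : ℕ) (cost : length cover ≤ 2 ^ C) (budget : C + K ^ suc d * m ≤ b′ * E)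
    where

    lab : Known w → Vec Bool L → ℕ → List Bool → Maybe ℕ
    lab μ x i q = LAB μ x i (q ++ drop i (toList x))

    collided : Known w → Vec Bool L → Vec Bool h → ℕ
    collided μ x p = Labels.totalCollisions (lab μ x) t init d (toList p)

    B : ℕ
    B = 2 ^ b′

    -- Once the content is fixed, the exponent is a sum over tokens of terms depending on one path
    -- each, so `∑-nets-sq` applies. It squares the summand, which is why the path moment is taken
    -- with base `sq B` and the buffers have to absorb `2 ^ b′` twice.
    one-class : ∀ n₀ → ∑[ n ∈ nets e h ] (B ^ ∑[ x ∈ bits↓ L ] collided (P n₀) x (path h n x)) ≤
                Z * 2 ^ (K ^ suc d * m)
    one-class n₀ = sq-cancel-≤ (begin
      sq (∑[ n ∈ nets e h ] (B ^ ∑[ x ∈ bits↓ L ] collided (P n₀) x (path h n x)))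
        ≡⟨ cong sq (∑-cong (nets e h) (λ n → ^-∑ (bits↓ L) B)) ⟩
      sq (∑[ n ∈ nets e h ] ∏[ x ∈ bits↓ L ] F x (path h n x))
        ≤⟨ ∑-nets-sq e h F ⟩
      ∏[ x ∈ bits↓ L ] ∑[ p ∈ bits↓ h ] sq (F x p)
        ≤⟨ ∏-^-bound (bits↓ L) {c = h + κ} paths ⟩
      2 ^ ((h + κ) * length (bits↓ L))
        ≡⟨ cong (λ z → 2 ^ ((h + κ) * z)) (length-bits L) ⟩
      2 ^ ((h + κ) * m)
        ≡⟨ cong (2 ^_) (*-distribʳ-+ m h κ) ⟩
      2 ^ (h * m + κ * m)
        ≡⟨ ^-distribˡ-+-* 2 (h * m) (κ * m) ⟩
      2 ^ (h * m) * 2 ^ (κ * m)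
        -- The square root would halve this exponent; the gain is given away.
        ≤⟨ *-monoʳ-≤ (2 ^ (h * m)) (m≤m*n _ _ {{m^n≢0 2 (κ * m)}}) ⟩
      2 ^ (h * m) * sq (2 ^ (κ * m))
        ≡⟨ cong (_* sq (2 ^ (κ * m))) (sq-length-nets e h) ⟨
      sq Z * sq (2 ^ (κ * m))
        ≡⟨ sq-* Z (2 ^ (κ * m)) ⟨
      sq (Z * 2 ^ (κ * m)) ∎)
      where
      open ≤-Reasoning
      κ = K ^ suc d
      F : Vec Bool L → Vec Bool h → ℕ
      F x p = B ^ collided (P n₀) x p
      top≡ : top d (suc t) ≡ T
      top≡ = trans (top-+ d (suc t)) scale
      paths : ∀ x → ∑[ p ∈ bits↓ h ] sq (F x p) ≤ 2 ^ (h + κ)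
      paths x = ≤-trans (≤-reflexive (∑-cong (bits↓ h) (λ p → sq-^ B (collided (P n₀) x p))))
        (subst (λ T → ∑[ p ∈ bits↓ (W T) ] (sq B ^ Labels.totalCollisions (lab (P n₀) x) t init d (toList p))
                      ≤ 2 ^ (W T + κ)) top≡
          (Labels.totalCollisions-bound (lab (P n₀) x) t (sq B) Λ init
            (Load.load b K h e Λ (LAB (P n₀) x) x (guard (P n₀) x) (total n₀ x) t)
            (≤-trans (*-monoˡ-≤ (sq B * Λ) (+-monoˡ-≤ K short)) small) d))

    -- The `2 ^ C` possible contents multiply the moment, but the base of the moment is `2 ^ b′`, so
    -- they raise the mean only by about `C / b′`.
    collisions-rare : ∑[ n ∈ nets e h ] ∑[ x ∈ bits↓ L ] collided (P n) x (path h n x) ≤ Z * suc E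
    collisions-rare = ∑-exponential (nets e h) _ B E (^-monoʳ-≤ 2 1≤b′) (begin
      ∑[ n ∈ nets e h ] (B ^ ∑[ x ∈ bits↓ L ] collided (P n) x (path h n x))
        ≤⟨ ∑-classes known-≟ (nets e h) P
             (λ μ n → B ^ ∑[ x ∈ bits↓ L ] collided μ x (path h n x)) cover covers _ one-class ⟩
      length cover * (Z * 2 ^ (K ^ suc d * m)) ≤⟨ *-monoˡ-≤ (Z * 2 ^ (K ^ suc d * m)) cost ⟩
      2 ^ C * (Z * 2 ^ (K ^ suc d * m)) ≡⟨ lem (2 ^ C) Z _ ⟩
      Z * (2 ^ C * 2 ^ (K ^ suc d * m)) ≡⟨ cong (Z *_) (^-distribˡ-+-* 2 C _) ⟨
      Z * 2 ^ (C + K ^ suc d * m) ≤⟨ *-monoʳ-≤ Z (^-monoʳ-≤ 2 budget) ⟩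
      Z * 2 ^ (b′ * E) ≡⟨ cong (Z *_) (^-*-assoc 2 b′ E) ⟨
      Z * B ^ E ∎)
      where
      open ≤-Reasoning
      lem : ∀ a b c → a * (b * c) ≡ b * (a * c)
      lem = solve-∀

-- Rounds of publishing cells

∑-mono-∈ : ∀ (xs : List 𝔸) {f g : 𝔸 → ℕ} → (∀ x → x ∈ xs → f x ≤ g x) → ∑ xs f ≤ ∑ xs g
∑-mono-∈ []       e = z≤n
∑-mono-∈ (x ∷ xs) e = +-mono-≤ (e x (here refl)) (∑-mono-∈ xs (λ y y∈ → e y (there y∈)))

∑-downFrom-≤ : ∀ n {f : ℕ → ℕ} {c} → (∀ i → i < n → f i ≤ c) → ∑ (downFrom n) f ≤ n * c
∑-downFrom-≤ zero    e = z≤n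
∑-downFrom-≤ (suc n) e = +-mono-≤ (e n ≤-refl) (∑-downFrom-≤ n (λ i i<n → e i (m≤n⇒m≤1+n i<n)))

∑-bits-unique : ∀ n (f : Vec Bool n → Bool) v → (∀ u → f u ≡ true → u ≡ v) → ∑[ u ∈ bits↓ n ] 𝟙 (f u) ≤ 1
∑-bits-none : ∀ n (f : Vec Bool n → Bool) → (∀ u → f u ≡ true → ⊥) → ∑[ u ∈ bits↓ n ] 𝟙 (f u) ≡ 0
∑-bits-none n f none = ∑-zero (bits↓ n) (λ u → zero-𝟙 (f u) (none u))
  where
  zero-𝟙 : ∀ b → (b ≡ true → ⊥) → 𝟙 b ≡ 0
  zero-𝟙 true  f = ⊥-elim (f refl)
  zero-𝟙 false f = refl
∑-bits-unique zero f [] only with f []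
... | true  = ≤-refl
... | false = z≤n
∑-bits-unique (suc n) f (false ∷ v) only = ≤-trans (≤-reflexive (trans (∑-bits n)
    (trans (cong (∑[ u ∈ bits↓ n ] 𝟙 (f (false ∷ u)) +_)
      (∑-bits-none n (λ u → f (true ∷ u)) (λ u e → clash (only _ e)))) (+-identityʳ _))))
  (∑-bits-unique n (λ u → f (false ∷ u)) v (λ u e → Vec.∷-injectiveʳ (only _ e)))
  where
  clash : ∀ {u} → true Vec.∷ u ≡ false ∷ v → ⊥
  clash ()
∑-bits-unique (suc n) f (true ∷ v) only = ≤-trans (≤-reflexive (trans (∑-bits n)
    (cong (_+ ∑[ u ∈ bits↓ n ] 𝟙 (f (true ∷ u)))
      (∑-bits-none n (λ u → f (false ∷ u)) (λ u e → clash (only _ e))))))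
  (∑-bits-unique n (λ u → f (true ∷ u)) v (λ u e → Vec.∷-injectiveʳ (only _ e)))
  where
  clash : ∀ {u} → false Vec.∷ u ≡ true ∷ v → ⊥
  clash ()

keep : ℕ → List ℕ → Maybe ℕ → Maybe ℕ
keep M R nothing  = nothing
keep M R (just c) = if (c <ᵇ M) ∧ not (any (just c is_) R) then just c else nothing

keep-just : ∀ M R m c → keep M R m ≡ just c →
            m ≡ just c × c < M × not (any (m is_) R) ≡ true
keep-just M R (just c′) c e with c′ <ᵇ M in lt | any (just c′ is_) R
keep-just M R (just c′) .c′ refl | true | false = refl , <ᵇ⇒< c′ M (subst T (sym lt) tt) , refl

keep-nothing : ∀ M R m → keep M R m ≡ nothing → (∀ c → m ≡ just c → c < M) →
               ∀ c → m ≡ just c → c ∈ R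
keep-nothing M R (just c) e valid .c refl with c <ᵇ M in lt | any (just c is_) R in eq
... | false | _ = contradiction (subst T lt (<⇒<ᵇ (valid c refl))) (λ ())
... | true | true with any-true (just c is_) R eq
...   | c′ , c′∈ , q = subst (_∈ R) (sym (≡ᵇ-sound c c′ q)) c′∈

-- `M` bounds the number of memory cells, `r` the cells taken by either greedy choice of a round,
-- and `Λ` the queries that may probe a cell outside the heavy ones in a given step. A collision at
-- scale `t` weighs `2 ^ b′ t`, and `suc (E t)` bounds the mean number of collisions.
module Core (b b′ E : ℕ → ℕ) (K Q w e r M Λ : ℕ) where

  open Windows b K
  open Collide b K e (suc Q) using (h; L; m; Z; collisions-rare)

  module _
    (alg : ℕ → List Bool → Algorithm w ℕ) (mem : Net e h → Memory w) (num : ℕ → Vec Bool L → ℕ)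
    (mem-length : ∀ n → length (mem n) ≤ M)
    (num-injective : ∀ i x x′ → i ≤ h → num i x ≡ num i x′ → x ≡ x′)
    (answers : ∀ n i x → i ≤ h →
      ∃[ t ] run (alg i (toList (route h n i x))) (mem n) ≡ just (num i x , t) × t ≤ Q)
    (0<r : 0 < r) (0<K : 0 < K) (1≤b′ : ∀ t → 1 ≤ b′ t)
    (fresh-small : 8 * suc Q * M ≤ r * K)
    (load-small : suc h * m < r * suc Λ) (levels-small : suc h ≤ Λ)
    (weight-small : ∀ t → suc K * (2 ^ b′ t * 2 ^ b′ t * Λ) ≤ 2 ^ b t)
    (loss-small : ∀ d t → d + t ≡ Q → 8 * suc Q * suc (E t) ≤ m * K ^ suc d)
    (budget : ∀ d t → d + t ≡ Q → w * (r + r) * t + K ^ suc d * m ≤ b′ t * E t)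
    where

    query-at : ℕ → Net e h → Vec Bool L → Algorithm w ℕ
    query-at i n x = alg i (pos i (toList (path h n x)) (toList x))

    answers-at : ∀ n i x → i ≤ h → ∃[ t ] run (query-at i n x) (mem n) ≡ just (num i x , t) × t ≤ Q
    answers-at n i x i≤h = subst (λ y → ∃[ t ] run (alg i y) (mem n) ≡ just (num i x , t) × t ≤ Q)
      (toList-route h n i x i≤h) (answers n i x i≤h)

    unseen : Known w → ℕ → ℕ → Net e h → Vec Bool L → Bool
    unseen μ t s n x = not (any (λ i → reach μ t (query-at i n x)) (queryLevels t s))

    Unseen : (Net e h → Known w) → ℕ → ℕ → ℕ
    Unseen P d t = ∑[ n ∈ nets e h ] ∑[ x ∈ bits↓ L ] ∑[ s ∈ starts d t ] 𝟙 (unseen (P n) t s n x)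

    -- Each round adds at most `r + r` cells of `w` bits, whence `cost`. By `few` a round may lose a
    -- fraction 1/(4(Q+1)) of the windows, one half of it to collisions and the other to fresh
    -- cells, so more than three quarters survive `Q` rounds.
    record Stage (d t : ℕ) : Set where
      field
        P      : Net e h → Known w
        cover  : List (Known w)
        covers : ∀ n → P n ∈ cover
        cost   : length cover ≤ 2 ^ (w * (r + r) * t)
        sound  : ∀ n → P n ⊑ mem n
        few    : 4 * suc Q * Unseen P d t ≤ t * (Z * (m * K ^ d))

    start : ∀ d → Stage d 0
    start d = record
      { P = λ _ → [] ; cover = [] ∷ [] ; covers = λ _ → here refl
      ; cost = m^n>0 2 (w * (r + r) * 0) ; sound = λ _ _ _ ()
      ; few = ≤-reflexive (trans (cong (4 * suc Q *_) none) (*-zeroʳ (4 * suc Q)))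
      }
      where
      none : Unseen (λ _ → []) d 0 ≡ 0
      none = ∑-zero (nets e h) λ n → ∑-zero (bits↓ L) λ x → ∑-zero (starts d 0) λ s → refl

    queries : List (ℕ × Vec Bool L)
    queries = cartesianProduct (downFrom (suc h)) (bits↓ L)

    length-queries : length queries ≡ suc h * m
    length-queries = trans (length-cartesianProduct (downFrom (suc h)) (bits↓ L))
      (cong₂ _*_ (List.length-downFrom (suc h)) (length-bits L))

    probes : Known w → ℕ → ℕ × Vec Bool L → ℕ → Bool
    probes μ t (i , y) c = nextCell μ t (alg i (toList y)) is c

    -- The choice depends on `μ` alone. The addresses published in a round are thus known from the
    -- earlier contents, and only the bits stored in the cells have to be counted.
    heavy : ∀ μ t → ∃[ R ] length R ≤ r × (∀ c → c < M →
            r * ∑[ q ∈ queries ] 𝟙 (probes μ t q c ∧ missedBy (probes μ t) R q) ≤ length queries)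
    heavy μ t = greedy queries (probes μ t) M r

    light : ℕ → Known w → Vec Bool L → ℕ → List Bool → Maybe ℕ
    light t μ x i y = if i ≤ᵇ h then keep M (proj₁ (heavy μ t)) (nextCell μ t (alg i y)) else nothing

    light-guard : ∀ t μ x i y c → light t μ x i y ≡ just c → i ≤ h
    light-guard t μ x i y c e with i ≤ᵇ h in eq
    ... | true = ≤ᵇ⇒≤ i h (subst T (sym eq) tt)

    light-just : ∀ t μ x i y c → light t μ x i y ≡ just c →
      nextCell μ t (alg i y) ≡ just c × c < M × not (any (nextCell μ t (alg i y) is_) (proj₁ (heavy μ t))) ≡ true
    light-just t μ x i y c e with i ≤ᵇ h
    ... | true = keep-just M (proj₁ (heavy μ t)) (nextCell μ t (alg i y)) c e

    -- The greedy choice leaves to any cell at most a 1/r fraction of the `suc h * m` queries, which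
    -- `load-small` turns into `Λ`; addresses beyond `M` carry no label.
    light-load : ∀ t μ x c → ∑[ i ∈ downFrom (suc h) ] ∑[ y ∈ bits↓ L ] 𝟙 (light t μ x i (toList y) is c) ≤ Λ
    light-load t μ x c with c <? M
    ... | yes c<M = s≤s⁻¹ (*-cancelˡ-< r _ (suc Λ) (begin-strict
      r * ∑[ i ∈ downFrom (suc h) ] ∑[ y ∈ bits↓ L ] 𝟙 (light t μ x i (toList y) is c)
        ≡⟨ cong (r *_) (∑-cartesianProduct (downFrom (suc h)) (bits↓ L)) ⟨
      r * ∑[ q ∈ queries ] 𝟙 (light t μ x (proj₁ q) (toList (proj₂ q)) is c)
        ≤⟨ *-monoʳ-≤ r (∑-mono queries (λ q → 𝟙≤ (counted q))) ⟩
      r * ∑[ q ∈ queries ] 𝟙 (probes μ t q c ∧ missedBy (probes μ t) R q)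
        ≤⟨ proj₂ (proj₂ (heavy μ t)) c c<M ⟩
      length queries ≡⟨ length-queries ⟩
      suc h * m <⟨ load-small ⟩
      r * suc Λ ∎))
      where
      open ≤-Reasoning
      R = proj₁ (heavy μ t)
      counted : ∀ q → (light t μ x (proj₁ q) (toList (proj₂ q)) is c) ≡ true →
                1 ≤ 𝟙 (probes μ t q c ∧ missedBy (probes μ t) R q)
      counted (i , y) e with light-just t μ x i (toList y) c (is-sound _ c e)
      ... | p , _ , q rewrite q | p | ≡ᵇ-refl c = ≤-refl
    ... | no c≮M = ≤-trans (≤-reflexive (∑-zero (downFrom (suc h)) λ i → ∑-zero (bits↓ L) λ y →
        n≤0⇒n≡0 (𝟙≤ (absurd i y)))) z≤n
      where
      absurd : ∀ i y → (light t μ x i (toList y) is c) ≡ true → 1 ≤ 0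
      absurd i y e = contradiction (proj₁ (proj₂ (light-just t μ x i (toList y) c (is-sound _ c e)))) c≮M

    round : ∀ d t → d + suc t ≡ suc Q → Stage (suc d) t → Stage d (suc t)
    round d t scale st = record
      { P = P′ ; cover = concatMap extend cover ; covers = covers′ ; cost = cost′ ; sound = sound′ ; few = few′ }
      where
      open Stage st
      d+t≡Q : d + t ≡ Q
      d+t≡Q = suc-injective (trans (sym (+-suc d t)) scale)
      lab : Known w → Vec Bool L → ℕ → List Bool → Maybe ℕ
      lab μ x i q = light t μ x i (q ++ drop i (toList x))
      labels : Net e h → Vec Bool L → ℕ → List (Maybe ℕ)
      labels n x s = Labels.kidLabels (lab (P n) x) t s (toList (path h n x))
      Place = Net e h × Vec Bool L × ℕ
      places : List Place
      places = cartesianProduct (nets e h) (cartesianProduct (bits↓ L) (starts d (suc t)))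
      contains : Place → ℕ → Bool
      contains (n , x , s) c = any (_is c) (labels n x s)
      -- One list for all networks, chosen over the windows of all tokens in all networks at once,
      -- so its addresses need no description.
      chosen : ∃[ R ] length R ≤ r × (∀ c → c < M →
               r * ∑[ τ ∈ places ] 𝟙 (contains τ c ∧ missedBy contains R τ) ≤ length places)
      chosen = greedy places contains M r
      R : List ℕ
      R = proj₁ chosen
      published : Known w → List ℕ
      published μ = proj₁ (heavy μ t) ++ R
      P′ : Net e h → Known w
      P′ n = P n ++ excerpt (mem n) (published (P n))
      extend : Known w → List (Known w)
      extend μ = map (μ ++_) (fillings w (published μ))
      covers′ : ∀ n → P′ n ∈ concatMap extend cover
      covers′ n = ∈-concatMap⁺ extend (lose (covers n) (∈-map⁺ (P n ++_) (excerpt-∈ (mem n) (published (P n)))))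
      sound′ : ∀ n → P′ n ⊑ mem n
      sound′ n = ⊑-excerpt (P n) (mem n) (published (P n)) (sound n)
      cost′ : length (concatMap extend cover) ≤ 2 ^ (w * (r + r) * suc t)
      cost′ = begin
        length (concatMap extend cover)
          ≡⟨ trans (∑-const (concatMap extend cover) 1) (*-identityʳ _) ⟨
        ∑[ _ ∈ concatMap extend cover ] 1
          ≡⟨ ∑-concatMap extend cover ⟩
        ∑[ μ ∈ cover ] ∑[ _ ∈ extend μ ] 1
          ≤⟨ ∑-mono cover (λ μ → ≤-trans (≤-reflexive (trans (∑-const (extend μ) 1) (trans (*-identityʳ _)
               (trans (List.length-map _ (fillings w (published μ))) (length-fillings w (published μ))))))
               (^-monoʳ-≤ 2 (*-monoʳ-≤ w (≤-trans (≤-reflexive (List.length-++ (proj₁ (heavy μ t))))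
                 (+-mono-≤ (proj₁ (proj₂ (heavy μ t))) (proj₁ (proj₂ chosen))))))) ⟩
        ∑[ _ ∈ cover ] (2 ^ (w * (r + r))) ≡⟨ ∑-const cover _ ⟩
        length cover * 2 ^ (w * (r + r)) ≤⟨ *-monoˡ-≤ _ cost ⟩
        2 ^ (w * (r + r) * t) * 2 ^ (w * (r + r))
          ≡⟨ ^-distribˡ-+-* 2 (w * (r + r) * t) _ ⟨
        2 ^ (w * (r + r) * t + w * (r + r))
          ≡⟨ cong (2 ^_) (trans (+-comm _ (w * (r + r))) (sym (*-suc (w * (r + r)) t))) ⟩
        2 ^ (w * (r + r) * suc t) ∎
        where open ≤-Reasoning

      progress : ∀ n x i → reach (P n) t (query-at i n x) ≡ true →
                 (∀ c → nextCell (P n) t (query-at i n x) ≡ just c → c ∈ published (P n)) →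
                 reach (P′ n) (suc t) (query-at i n x) ≡ true
      progress n x i p f = reach-suc (P n) _ t (query-at i n x) p
        (λ c e → find-excerpt (P n) (mem n) (f c e))

      levels-valid : ∀ {s σ i} → s ∈ starts d (suc t) → σ ∈ kids t s → i ∈ queryLevels t σ → i ≤ h
      levels-valid {s} {σ} s∈ σ∈ i∈ = ≤-trans (proj₂ (All.lookup (All-queryLevels t σ) i∈))
        (≤-trans (proj₂ (All.lookup (All-kids t s) σ∈))
          (subst (λ T → s + W (suc t) ≤ W T) (trans (top-+ d (suc t)) scale)
            (All.lookup (All-starts d (suc t)) s∈)))

      clash : ∀ {n x s σ i} → σ ∈ kids t s → i ∈ queryLevels t σ → unseen (P′ n) (suc t) s n x ≡ true →
              reach (P′ n) (suc t) (query-at i n x) ≡ true → ⊥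
      clash {n} {x} {s} {σ} {i} σ∈ i∈ u p
        rewrite any-∈ (λ i → reach (P′ n) (suc t) (query-at i n x))
                  (∈-concatMap⁺ (queryLevels t) (lose σ∈ i∈)) p with u
      ... | ()

      -- If the subwindow was not lost before, one of its queries has `t` known probes. Without a
      -- label, that query has stopped or its next cell is heavy; either way it advances, and the
      -- enclosing window is seen.
      unlabelled : ∀ n x s → s ∈ starts d (suc t) → unseen (P′ n) (suc t) s n x ≡ true →
        ∀ σ → σ ∈ kids t s →
        𝟙 (isNothing (Labels.label (lab (P n) x) t σ (toList (path h n x)))) ≤ 𝟙 (unseen (P n) t σ n x)
      unlabelled n x s s∈ u σ σ∈ = 𝟙≤ λ e → decide (unseen (P n) t σ n x) refl (firstLabel-isNothing {l} e)
        where
        l = λ i → lab (P n) x i (take i (toList (path h n x)))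
        decide : ∀ v → unseen (P n) t σ n x ≡ v → All (λ i → l i ≡ nothing) (queryLevels t σ) → 1 ≤ 𝟙 v
        decide true  _ _ = ≤-refl
        decide false q none with any (λ i → reach (P n) t (query-at i n x)) (queryLevels t σ) in eq
        ... | true with any-true (λ i → reach (P n) t (query-at i n x)) (queryLevels t σ) eq
        ...   | i , i∈ , p = contradiction (progress n x i p member) (clash σ∈ i∈ u)
          where
          i≤h = levels-valid s∈ σ∈ i∈
          kept : light t (P n) x i (pos i (toList (path h n x)) (toList x)) ≡ nothing →
                 keep M (proj₁ (heavy (P n) t)) (nextCell (P n) t (query-at i n x)) ≡ nothing
          kept z rewrite ≤⇒≤ᵇ≡true i≤h = z
          member : ∀ c → nextCell (P n) t (query-at i n x) ≡ just c → c ∈ published (P n)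
          member c z = ∈-++⁺ˡ (keep-nothing M (proj₁ (heavy (P n) t)) (nextCell (P n) t (query-at i n x))
            (kept (All.lookup none i∈))
            (λ c z → ≤-trans (next-valid t (query-at i n x) (sound n) (proj₁ (proj₂ (answers-at n i x i≤h))) z)
              (mem-length n)) c z)

      -- A label in `R` belongs to a query whose next cell is now published, so that query would
      -- advance.
      missed : ∀ n x s → unseen (P′ n) (suc t) s n x ≡ true → missedBy contains R (n , x , s) ≡ true
      missed n x s u with any (contains (n , x , s)) R in eq
      ... | false = refl
      ... | true with any-true (contains (n , x , s)) R eq
      ...   | c , c∈R , q with any-true (_is c) (labels n x s) q
      ...     | m , m∈ , mc with ∈-map⁻ _ m∈
      ...       | σ , σ∈ , refl with firstLabel-just (All.tabulate (λ i∈ → i∈)) (is-sound _ c mc)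
      ...         | i , i∈ , li = ⊥-elim (clash σ∈ i∈ u (progress n x i (reach-next (P n) t (query-at i n x) nx)
                    (λ c′ z → ∈-++⁺ʳ (proj₁ (heavy (P n) t)) (subst (_∈ R) (just-injective (trans (sym nx) z)) c∈R))))
        where
        nx : nextCell (P n) t (query-at i n x) ≡ just c
        nx = proj₁ (light-just t (P n) x i (pos i (toList (path h n x)) (toList x)) c li)

      pointwise : ∀ n x s → s ∈ starts d (suc t) → K * 𝟙 (unseen (P′ n) (suc t) s n x) ≤
        ∑[ σ ∈ kids t s ] 𝟙 (unseen (P n) t σ n x) + collisions [] (labels n x s) +
        ∑[ c ∈ downFrom M ] 𝟙 (contains (n , x , s) c ∧ missedBy contains R (n , x , s))
      pointwise n x s s∈ with unseen (P′ n) (suc t) s n x in u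
      ... | false = ≤-trans (≤-reflexive (*-zeroʳ K)) z≤n
      ... | true  = begin
        K * 1 ≡⟨ *-identityʳ K ⟩
        K ≡⟨ trans (List.length-map _ (kids t s)) (length-slots (W t) K _) ⟨
        length (labels n x s) ≤⟨ labels-count M [] (labels n x s) (All.map⁺ (All.tabulate λ {σ} _ → valid σ)) ⟩
        ∑[ m ∈ labels n x s ] 𝟙 (isNothing m) + collisions [] (labels n x s) +
          ∑[ c ∈ downFrom M ] 𝟙 (contains (n , x , s) c ∧ true)
          ≤⟨ +-mono-≤ (+-monoˡ-≤ (collisions [] (labels n x s)) (≤-trans (≤-reflexive (∑-map _ (kids t s)))
               (∑-mono-∈ (kids t s) (unlabelled n x s s∈ u))))
               (≤-reflexive (∑-cong (downFrom M) (λ c → cong (λ z → 𝟙 (contains (n , x , s) c ∧ z)) (sym (missed n x s u))))) ⟩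
        ∑[ σ ∈ kids t s ] 𝟙 (unseen (P n) t σ n x) + collisions [] (labels n x s) +
          ∑[ c ∈ downFrom M ] 𝟙 (contains (n , x , s) c ∧ missedBy contains R (n , x , s)) ∎
        where
        open ≤-Reasoning
        valid : ∀ σ → Labels.label (lab (P n) x) t σ (toList (path h n x)) bounded-by M
        valid σ c z with firstLabel-just (All-queryLevels t σ) z
        ... | i , _ , li =
            proj₁ (proj₂ (light-just t (P n) x i (pos i (toList (path h n x)) (toList x)) c li))

      Coll Fresh : ℕ
      Coll = ∑[ n ∈ nets e h ] ∑[ x ∈ bits↓ L ] ∑[ s ∈ starts d (suc t) ] collisions [] (labels n x s)
      Fresh = ∑[ τ ∈ places ] ∑[ c ∈ downFrom M ] 𝟙 (contains τ c ∧ missedBy contains R τ)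

      -- Every unlabelled window was unseen before; every labelled one collides or
      -- probes a new cell, and the greedy choice leaves few places for new cells.
      recurrence : K * Unseen P′ d (suc t) ≤ Unseen P (suc d) t + Coll + Fresh
      recurrence = begin
        K * Unseen P′ d (suc t)
          ≡⟨ trans (∑-cong N λ n → trans (∑-cong X λ x → ∑-*ˡ S K) (∑-*ˡ X K)) (∑-*ˡ N K) ⟨
        ∑[ n ∈ N ] ∑[ x ∈ X ] ∑[ s ∈ S ] (K * 𝟙 (unseen (P′ n) (suc t) s n x))
          ≤⟨ ∑-mono N (λ n → ∑-mono X λ x → ∑-mono-∈ S (pointwise n x)) ⟩
        ∑[ n ∈ N ] ∑[ x ∈ X ] ∑[ s ∈ S ] (f n x s + g n x s + k n x s)
          ≡⟨ trans (∑-cong N λ n → trans (∑-cong X λ x → trans (∑-+ S) (cong (_+ ∑ S (k n x)) (∑-+ S)))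
               (trans (∑-+ X) (cong (_+ ∑[ x ∈ X ] ∑ S (k n x)) (∑-+ X))))
               (trans (∑-+ N) (cong (_+ ∑[ n ∈ N ] ∑[ x ∈ X ] ∑ S (k n x)) (∑-+ N))) ⟩
        ∑[ n ∈ N ] ∑[ x ∈ X ] ∑ S (f n x) + Coll + ∑[ n ∈ N ] ∑[ x ∈ X ] ∑ S (k n x)
          ≡⟨ cong₂ (λ u v → u + Coll + v)
               (∑-cong N λ n → ∑-cong X λ x → sym (∑-concatMap (kids t) S))
               (trans (∑-cong N λ n → sym (∑-cartesianProduct X S)) (sym (∑-cartesianProduct N _))) ⟩
        Unseen P (suc d) t + Coll + Fresh ∎
        where
        open ≤-Reasoning
        N = nets e h
        X = bits↓ L
        S = starts d (suc t)
        f g k : Net e h → Vec Bool L → ℕ → ℕ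
        f n x s = ∑[ σ ∈ kids t s ] 𝟙 (unseen (P n) t σ n x)
        g n x s = collisions [] (labels n x s)
        k n x s = ∑[ c ∈ downFrom M ] 𝟙 (contains (n , x , s) c ∧ missedBy contains R (n , x , s))

      rare : Coll ≤ Z * suc (E t)
      rare = collisions-rare P cover covers (b′ t) Λ (E t) t d scale [] z≤n (light t)
        (light-guard t) (λ n x c → light-load t (P n) x c) (1≤b′ t) (weight-small t)
        (w * (r + r) * t) cost (budget d t d+t≡Q)

      length-places : length places ≡ Z * (m * K ^ d)
      length-places = trans (length-cartesianProduct (nets e h) _) (cong (Z *_)
        (trans (length-cartesianProduct (bits↓ L) _) (cong₂ _*_ (length-bits L) (length-starts d (suc t)))))

      -- Each of the `M` cells is new in at most a 1/r fraction of the places; this is the guarantee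
      -- of the greedy choice summed over the cells.
      fresh : r * Fresh ≤ M * (Z * (m * K ^ d))
      fresh = begin
        r * Fresh ≡⟨ cong (r *_) (∑-swap places (downFrom M)) ⟩
        r * ∑[ c ∈ downFrom M ] ∑[ τ ∈ places ] 𝟙 (contains τ c ∧ missedBy contains R τ)
                       ≡⟨ ∑-*ˡ (downFrom M) r ⟨
        ∑[ c ∈ downFrom M ] (r * ∑[ τ ∈ places ] 𝟙 (contains τ c ∧ missedBy contains R τ))
                       ≤⟨ ∑-downFrom-≤ M (proj₂ (proj₂ chosen)) ⟩
        M * length places ≡⟨ cong (M *_) length-places ⟩
        M * (Z * (m * K ^ d)) ∎
        where open ≤-Reasoning

      few′ : 4 * suc Q * Unseen P′ d (suc t) ≤ suc t * (Z * (m * K ^ d))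
      -- The factor 2 splits the loss of the round evenly between `coll` and `fresh′`.
      few′ = *-cancelˡ-≤ K {{>-nonZero 0<K}} (*-cancelˡ-≤ 2 (begin
        2 * (K * (4 * suc Q * U′)) ≡⟨ l₁ K q U′ ⟩
        8 * q * (K * U′) ≤⟨ *-monoʳ-≤ (8 * q) recurrence ⟩
        8 * q * (U + Coll + Fresh) ≡⟨ l₂ q U Coll Fresh ⟩
        2 * (4 * q * U) + 8 * q * Coll + 8 * q * Fresh
          ≤⟨ +-mono-≤ (+-mono-≤ (*-monoʳ-≤ 2 few) coll) fresh′ ⟩
        2 * (t * (Z * (m * K ^ suc d))) + Z * (m * K ^ suc d) + K * (Z * (m * K ^ d))
          ≡⟨ l₃ t Z m K (K ^ d) ⟩
        2 * (K * (suc t * (Z * (m * K ^ d)))) ∎))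
        where
        open ≤-Reasoning
        q = suc Q
        U′ = Unseen P′ d (suc t)
        U = Unseen P (suc d) t
        l₁ : ∀ K q U → 2 * (K * (4 * q * U)) ≡ 8 * q * (K * U)
        l₁ = solve-∀
        l₂ : ∀ q U V W → 8 * q * (U + V + W) ≡ 2 * (4 * q * U) + 8 * q * V + 8 * q * W
        l₂ = solve-∀
        l₃ : ∀ t Z m K k → 2 * (t * (Z * (m * (K * k)))) + Z * (m * (K * k)) + K * (Z * (m * k)) ≡
             2 * (K * ((1 + t) * (Z * (m * k))))
        l₃ = solve-∀
        l₄ : ∀ q Z e → 8 * q * (Z * e) ≡ Z * (8 * q * e)
        l₄ = solve-∀
        l₅ : ∀ r q F → r * (8 * q * F) ≡ 8 * q * (r * F)
        l₅ = solve-∀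
        coll : 8 * q * Coll ≤ Z * (m * K ^ suc d)
        coll = ≤-trans (*-monoʳ-≤ (8 * q) rare) (≤-trans (≤-reflexive (l₄ q Z (suc (E t))))
          (*-monoʳ-≤ Z (loss-small d t d+t≡Q)))
        fresh′ : 8 * q * Fresh ≤ K * (Z * (m * K ^ d))
        fresh′ = *-cancelˡ-≤ r {{>-nonZero 0<r}} (begin
          r * (8 * q * Fresh) ≡⟨ l₅ r q Fresh ⟩
          8 * q * (r * Fresh) ≤⟨ *-monoʳ-≤ (8 * q) fresh ⟩
          8 * q * (M * (Z * (m * K ^ d))) ≡⟨ *-assoc (8 * q) M _ ⟨
          8 * q * M * (Z * (m * K ^ d)) ≤⟨ *-monoˡ-≤ _ fresh-small ⟩
          r * K * (Z * (m * K ^ d)) ≡⟨ *-assoc r K _ ⟩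
          r * (K * (Z * (m * K ^ d))) ∎)

    stage : ∀ t d → d + t ≡ suc Q → Stage d t
    stage zero    d eq = start d
    stage (suc t) d eq = round d t eq (stage t (suc d) (trans (sym (+-suc d t)) eq))

    -- A window of scale `Q` that survives `Q` rounds has a query whose complete run is known. The
    -- collision bound is applied once more, with known correct answers in the role of collisions,
    -- and shows that such windows are rare.
    contradictory : ⊥
    contradictory = <⇒≱ few-large (≤-trans (*-monoʳ-≤ (8 * q) all-unseen-or-collide) total)
      where
      open Stage (stage Q 1 refl)
      q = suc Q
      answered : Known w → Vec Bool L → ℕ → List Bool → Maybe ℕ
      -- All correct answers carry the label 0, and the initial past `0 ∷ []` turns each of them
      -- into a collision.
      answered μ x i y = if (i ≤ᵇ h) ∧ (outcome μ (alg i y) is num i x) then just 0 else nothing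
      guard : ∀ μ x i y c → answered μ x i y ≡ just c → i ≤ h
      guard μ x i y c e with i ≤ᵇ h in eq
      ... | true = ≤ᵇ⇒≤ i h (subst T (sym eq) tt)
      answered-just : ∀ μ x i y c → answered μ x i y ≡ just c → outcome μ (alg i y) ≡ just (num i x) × c ≡ 0
      answered-just μ x i y c e with i ≤ᵇ h | outcome μ (alg i y) is num i x in eq
      answered-just μ x i y .0 refl | true | true = is-sound _ _ eq , refl
      -- At each level at most one position is answered with the token `x`: since the known cells
      -- are true, any other position is answered with the token located there.
      load : ∀ n x c → ∑[ i ∈ downFrom (suc h) ] ∑[ y ∈ bits↓ L ] 𝟙 (answered (P n) x i (toList y) is c) ≤ Λ
      load n x c = begin
        ∑[ i ∈ downFrom (suc h) ] ∑[ y ∈ bits↓ L ] 𝟙 (answered (P n) x i (toList y) is c)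
          ≤⟨ ∑-mono (downFrom (suc h)) (λ i → ∑-bits-unique L _ (route h n i x) (only i)) ⟩
        ∑[ _ ∈ downFrom (suc h) ] 1 ≡⟨ trans (∑-const (downFrom (suc h)) 1)
                                            (trans (*-identityʳ _) (List.length-downFrom (suc h))) ⟩
        suc h ≤⟨ levels-small ⟩
        Λ ∎
        where
        open ≤-Reasoning
        only : ∀ i y → (answered (P n) x i (toList y) is c) ≡ true → y ≡ route h n i x
        only i y e = trans (sym (route-unroute h n i y)) (cong (route h n i) (sym
          (num-injective i x x′ i≤h (outcome-sound (alg i (toList y)) (sound n) actual
            (proj₁ (answered-just (P n) x i (toList y) c (is-sound _ c e)))))))
          where
          i≤h = guard (P n) x i (toList y) c (is-sound _ c e)
          x′ = unroute h n i y
          actual : run (alg i (toList y)) (mem n) ≡ just (num i x′ , proj₁ (answers n i x′ i≤h))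
          actual = subst (λ z → run (alg i (toList z)) (mem n) ≡ just (num i x′ , proj₁ (answers n i x′ i≤h)))
            (route-unroute h n i y) (proj₁ (proj₂ (answers n i x′ i≤h)))
      lab : Known w → Vec Bool L → ℕ → List Bool → Maybe ℕ
      lab μ x i q = answered μ x i (q ++ drop i (toList x))
      labels : Net e h → Vec Bool L → ℕ → List (Maybe ℕ)
      labels n x s = Labels.kidLabels (lab (P n) x) Q s (toList (path h n x))
      Coll : ℕ
      Coll = ∑[ n ∈ nets e h ] ∑[ x ∈ bits↓ L ] ∑[ s ∈ starts 0 q ] collisions (0 ∷ []) (labels n x s)
      rare : Coll ≤ Z * suc (E Q)
      rare = collisions-rare P cover covers (b′ Q) Λ (E Q) Q 0 refl (0 ∷ []) ≤-refl answered
        guard load (1≤b′ Q) (weight-small Q) (w * (r + r) * Q) cost (budget 0 Q refl)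
      unlabelled : ∀ n x → ∀ σ → σ ∈ kids Q 0 →
        𝟙 (isNothing (Labels.label (lab (P n) x) Q σ (toList (path h n x)))) ≤ 𝟙 (unseen (P n) Q σ n x)
      unlabelled n x σ σ∈ = 𝟙≤ λ e → decide (unseen (P n) Q σ n x) refl (firstLabel-isNothing {l} e)
        where
        l = λ i → lab (P n) x i (take i (toList (path h n x)))
        decide : ∀ v → unseen (P n) Q σ n x ≡ v → All (λ i → l i ≡ nothing) (queryLevels Q σ) → 1 ≤ 𝟙 v
        decide true  _ _ = ≤-refl
        decide false q none with any (λ i → reach (P n) Q (query-at i n x)) (queryLevels Q σ) in eq
        ... | true with any-true (λ i → reach (P n) Q (query-at i n x)) (queryLevels Q σ) eq
        ...   | i , i∈ , p = contradiction (trans (sym (All.lookup none i∈)) some) (λ ())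
          where
          i≤h : i ≤ h
          i≤h = ≤-trans (proj₂ (All.lookup (All-queryLevels Q σ) i∈)) (proj₂ (All.lookup (All-kids Q 0) σ∈))
          some : l i ≡ just 0
          some rewrite ≤⇒≤ᵇ≡true i≤h
            | outcome-reach Q (query-at i n x) (sound n) (proj₁ (proj₂ (answers-at n i x i≤h)))
                (proj₂ (proj₂ (answers-at n i x i≤h))) p
            | ≡ᵇ-refl (num i x) = refl
      pointwise : ∀ n x → K ≤ ∑[ σ ∈ kids Q 0 ] 𝟙 (unseen (P n) Q σ n x) + collisions (0 ∷ []) (labels n x 0)
      pointwise n x = begin
        K ≡⟨ trans (List.length-map _ (kids Q 0)) (length-slots (W Q) K _) ⟨
        length (labels n x 0) ≤⟨ labels-count 1 (0 ∷ []) (labels n x 0) (All.map⁺ (All.tabulate λ {σ} _ → valid σ)) ⟩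
        ∑[ m ∈ labels n x 0 ] 𝟙 (isNothing m) + collisions (0 ∷ []) (labels n x 0) +
          ∑[ c ∈ downFrom 1 ] 𝟙 (any (_is c) (labels n x 0) ∧ not (any (_≡ᵇ c) (0 ∷ [])))
          ≡⟨ trans (cong (λ z → ∑[ m ∈ labels n x 0 ] 𝟙 (isNothing m) + collisions (0 ∷ []) (labels n x 0) +
                 (𝟙 z + 0)) (Bool.∧-zeroʳ (any (_is 0) (labels n x 0)))) (+-identityʳ _) ⟩
        ∑[ m ∈ labels n x 0 ] 𝟙 (isNothing m) + collisions (0 ∷ []) (labels n x 0)
          ≤⟨ +-monoˡ-≤ _ (≤-trans (≤-reflexive (∑-map _ (kids Q 0))) (∑-mono-∈ (kids Q 0) (unlabelled n x))) ⟩
        ∑[ σ ∈ kids Q 0 ] 𝟙 (unseen (P n) Q σ n x) + collisions (0 ∷ []) (labels n x 0) ∎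
        where
        open ≤-Reasoning
        valid : ∀ σ → Labels.label (lab (P n) x) Q σ (toList (path h n x)) bounded-by 1
        valid σ c z with firstLabel-just (All-queryLevels Q σ) z
        ... | i , _ , li = s≤s (≤-reflexive (proj₂ (answered-just (P n) x i _ c li)))
      all-unseen-or-collide : Z * (m * K ^ 1) ≤ Unseen P 1 Q + Coll
      all-unseen-or-collide = begin
        Z * (m * K ^ 1)
          ≡⟨ ∑-const N (m * K ^ 1) ⟨
        ∑[ _ ∈ N ] (m * K ^ 1)
          ≡⟨ ∑-cong N (λ _ → trans (∑-const X (K ^ 1)) (cong (_* K ^ 1) (length-bits L))) ⟨
        ∑[ _ ∈ N ] ∑[ _ ∈ X ] (K ^ 1)
          ≤⟨ ∑-mono N (λ n → ∑-mono X (λ x → ≤-trans (≤-reflexive (*-identityʳ K)) (pointwise n x))) ⟩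
        ∑[ n ∈ N ] ∑[ x ∈ X ] (f n x + collisions (0 ∷ []) (labels n x 0))
          ≡⟨ trans (∑-cong N (λ n → ∑-+ X)) (∑-+ N) ⟩
        ∑[ n ∈ N ] ∑[ x ∈ X ] f n x + ∑[ n ∈ N ] ∑[ x ∈ X ] collisions (0 ∷ []) (labels n x 0)
          ≡⟨ cong₂ _+_ (∑-cong N λ n → ∑-cong X λ x → sym (trans (∑-++ (kids Q 0) []) (+-identityʳ _)))
               (∑-cong N λ n → ∑-cong X λ x → sym (+-identityʳ _)) ⟩
        Unseen P 1 Q + Coll ∎
        where
        open ≤-Reasoning
        N = nets e h
        X = bits↓ L
        f : Net e h → Vec Bool L → ℕ
        f n x = ∑[ σ ∈ kids Q 0 ] 𝟙 (unseen (P n) Q σ n x)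
      0<Z : 0 < Z
      0<Z = ≰⇒> λ Z≤0 → contradiction (trans (sym (sq-length-nets e h)) (cong sq (n≤0⇒n≡0 Z≤0)))
        (m^n≢0′ (h * m))
        where
        m^n≢0′ : ∀ n → 2 ^ n ≡ 0 → ⊥
        m^n≢0′ n eq = <⇒≢ (m^n>0 2 n) (sym eq)
      total : 8 * q * (Unseen P 1 Q + Coll) ≤ (2 * Q + 1) * (Z * (m * K ^ 1))
      total = begin
        8 * q * (Unseen P 1 Q + Coll) ≡⟨ l₂ q (Unseen P 1 Q) Coll ⟩
        2 * (4 * q * Unseen P 1 Q) + 8 * q * Coll
          ≤⟨ +-mono-≤ (*-monoʳ-≤ 2 few) (≤-trans (*-monoʳ-≤ (8 * q) rare)
               (≤-trans (≤-reflexive (l₄ q Z (suc (E Q)))) (*-monoʳ-≤ Z (loss-small 0 Q refl)))) ⟩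
        2 * (Q * (Z * (m * K ^ 1))) + Z * (m * K ^ 1) ≡⟨ l₃ Q (Z * (m * K ^ 1)) ⟩
        (2 * Q + 1) * (Z * (m * K ^ 1)) ∎
        where
        open ≤-Reasoning
        l₂ : ∀ q U V → 8 * q * (U + V) ≡ 2 * (4 * q * U) + 8 * q * V
        l₂ = solve-∀
        l₃ : ∀ Q X → 2 * (Q * X) + X ≡ (2 * Q + 1) * X
        l₃ = solve-∀
        l₄ : ∀ q Z e → 8 * q * (Z * e) ≡ Z * (8 * q * e)
        l₄ = solve-∀
      few-large : (2 * Q + 1) * (Z * (m * K ^ 1)) < 8 * q * (Z * (m * K ^ 1))
      few-large = *-monoˡ-< (Z * (m * K ^ 1)) {{>-nonZero (*-mono-≤ 0<Z (*-mono-≤ (m^n>0 2 L)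
          (≤-trans 0<K (≤-reflexive (sym (*-identityʳ K))))))}}
        (≤-trans (m≤m+n (suc (2 * Q + 1)) (6 * Q + 6)) (≤-reflexive (l₅ Q)))
        where
        l₅ : ∀ Q → suc (2 * Q + 1) + (6 * Q + 6) ≡ 8 * suc Q
        l₅ = solve-∀

-- The text and its suffix array

precedes : List Bool → List Bool → Bool
precedes []      []      = false
precedes []      (_ ∷ _) = true
precedes (_ ∷ _) []      = false
precedes (a ∷ s) (b ∷ t) = if a xor b then b else precedes s t

precedes-irrefl : ∀ s → precedes s s ≡ false
precedes-irrefl []          = refl
precedes-irrefl (false ∷ s) = precedes-irrefl s
precedes-irrefl (true ∷ s)  = precedes-irrefl s

-- A mismatch inside both strings. Unlike mere inequality it excludes prefixes, so the comparison
-- ignores whatever is appended.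
differ : List Bool → List Bool → Bool
differ (a ∷ s) (b ∷ t) = (a xor b) ∨ differ s t
differ _       _       = false

precedes-++ : ∀ s t {s′ t′} → differ s t ≡ true → precedes (s ++ s′) (t ++ t′) ≡ precedes s t
precedes-++ (a ∷ s) (b ∷ t) d with a xor b
... | true  = refl
... | false = precedes-++ s t d

code : List Bool → List Bool
code []      = []
code (b ∷ l) = false ∷ b ∷ code l

code-++ : ∀ u v → code (u ++ v) ≡ code u ++ code v
code-++ []      v = refl
code-++ (b ∷ u) v = cong (λ z → false ∷ b ∷ z) (code-++ u v)

length-code : ∀ u → length (code u) ≡ 2 * length u
length-code []      = refl
length-code (b ∷ u) = cong suc (trans (cong suc (length-code u)) (sym (+-suc (length u) _)))

differ-code : ∀ u v s t → length u ≡ length v → u ≢ v → differ (code u ++ s) (code v ++ t) ≡ true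
differ-code []      []      s t _ ne = contradiction refl ne
differ-code (a ∷ u) (b ∷ v) s t e ne with a | b
... | true  | false = refl
... | false | true  = refl
... | true  | true  = differ-code u v s t (suc-injective e) (λ q → ne (cong (true ∷_) q))
... | false | false = differ-code u v s t (suc-injective e) (λ q → ne (cong (false ∷_) q))

-- The separator 011 begins neither at an even nor at an odd offset inside an
-- encoded word, so its first occurrence determines the level and the parity.
differ-separated : ∀ u v s t → (u ≡ v → differ s t ≡ true) →
  differ (code u ++ (false ∷ true ∷ true ∷ s)) (code v ++ (false ∷ true ∷ true ∷ t)) ≡ true
differ-separated []      []      s t d = d refl
differ-separated []      (true ∷ [])  s t d = refl
differ-separated []      (true ∷ _ ∷ _) s t d = refl
differ-separated []      (false ∷ v) s t d = refl
differ-separated (true ∷ []) [] s t d = refl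
differ-separated (true ∷ _ ∷ _) [] s t d = refl
differ-separated (false ∷ u) [] s t d = refl
differ-separated (a ∷ u) (b ∷ v) s t d with a | b
... | true  | false = refl
... | false | true  = refl
... | true  | true  = differ-separated u v s t (λ q → d (cong (true ∷_) q))
... | false | false = differ-separated u v s t (λ q → d (cong (false ∷_) q))

-- Without a mismatch every bit of either code faces a padding 0 of the other and is 0 itself, until
-- a 1 of one of the separators meets a 0.
differ-shifted : ∀ c u v t →
  differ (c ∷ code u ++ (false ∷ true ∷ true ∷ [])) (code v ++ (false ∷ true ∷ true ∷ t)) ≡ true
differ-shifted true  u        []          t = refl
differ-shifted true  u        (b ∷ v)     t = refl
differ-shifted false []       []          t = refl
differ-shifted false (c ∷ u)  []          t = refl
differ-shifted false []       (true ∷ v)  t = refl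
differ-shifted false (c ∷ u)  (true ∷ v)  t = refl
differ-shifted false []       (false ∷ [])    t = refl
differ-shifted false []       (false ∷ _ ∷ _) t = refl
differ-shifted false (c ∷ u)  (false ∷ v) t = differ-shifted c u v t

-- Reversed, so that dropping pairs from the front removes the last levels first: the codes of the
-- prefixes of a path are suffixes of its code.
rcode : List Bool → List Bool
rcode l = code (reverse l)

rcode-++ : ∀ u v → rcode (u ++ v) ≡ rcode v ++ rcode u
rcode-++ u v = trans (cong code (List.reverse-++ u v)) (code-++ (reverse v) (reverse u))

take-suc-snoc : ∀ j (l : List 𝔸) → j < length l → ∃[ c ] take (suc j) l ≡ take j l ++ c ∷ []
take-suc-snoc zero    (x ∷ l) _       = x , refl
take-suc-snoc (suc j) (x ∷ l) (s≤s p) with take-suc-snoc j l p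
... | c , e = c , cong (x ∷_) e

rcode-take-suc : ∀ j l → j < length l → ∃[ c ] rcode (take (suc j) l) ≡ false ∷ c ∷ rcode (take j l)
rcode-take-suc j l p with take-suc-snoc j l p
... | c , e = c , trans (cong rcode e) (rcode-++ (take j l) (c ∷ []))

suffixes : (List Bool → ℕ) → List Bool → List Bool → ℕ
suffixes f []      v = 0
suffixes f (c ∷ u) v = f (c ∷ u ++ v) + suffixes f u v

suffixes-++ : ∀ f u u′ v → suffixes f (u ++ u′) v ≡ suffixes f u (u′ ++ v) + suffixes f u′ v
suffixes-++ f []      u′ v = refl
suffixes-++ f (c ∷ u) u′ v = trans (cong₂ _+_ (cong (λ z → f (c ∷ z)) (List.++-assoc u u′ v)) (suffixes-++ f u u′ v))
  (sym (+-assoc (f (c ∷ u ++ (u′ ++ v))) _ _))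

suffixes-rcode : ∀ f l v k → k ≤ length l → suffixes f (rcode (take k l)) v ≡
  ∑[ j ∈ downFrom k ] (f (rcode (take (suc j) l) ++ v) + f (drop 1 (rcode (take (suc j) l)) ++ v))
suffixes-rcode f l v zero    _ = refl
suffixes-rcode f l v (suc k) p with rcode-take-suc k l p
... | c , e rewrite e = trans (sym (+-assoc (f (false ∷ c ∷ rcode (take k l) ++ v)) _ _))
  (cong (f (false ∷ c ∷ rcode (take k l) ++ v) + f (c ∷ rcode (take k l) ++ v) +_)
    (suffixes-rcode f l v k (≤-trans (n≤1+n k) p)))

before after : ∀ {n} → Vec Bool n → List (Vec Bool n)
before []          = []
before (false ∷ x) = map (false ∷_) (before x)
before (true ∷ x)  = map (false ∷_) (bits↓ _) ++ map (true ∷_) (before x)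
after []          = []
after (false ∷ x) = map (false ∷_) (after x) ++ map (true ∷_) (bits↓ _)
after (true ∷ x)  = map (true ∷_) (after x)

before-after : ∀ {n} (x : Vec Bool n) → before x ++ x ∷ after x ≡ bits↓ n
before-after []          = refl
before-after (false ∷ x) = trans (sym (List.++-assoc (map (false ∷_) (before x)) _ _)) (cong (_++ _)
  (trans (sym (List.map-++ (false ∷_) (before x) (x ∷ after x))) (cong (map (false ∷_)) (before-after x))))
before-after (true ∷ x)  = trans (List.++-assoc (map (false ∷_) (bits↓ _)) _ _) (cong (map (false ∷_) (bits↓ _) ++_)
  (trans (sym (List.map-++ (true ∷_) (before x) (x ∷ after x))) (cong (map (true ∷_)) (before-after x))))

split-unique : ∀ (us vs : List 𝔸) {x y us′ vs′} → length us ≡ length vs →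
               us ++ x ∷ us′ ≡ vs ++ y ∷ vs′ → x ≡ y
split-unique []       []       _ e = List.∷-injectiveˡ e
split-unique (_ ∷ us) (_ ∷ vs) l e = split-unique us vs (suc-injective l) (List.∷-injectiveʳ e)

before-injective : ∀ {n} (x y : Vec Bool n) → length (before x) ≡ length (before y) → x ≡ y
before-injective x y e = split-unique (before x) (before y) e (trans (before-after x) (sym (before-after y)))

suffixes-concatMap : ∀ n f (g : Vec Bool n → List Bool) v →
  suffixes f (concatMap g (bits↓ n)) v ≡ ∑[ x ∈ bits↓ n ] suffixes f (g x) (concatMap g (after x) ++ v)
suffixes-concatMap zero    f g v = trans (cong (λ z → suffixes f z v) (List.++-identityʳ (g []))) (sym (+-identityʳ _))
suffixes-concatMap (suc n) f g v = begin
  suffixes f (concatMap g (bits↓ (suc n))) v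
    ≡⟨ cong (λ z → suffixes f z v) (List.concatMap-++ g (map (false ∷_) (bits↓ n)) _) ⟩
  suffixes f (concatMap g (map (false ∷_) (bits↓ n)) ++ concatMap g (map (true ∷_) (bits↓ n))) v
    ≡⟨ cong₂ (λ p q → suffixes f (p ++ q) v) (List.concatMap-map g (false ∷_) (bits↓ n))
         (List.concatMap-map g (true ∷_) (bits↓ n)) ⟩
  suffixes f (concatMap g₀ (bits↓ n) ++ concatMap g₁ (bits↓ n)) v
    ≡⟨ suffixes-++ f (concatMap g₀ (bits↓ n)) _ v ⟩
  suffixes f (concatMap g₀ (bits↓ n)) (concatMap g₁ (bits↓ n) ++ v) + suffixes f (concatMap g₁ (bits↓ n)) v
    ≡⟨ cong₂ _+_ (suffixes-concatMap n f g₀ _) (suffixes-concatMap n f g₁ v) ⟩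
  ∑[ x ∈ bits↓ n ] suffixes f (g₀ x) (concatMap g₀ (after x) ++ (concatMap g₁ (bits↓ n) ++ v)) +
  ∑[ x ∈ bits↓ n ] suffixes f (g₁ x) (concatMap g₁ (after x) ++ v)
    ≡⟨ cong₂ _+_ (∑-cong (bits↓ n) (λ x → cong (suffixes f (g₀ x)) (low x)))
         (∑-cong (bits↓ n) (λ x → cong (λ z → suffixes f (g₁ x) (z ++ v)) (sym (List.concatMap-map g (true ∷_) (after x))))) ⟩
  ∑[ x ∈ bits↓ n ] F (false ∷ x) + ∑[ x ∈ bits↓ n ] F (true ∷ x)
    ≡⟨ ∑-bits n ⟨
  ∑ (bits↓ (suc n)) F ∎
  where
  open ≡-Reasoning
  g₀ g₁ : Vec Bool n → List Bool
  g₀ x = g (false ∷ x)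
  g₁ x = g (true ∷ x)
  F : Vec Bool (suc n) → ℕ
  F x = suffixes f (g x) (concatMap g (after x) ++ v)
  low : ∀ x → concatMap g₀ (after x) ++ (concatMap g₁ (bits↓ n) ++ v) ≡ concatMap g (after (false ∷ x)) ++ v
  low x = trans (sym (List.++-assoc (concatMap g₀ (after x)) _ v)) (cong (_++ v) (trans
    (cong₂ _++_ (sym (List.concatMap-map g (false ∷_) (after x))) (sym (List.concatMap-map g (true ∷_) (bits↓ n))))
    (sym (List.concatMap-++ g (map (false ∷_) (after x)) _))))

∑-route : ∀ {e} h (n : Net e h) i (f : Vec Bool (h + e) → ℕ) →
          ∑[ x ∈ bits↓ (h + e) ] f (route h n i x) ≡ ∑ (bits↓ (h + e)) f
∑-route zero    n i f = refl
∑-route (suc h) n zero f = refl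
∑-route {e} (suc h) (s , ns) (suc i) f = begin
  ∑[ x ∈ bits↓ (suc h + e) ] f (route (suc h) (s , ns) (suc i) x)
    ≡⟨ trans (∑-bits (h + e)) (sym (∑-+ (bits↓ (h + e)))) ⟩
  ∑[ y ∈ bits↓ (h + e) ] (f (route (suc h) (s , ns) (suc i) (false ∷ y)) + f (route (suc h) (s , ns) (suc i) (true ∷ y)))
    ≡⟨ ∑-cong (bits↓ (h + e)) token ⟩
  ∑[ y ∈ bits↓ (h + e) ] (f (false ∷ route h (proj₁ ns) i y) + f (true ∷ route h (proj₂ ns) i y))
    ≡⟨ ∑-+ (bits↓ (h + e)) ⟩
  ∑[ y ∈ bits↓ (h + e) ] f (false ∷ route h (proj₁ ns) i y) + ∑[ y ∈ bits↓ (h + e) ] f (true ∷ route h (proj₂ ns) i y)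
    ≡⟨ cong₂ _+_ (∑-route h (proj₁ ns) i (λ y → f (false ∷ y))) (∑-route h (proj₂ ns) i (λ y → f (true ∷ y))) ⟩
  ∑[ y ∈ bits↓ (h + e) ] f (false ∷ y) + ∑[ y ∈ bits↓ (h + e) ] f (true ∷ y)
    ≡⟨ ∑-bits (h + e) ⟨
  ∑ (bits↓ (suc h + e)) f ∎
  where
  open ≡-Reasoning
  token : ∀ y → f (route (suc h) (s , ns) (suc i) (false ∷ y)) + f (route (suc h) (s , ns) (suc i) (true ∷ y)) ≡
          f (false ∷ route h (proj₁ ns) i y) + f (true ∷ route h (proj₂ ns) i y)
  token y with leaf s y
  ... | false = refl
  ... | true  = +-comm (f (true ∷ route h (proj₂ ns) i y)) _

≺⇒precedes : ∀ {s t} → s ≺ t → precedes s t ≡ true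
≺⇒precedes (base ())
≺⇒precedes halt = refl
≺⇒precedes (this f<t) = refl
≺⇒precedes {x ∷ s} {_ ∷ t} (next refl p) rewrite Bool.xor-same x = ≺⇒precedes p

precedes-asym : ∀ s t → precedes s t ≡ true → precedes t s ≡ false
precedes-asym []          (_ ∷ _)     _ = refl
precedes-asym (true ∷ s)  (true ∷ t)  p = precedes-asym s t p
precedes-asym (false ∷ s) (false ∷ t) p = precedes-asym s t p
precedes-asym (false ∷ s) (true ∷ t)  p = refl

count-below : ∀ n (f : Fin n → Bool) (k : Fin n) → (∀ i → i Fin.< k → f i ≡ true) →
              (∀ i → k Fin.≤ i → f i ≡ false) → Sum.sum (λ i → 𝟙 (f i)) ≡ toℕ k
count-below (suc n) f zero smaller larger = zeros (suc n) f (λ i → larger i z≤n)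
  where
  zeros : ∀ n (f : Fin n → Bool) → (∀ i → f i ≡ false) → Sum.sum (λ i → 𝟙 (f i)) ≡ 0
  zeros zero    f z = refl
  zeros (suc n) f z rewrite z zero = zeros n (λ i → f (suc i)) (λ i → z (suc i))
count-below (suc n) f (suc k) smaller larger rewrite smaller zero (s≤s z≤n) =
  cong suc (count-below n (λ i → f (suc i)) k (λ i p → smaller (suc i) (s≤s p)) (λ i p → larger (suc i) (s≤s p)))

sum-suffix : ∀ (T : List Bool) f → Sum.sum (λ (j : Fin (length T)) → f (suffix T j)) ≡ suffixes f T []
sum-suffix []      f = refl
sum-suffix (c ∷ T) f = cong₂ _+_ (cong (λ z → f (c ∷ z)) (sym (List.++-identityʳ T))) (sum-suffix T f)

-- In sorted order the smaller suffixes are those of smaller index, hence the index is their number;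
-- permuting the sum counts them in text order instead.
SA-rank : ∀ T (a : Fin (length T)) →
          toℕ (SA T ⟨$⟩ˡ a) ≡ suffixes (λ s → 𝟙 (precedes s (suffix T a))) T []
SA-rank T a = begin
  toℕ k
    ≡⟨ count-below (length T) (λ i → precedes (suffix T (SA T ⟨$⟩ʳ i)) A) k smaller larger ⟨
  Sum.sum (λ i → 𝟙 (precedes (suffix T (SA T ⟨$⟩ʳ i)) A))
    ≡⟨ Sum.sum-permute (λ j → 𝟙 (precedes (suffix T j) A)) (SA T) ⟨
  Sum.sum (λ j → 𝟙 (precedes (suffix T j) A))
    ≡⟨ sum-suffix T (λ s → 𝟙 (precedes s A)) ⟩
  suffixes (λ s → 𝟙 (precedes s A)) T [] ∎
  where
  open ≡-Reasoning
  A = suffix T a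
  k = SA T ⟨$⟩ˡ a
  ka : SA T ⟨$⟩ʳ k ≡ a
  ka = inverseʳ (SA T)
  smaller : ∀ i → i Fin.< k → precedes (suffix T (SA T ⟨$⟩ʳ i)) A ≡ true
  smaller i i<k = ≺⇒precedes (subst (λ z → suffix T (SA T ⟨$⟩ʳ i) ≺ suffix T z) ka (SA-isSuffixArray T i<k))
  larger : ∀ i → k Fin.≤ i → precedes (suffix T (SA T ⟨$⟩ʳ i)) A ≡ false
  larger i k≤i with Fin.<-cmp k i
  ... | tri< k<i _ _ = precedes-asym A _ (≺⇒precedes
    (subst (λ z → suffix T z ≺ suffix T (SA T ⟨$⟩ʳ i)) ka (SA-isSuffixArray T k<i)))
  ... | tri≈ _ refl _ = trans (cong (λ z → precedes (suffix T z) A) ka) (precedes-irrefl A)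
  ... | tri> _ _ i<k = contradiction i<k (≤⇒≯ k≤i)

-- The levels of the network are spelled out in front of every token, in
-- reverse, so that the suffix of the block of x beginning with its first i
-- levels also begins with the reversed position of x at level i.
module Text (e h : ℕ) where

  L : ℕ
  L = h + e

  -- What follows `sep` in a block starts with 0, as a code or as an end marker; the third 1 of
  -- `end` therefore sets it apart from a separator.
  sep end : List Bool → List Bool
  sep v = false ∷ true ∷ true ∷ v
  end v = false ∷ true ∷ true ∷ true ∷ v

  trace : Net e h → Vec Bool L → List Bool
  trace n x = toList (path h n x)

  block : Net e h → Vec Bool L → List Bool
  block n x = rcode (trace n x) ++ sep (rcode (toList x) ++ end [])

  text : Net e h → List Bool
  text n = concatMap (block n) (bits↓ L)

  blockLength : ℕ
  blockLength = 2 * h + (3 + (2 * L + 4))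

  length-rcode : ∀ l → length (rcode l) ≡ 2 * length l
  length-rcode l = trans (length-code (reverse l)) (cong (2 *_) (List.length-reverse l))

  length-block : ∀ n x → length (block n x) ≡ blockLength
  length-block n x = trans (List.length-++ (rcode (trace n x))) (cong₂ _+_
    (trans (length-rcode (trace n x)) (cong (2 *_) (Vec.length-toList (path h n x))))
    (cong (3 +_) (trans (List.length-++ (rcode (toList x))) (cong (_+ 4)
      (trans (length-rcode (toList x)) (cong (2 *_) (Vec.length-toList x)))))))

  length-blocks : ∀ n xs → length (concatMap (block n) xs) ≡ length xs * blockLength
  length-blocks n []       = refl
  length-blocks n (x ∷ xs) = trans (List.length-++ (block n x)) (cong₂ _+_ (length-block n x) (length-blocks n xs))

  length-text : ∀ n → length (text n) ≡ 2 ^ L * blockLength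
  length-text n = trans (length-blocks n (bits↓ L)) (cong (_* blockLength) (length-bits L))

  rest : Net e h → Vec Bool L → List Bool
  rest n x = concatMap (block n) (after x)

  suffixAt : Net e h → ℕ → Vec Bool L → List Bool
  suffixAt n i x = rcode (take i (trace n x)) ++ sep (rcode (toList x) ++ end (rest n x))

  -- The part of a suffix that is fixed by its level and position. The trailing 0 begins whatever
  -- comes next, and it separates the key from an end marker even if `drop i y` is empty.
  key : ℕ → List Bool → List Bool
  key i y = rcode (take i y) ++ sep (rcode (drop i y) ++ (false ∷ []))

  code-head : ∀ u v → ∃[ s ] code u ++ false ∷ v ≡ false ∷ s
  code-head []      v = v , refl
  code-head (b ∷ u) v = b ∷ code u ++ false ∷ v , refl

  take-pos : ∀ i (p x : List Bool) → i ≤ length p → take i (pos i p x) ≡ take i p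
  take-pos zero    p       x _       = refl
  take-pos (suc i) (b ∷ p) x (s≤s q) = cong (b ∷_)
    (trans (cong (λ z → take i (take i p ++ z)) (drop-suc i x)) (take-pos i p (drop 1 x) q))
    where
    drop-suc : ∀ i (x : List Bool) → drop (suc i) x ≡ drop i (drop 1 x)
    drop-suc zero    []      = refl
    drop-suc (suc i) []      = refl
    drop-suc i       (_ ∷ x) = refl

  drop-pos : ∀ i (p x : List Bool) → i ≤ length p → drop i (pos i p x) ≡ drop i x
  drop-pos i p x q = trans (cong (λ k → drop k (take i p ++ drop i x))
      (sym (trans (List.length-take i p) (m≤n⇒m⊓n≡m q)))) (drop-++-length (take i p) (drop i x))
    where
    drop-++-length : ∀ (u v : List Bool) → drop (length u) (u ++ v) ≡ v
    drop-++-length []      v = refl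
    drop-++-length (_ ∷ u) v = drop-++-length u v

  position : Net e h → ℕ → Vec Bool L → List Bool
  position n i x = toList (route h n i x)

  take-position : ∀ n i x → i ≤ h → take i (position n i x) ≡ take i (trace n x)
  take-position n i x i≤h = trans (cong (take i) (toList-route h n i x i≤h))
    (take-pos i (trace n x) (toList x) (≤-trans i≤h (≤-reflexive (sym (Vec.length-toList (path h n x))))))

  drop-position : ∀ n i x → i ≤ h → drop i (position n i x) ≡ drop i (toList x)
  drop-position n i x i≤h = trans (cong (drop i) (toList-route h n i x i≤h))
    (drop-pos i (trace n x) (toList x) (≤-trans i≤h (≤-reflexive (sym (Vec.length-toList (path h n x))))))

  suffixAt-key : ∀ n i x → i ≤ h → ∃[ s ] suffixAt n i x ≡ key i (position n i x) ++ s
  suffixAt-key n i x i≤h with code-head (reverse (take i (toList x))) (true ∷ true ∷ true ∷ rest n x)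
  ... | s , eq = s , (begin
    rcode (take i (trace n x)) ++ sep (rcode (toList x) ++ end (rest n x))
      ≡⟨ cong₂ (λ u v → rcode u ++ sep (v ++ end (rest n x))) (sym (take-position n i x i≤h))
           (trans (cong rcode (sym (List.take++drop≡id i (toList x)))) (rcode-++ (take i (toList x)) _)) ⟩
    rcode (take i y) ++ sep ((rcode (drop i (toList x)) ++ rcode (take i (toList x))) ++ end (rest n x))
      ≡⟨ cong (λ z → rcode (take i y) ++ sep z) (trans (List.++-assoc (rcode (drop i (toList x))) _ _)
           (cong₂ (λ u v → rcode u ++ v) (sym (drop-position n i x i≤h)) eq)) ⟩
    rcode (take i y) ++ sep (rcode (drop i y) ++ (false ∷ s))
      ≡⟨ cong (λ z → rcode (take i y) ++ sep z) (sym (List.++-assoc (rcode (drop i y)) (false ∷ []) s)) ⟩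
    rcode (take i y) ++ (sep (rcode (drop i y) ++ (false ∷ [])) ++ s)
      ≡⟨ List.++-assoc (rcode (take i y)) _ s ⟨
    key i y ++ s ∎)
    where
    open ≡-Reasoning
    y = position n i x

  module Rank (n : Net e h) (i : ℕ) (a : Vec Bool L) (i≤h : i ≤ h) where

    y : List Bool
    y = position n i a

    κ A : List Bool
    κ = key i y
    A = suffixAt n i a

    A≡ : ∃[ s ] A ≡ κ ++ s
    A≡ = suffixAt-key n i a i≤h

    by-key : ∀ k {s} → differ k κ ≡ true → precedes (k ++ s) A ≡ precedes k κ
    by-key k {s} d = trans (cong (precedes (k ++ s)) (proj₂ A≡)) (precedes-++ k κ d)

    true-larger : ∀ s → precedes (true ∷ s) A ≡ false
    true-larger s with code-head (reverse (take i (trace n a))) (true ∷ true ∷ (rcode (toList a) ++ end (rest n a)))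
    ... | _ , eq rewrite eq = refl

    end-key : ∀ l v → precedes (rcode l ++ end v) A ≡ precedes (rcode l ++ end []) κ
    end-key l v = trans (cong (λ z → precedes z A) (sym (List.++-assoc (rcode l) (end []) v)))
      (by-key (rcode l ++ end []) (differ-separated (reverse l) (reverse (take i y)) (true ∷ []) _ (λ _ → ends)))
      where
      ends : differ (true ∷ []) (rcode (drop i y) ++ (false ∷ [])) ≡ true
      ends with code-head (reverse (drop i y)) []
      ... | _ , eq rewrite eq = refl

    odd-key : ∀ l j v → j < length l → precedes (drop 1 (rcode (take (suc j) l)) ++ sep v) A ≡
              precedes (drop 1 (rcode (take (suc j) l)) ++ sep []) κ
    odd-key l j v p with rcode-take-suc j l p
    ... | c , eq rewrite eq = trans (cong (λ z → precedes (c ∷ z) A) (sym (List.++-assoc (rcode (take j l)) (sep []) v)))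
      (by-key (c ∷ rcode (take j l) ++ sep []) (differ-shifted c (reverse (take j l)) (reverse (take i y)) _))

    take-length : ∀ {j l} {u v : List Bool} → length u ≡ l → length v ≡ l → i ≤ l → j ≤ l →
                  take j u ≡ take i v → j ≡ i
    take-length {j} {l} {u} {v} lu lv i≤l j≤l eq = trans (sym (size j u lu j≤l)) (trans (cong length eq) (size i v lv i≤l))
      where
      size : ∀ k u → length u ≡ l → k ≤ l → length (take k u) ≡ k
      size k u lu k≤l = trans (List.length-take k u) (trans (cong (k ⊓_) lu) (m≤n⇒m⊓n≡m k≤l))

    -- Equal keys would mean equal level and equal position, hence the same token because routing is
    -- injective. So two different suffixes of this kind already differ inside their keys.
    distinct : ∀ j x → j ≤ h → ¬ (j ≡ i × x ≡ a) → precedes (suffixAt n j x) A ≡ precedes (key j (position n j x)) κ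
    distinct j x j≤h ne = trans (cong (λ z → precedes z A) (proj₂ (suffixAt-key n j x j≤h)))
      (by-key (key j z) (differ-separated (reverse (take j z)) (reverse (take i y)) _ _ tails))
      where
      z = position n j x
      L≥ : h ≤ L
      L≥ = m≤m+n h e
      lz : length z ≡ L
      lz = Vec.length-toList (route h n j x)
      ly : length y ≡ L
      ly = Vec.length-toList (route h n i a)
      tails : reverse (take j z) ≡ reverse (take i y) →
              differ (rcode (drop j z) ++ (false ∷ [])) (rcode (drop i y) ++ (false ∷ [])) ≡ true
      tails eq = differ-code (reverse (drop j z)) (reverse (drop i y)) _ _ same-length
        (λ q → ne (j≡i , tokens (List.reverse-injective q)))
        where
        heads : take j z ≡ take i y
        heads = List.reverse-injective eq
        j≡i : j ≡ i
        j≡i = take-length lz ly (≤-trans i≤h L≥) (≤-trans j≤h L≥) heads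
        same-length : length (reverse (drop j z)) ≡ length (reverse (drop i y))
        same-length = trans (List.length-reverse (drop j z)) (trans (List.length-drop j z)
          (trans (cong₂ _∸_ (trans lz (sym ly)) j≡i)
            (sym (trans (List.length-reverse (drop i y)) (List.length-drop i y)))))
        tokens : drop j z ≡ drop i y → x ≡ a
        tokens q = trans (sym (unroute-route h n j x)) (trans (cong (unroute h n j) same-route)
          (trans (cong (λ k → unroute h n k (route h n i a)) j≡i) (unroute-route h n i a)))
          where
          same-route : route h n j x ≡ route h n i a
          same-route = trans (sym (Vec.cast-is-id refl _)) (Vec.toList-injective refl _ _
            (trans (sym (List.take++drop≡id j z)) (trans (cong₂ _++_ heads q) (List.take++drop≡id i y))))

    -- The one case without a mismatch is the comparison of the suffix with itself, where both sides
    -- are false.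
    level-key : ∀ j x → j ≤ h → precedes (suffixAt n j x) A ≡ precedes (key j (position n j x)) κ
    level-key j x j≤h with j ≟ i | Vec.≡-dec Bool._≟_ x a
    ... | yes refl | yes refl = trans (precedes-irrefl A) (sym (precedes-irrefl κ))
    ... | yes refl | no x≢a   = distinct j x j≤h (λ { (_ , e) → x≢a e })
    ... | no j≢i   | _        = distinct j x j≤h (λ { (e , _) → j≢i e })

  -- The three kinds of suffixes that can be smaller: those starting at a pair of the path or at the
  -- separator, those starting in the middle of a pair, and those starting at a pair of the token or
  -- at its end marker. A suffix starting with a 1 of a marker is never smaller.
  levelTerm oddTerm endTerm : List Bool → ℕ → List Bool → ℕ
  levelTerm κ j z = 𝟙 (precedes (key j z) κ)
  oddTerm   κ j z = 𝟙 (precedes (drop 1 (rcode (take (suc j) z)) ++ sep []) κ)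
  endTerm   κ j z = 𝟙 (precedes (rcode (take j z) ++ end []) κ)

  contribution : List Bool → Vec Bool L → ℕ
  contribution κ z = ∑[ j ∈ downFrom h ] (levelTerm κ (suc j) (toList z) + oddTerm κ j (toList z)) +
    (levelTerm κ 0 (toList z) +
     (∑[ j ∈ downFrom L ] (endTerm κ (suc j) (toList z) + oddTerm κ j (toList z)) + endTerm κ 0 []))

  -- Independent of the network: at every level the tokens occupy each position exactly once.
  rank : ℕ → List Bool → ℕ
  rank i y = ∑ (bits↓ L) (contribution (key i y))

  module _ (n : Net e h) (i : ℕ) (a : Vec Bool L) (i≤h : i ≤ h) where

    open Rank n i a i≤h

    private
      g : List Bool → ℕ
      g s = 𝟙 (precedes s A)

    smaller-in-block : ∀ x → suffixes g (block n x) (rest n x ++ []) ≡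
      ∑[ j ∈ downFrom h ] (levelTerm κ (suc j) (position n (suc j) x) + oddTerm κ j (position n (suc j) x)) +
      (levelTerm κ 0 (position n 0 x) +
       (∑[ j ∈ downFrom L ] (endTerm κ (suc j) (toList x) + oddTerm κ j (toList x)) + endTerm κ 0 []))
    smaller-in-block x = begin
      suffixes g (rcode p ++ sep (rcode X ++ end [])) (v ++ [])
        ≡⟨ cong (suffixes g (rcode p ++ sep (rcode X ++ end []))) (List.++-identityʳ v) ⟩
      suffixes g (rcode p ++ sep (rcode X ++ end [])) v
        ≡⟨ suffixes-++ g (rcode p) _ v ⟩
      suffixes g (rcode p) (sep (rcode X ++ end []) ++ v) + suffixes g (sep (rcode X ++ end [])) v
        ≡⟨ cong₂ _+_ levels separator ⟩
      ∑[ j ∈ downFrom h ] (levelTerm κ (suc j) (position n (suc j) x) + oddTerm κ j (position n (suc j) x)) +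
      (levelTerm κ 0 (position n 0 x) +
       (∑[ j ∈ downFrom L ] (endTerm κ (suc j) X + oddTerm κ j X) + endTerm κ 0 [])) ∎
      where
      open ≡-Reasoning
      p = trace n x
      X = toList x
      v = rest n x
      lp : length p ≡ h
      lp = Vec.length-toList (path h n x)
      lX : length X ≡ L
      lX = Vec.length-toList x
      tail : (rcode X ++ end []) ++ v ≡ rcode X ++ end v
      tail = List.++-assoc (rcode X) (end []) v
      ∑-downFrom-cong : ∀ k {f f′ : ℕ → ℕ} → (∀ j → j < k → f j ≡ f′ j) → ∑ (downFrom k) f ≡ ∑ (downFrom k) f′
      ∑-downFrom-cong zero    eq = refl
      ∑-downFrom-cong (suc k) eq = cong₂ _+_ (eq k ≤-refl) (∑-downFrom-cong k (λ j q → eq j (m≤n⇒m≤1+n q)))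
      full : ∀ {l k} → length l ≡ k → suffixes g (rcode l) ≡ suffixes g (rcode (take k l))
      full {l} {k} e = cong (λ z → suffixes g (rcode z)) (sym (List.take-all k l (≤-reflexive e)))
      levels : suffixes g (rcode p) (sep (rcode X ++ end []) ++ v) ≡
        ∑[ j ∈ downFrom h ] (levelTerm κ (suc j) (position n (suc j) x) + oddTerm κ j (position n (suc j) x))
      levels = trans (cong₂ (λ f z → f (sep z)) (full lp) tail)
        (trans (suffixes-rcode g p (sep (rcode X ++ end v)) h (≤-reflexive (sym lp)))
          (∑-downFrom-cong h λ j j<h → cong₂ _+_ (cong 𝟙 (level-key (suc j) x j<h))
            (trans (cong 𝟙 (odd-key p j (rcode X ++ end v) (≤-trans j<h (≤-reflexive (sym lp)))))
              (cong (λ z → 𝟙 (precedes (drop 1 (rcode z) ++ sep []) κ)) (sym (take-position n (suc j) x j<h))))))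
      token : suffixes g (rcode X ++ end []) v ≡
        ∑[ j ∈ downFrom L ] (endTerm κ (suc j) X + oddTerm κ j X) + endTerm κ 0 []
      token = trans (suffixes-++ g (rcode X) (end []) v) (cong₂ _+_
        (trans (cong (λ f → f (end v)) (full lX))
          (trans (suffixes-rcode g X (end v) L (≤-reflexive (sym lX)))
            (∑-downFrom-cong L λ j j<L → cong₂ _+_ (cong 𝟙 (end-key (take (suc j) X) v))
              (cong 𝟙 (odd-key X j (true ∷ v) (≤-trans j<L (≤-reflexive (sym lX))))))))
        (trans (cong₂ _+_ (cong 𝟙 (end-key [] v)) (cong₂ _+_ (cong 𝟙 (true-larger _))
          (cong₂ _+_ (cong 𝟙 (true-larger _)) (cong (_+ 0) (cong 𝟙 (true-larger v)))))) (+-identityʳ _)))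
      separator : suffixes g (sep (rcode X ++ end [])) v ≡ levelTerm κ 0 (position n 0 x) +
        (∑[ j ∈ downFrom L ] (endTerm κ (suc j) X + oddTerm κ j X) + endTerm κ 0 [])
      separator = cong₂ _+_ (trans (cong (λ z → g (sep z)) tail) (cong 𝟙 (level-key 0 x z≤n)))
        (trans (cong₂ _+_ (cong 𝟙 (true-larger _)) (cong (_+ suffixes g (rcode X ++ end []) v) (cong 𝟙 (true-larger _))))
          token)

    smaller-in-text : suffixes g (text n) [] ≡ rank i y
    smaller-in-text = begin
      suffixes g (text n) []
        ≡⟨ suffixes-concatMap L g (block n) [] ⟩
      ∑[ x ∈ bits↓ L ] suffixes g (block n x) (rest n x ++ [])
        ≡⟨ ∑-cong (bits↓ L) smaller-in-block ⟩
      ∑[ x ∈ bits↓ L ] (∑[ j ∈ downFrom h ] f (suc j) j (position n (suc j) x) + (f₀ (position n 0 x) + f₁ x))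
        ≡⟨ trans (∑-+ (bits↓ L)) (cong₂ _+_ (∑-swap (bits↓ L) (downFrom h)) (∑-+ (bits↓ L))) ⟩
      ∑[ j ∈ downFrom h ] ∑[ x ∈ bits↓ L ] f (suc j) j (position n (suc j) x) +
      (∑[ x ∈ bits↓ L ] f₀ (position n 0 x) + ∑ (bits↓ L) f₁)
        ≡⟨ cong₂ _+_ (∑-cong (downFrom h) (λ j → ∑-route h n (suc j) (λ z → f (suc j) j (toList z))))
             (cong (_+ ∑ (bits↓ L) f₁) (∑-route h n 0 (λ z → f₀ (toList z)))) ⟩
      ∑[ j ∈ downFrom h ] ∑[ z ∈ bits↓ L ] f (suc j) j (toList z) +
      (∑[ z ∈ bits↓ L ] f₀ (toList z) + ∑ (bits↓ L) f₁)
        ≡⟨ trans (∑-+ (bits↓ L)) (cong₂ _+_ (∑-swap (bits↓ L) (downFrom h)) (∑-+ (bits↓ L))) ⟨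
      rank i y ∎
      where
      open ≡-Reasoning
      f : ℕ → ℕ → List Bool → ℕ
      f k j z = levelTerm κ k z + oddTerm κ j z
      f₀ : List Bool → ℕ
      f₀ = levelTerm κ 0
      f₁ : Vec Bool L → ℕ
      f₁ x = ∑[ j ∈ downFrom L ] (endTerm κ (suc j) (toList x) + oddTerm κ j (toList x)) + endTerm κ 0 []

  -- The suffix of level `i` starts after the pairs of the `h ∸ i` later levels. At a given level
  -- the number determines the token, so the answer reveals the token at a position.
  number : ℕ → Vec Bool L → ℕ
  number i x = length (before x) * blockLength + 2 * (h ∸ i)

  drop-++ : ∀ (u v : List Bool) k → drop (length u + k) (u ++ v) ≡ drop k v
  drop-++ []      v k = refl
  drop-++ (_ ∷ u) v k = drop-++ u v k

  drop-number : ∀ n i x → i ≤ h → drop (number i x) (text n) ≡ suffixAt n i x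
  drop-number n i x i≤h = begin
    drop (number i x) (text n)
      ≡⟨ cong (drop (number i x)) (trans (cong (concatMap (block n)) (sym (before-after x)))
           (List.concatMap-++ (block n) (before x) (x ∷ after x))) ⟩
    drop (number i x) (concatMap (block n) (before x) ++ (block n x ++ rest n x))
      ≡⟨ cong (λ z → drop (z + 2 * (h ∸ i)) (concatMap (block n) (before x) ++ (block n x ++ rest n x)))
           (sym (length-blocks n (before x))) ⟩
    drop (length (concatMap (block n) (before x)) + 2 * (h ∸ i)) (concatMap (block n) (before x) ++ (block n x ++ rest n x))
      ≡⟨ drop-++ (concatMap (block n) (before x)) _ (2 * (h ∸ i)) ⟩
    drop (2 * (h ∸ i)) (block n x ++ rest n x)
      ≡⟨ cong (drop (2 * (h ∸ i))) block≡ ⟩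
    drop (2 * (h ∸ i)) (rcode (drop i p) ++ suffixAt n i x)
      ≡⟨ cong (λ z → drop z (rcode (drop i p) ++ suffixAt n i x)) skipped ⟩
    drop (length (rcode (drop i p)) + 0) (rcode (drop i p) ++ suffixAt n i x)
      ≡⟨ drop-++ (rcode (drop i p)) _ 0 ⟩
    suffixAt n i x ∎
    where
    open ≡-Reasoning
    p = trace n x
    skipped : 2 * (h ∸ i) ≡ length (rcode (drop i p)) + 0
    skipped = sym (trans (+-identityʳ _) (trans (length-rcode (drop i p)) (cong (2 *_)
      (trans (List.length-drop i p) (cong (_∸ i) (Vec.length-toList (path h n x)))))))
    block≡ : block n x ++ rest n x ≡ rcode (drop i p) ++ suffixAt n i x
    block≡ = begin
      (rcode p ++ sep (rcode (toList x) ++ end [])) ++ rest n x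
        ≡⟨ List.++-assoc (rcode p) _ (rest n x) ⟩
      rcode p ++ sep ((rcode (toList x) ++ end []) ++ rest n x)
        ≡⟨ cong₂ (λ u v → u ++ sep v)
             (trans (cong rcode (sym (List.take++drop≡id i p))) (rcode-++ (take i p) (drop i p)))
             (List.++-assoc (rcode (toList x)) (end []) (rest n x)) ⟩
      (rcode (drop i p) ++ rcode (take i p)) ++ sep (rcode (toList x) ++ end (rest n x))
        ≡⟨ List.++-assoc (rcode (drop i p)) (rcode (take i p)) _ ⟩
      rcode (drop i p) ++ suffixAt n i x ∎

  number<length : ∀ n i x → i ≤ h → number i x < length (text n)
  number<length n i x i≤h = inside (number i x) (text n) (trans (drop-number n i x i≤h)
    (proj₂ (code-head (reverse (take i (trace n x))) _)))
    where
    inside : ∀ k (l : List Bool) {c s} → drop k l ≡ c ∷ s → k < length l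
    inside zero    (_ ∷ l) _ = s≤s z≤n
    inside (suc k) (_ ∷ l) e = s≤s (inside k l e)

  number-injective : ∀ i x x′ → suc (number i x) ≡ suc (number i x′) → x ≡ x′
  number-injective i x x′ e = before-injective x x′
    (*-cancelʳ-≡ _ _ blockLength {{>-nonZero (≤-trans (s≤s z≤n) (m≤n+m _ (2 * h)))}}
      (+-cancelʳ-≡ (2 * (h ∸ i)) _ _ (suc-injective e)))

  SA-answers : ∀ {w} (D : CellProbeStructure w (List Bool) ℕ ℕ) Q n → AnswersSA D (text n) Q →
    ∀ i x → i ≤ h → ∃[ t ] run (query D (suc (rank i (position n i x)))) (preprocess D (text n))
                           ≡ just (suc (number i x) , t) × t ≤ Q
  SA-answers D Q n answers i x i≤h = subst₂
    (λ k j → ∃[ t ] run (query D (suc k)) (preprocess D (text n)) ≡ just (suc j , t) × t ≤ Q)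
    index (trans (cong toℕ (inverseʳ (SA (text n)))) (Fin.toℕ-fromℕ< (number<length n i x i≤h)))
    (answers (SA (text n) ⟨$⟩ˡ a))
    where
    a : Fin (length (text n))
    a = fromℕ< (number<length n i x i≤h)
    suffix-a : suffix (text n) a ≡ suffixAt n i x
    suffix-a = trans (cong (λ k → drop k (text n)) (Fin.toℕ-fromℕ< (number<length n i x i≤h))) (drop-number n i x i≤h)
    index : toℕ (SA (text n) ⟨$⟩ˡ a) ≡ rank i (position n i x)
    index = trans (SA-rank (text n) a)
      (trans (cong (λ s → suffixes (λ t → 𝟙 (precedes t s)) (text n) []) suffix-a) (smaller-in-text n i x i≤h))

-- Each scale loses a factor 1 + 1/q to the buffers; over d ≤ q scales this amounts to at most q + 1.
buffers-cheap : ∀ q d c → d + c ≡ q → suc q ^ d * suc c ≤ suc q * q ^ d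
buffers-cheap q zero    c refl = ≤-reflexive (trans (+-identityʳ (suc q)) (sym (*-identityʳ (suc q))))
buffers-cheap q (suc d) c eq = begin
  suc q * suc q ^ d * suc c ≡⟨ l₁ q (suc q ^ d) c ⟩
  suc q ^ d * (suc q * suc c) ≤⟨ *-monoʳ-≤ (suc q ^ d) loss ⟩
  suc q ^ d * (suc (suc c) * q) ≡⟨ *-assoc (suc q ^ d) _ q ⟨
  suc q ^ d * suc (suc c) * q ≤⟨ *-monoˡ-≤ q (buffers-cheap q d (suc c) (trans (+-suc d c) eq)) ⟩
  suc q * q ^ d * q ≡⟨ l₂ q (q ^ d) ⟩
  suc q * (q * q ^ d) ∎
  where
  open ≤-Reasoning
  l₁ : ∀ q x c → (1 + q) * x * (1 + c) ≡ x * ((1 + q) * (1 + c))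
  l₁ = solve-∀
  l₂ : ∀ q x → (1 + q) * x * q ≡ (1 + q) * (q * x)
  l₂ = solve-∀
  c<q : suc c ≤ q
  c<q = ≤-trans (s≤s (m≤n+m c d)) (≤-reflexive eq)
  l₃ : ∀ q c → (1 + q) * (1 + c) ≡ q * (1 + c) + (1 + c)
  l₃ = solve-∀
  l₄ : ∀ q c → q * (1 + c) + q ≡ (2 + c) * q
  l₄ = solve-∀
  loss : suc q * suc c ≤ suc (suc c) * q
  loss = ≤-trans (≤-reflexive (l₃ q c)) (≤-trans (+-monoʳ-≤ (q * suc c) c<q) (≤-reflexive (l₄ q c)))

-- Choice of the numerical parameters

pow-* : ∀ a b n → (a * b) ^ n ≡ a ^ n * b ^ n
pow-* a b zero    = refl
pow-* a b (suc n) = trans (cong (a * b *_) (pow-* a b n)) (l a b (a ^ n) (b ^ n))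
  where
  l : ∀ a b x y → a * b * (x * y) ≡ a * x * (b * y)
  l = solve-∀

-- `κ` bounds the memory in units of `m * h` bits, one greedy choice publishes a share `1/c` of
-- `m * h` bits, and `γ` bounds the resulting ratio of memory cells to published cells, with a
-- factor 2 for rounding. A buffer of scale `t + 1` is as long as `8 * γ` windows of scale `t`, so
-- windows grow by the factor `R = K + 8 * γ`.
module Parameters (Q κ g c : ℕ) where

  q u γ K R : ℕ
  q = suc Q
  u = suc q
  γ = 2 * κ * c
  K = 8 * γ * q
  R = 8 * γ * u

  b′ b : ℕ → ℕ
  b′ zero    = g
  b′ (suc t) = 2 * γ * (R ^ t * (4 * g))
  b t = 4 * b′ t

  open Windows b K

  W≡ : ∀ t → W t ≡ R ^ t * (4 * g)
  W≡ zero    = refl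
  W≡ (suc t) = trans (cong (λ z → 4 * (2 * γ * (R ^ t * (4 * g))) + K * z) (W≡ t)) (l γ q (R ^ t) g)
    where
    l : ∀ γ q x g → 4 * (2 * γ * (x * (4 * g))) + 8 * γ * q * (x * (4 * g)) ≡ 8 * γ * (1 + q) * x * (4 * g)
    l = solve-∀

  h : ℕ
  h = W (suc Q)

  module Bound (w e : ℕ) (0<w : 0 < w) (0<κ : 0 < κ) (0<c : 0 < c)
    (c-large : 256 * (q * (u * u) * Q) ≤ c) (g-large : 32 * q ≤ g)
    (exponent : suc K * (4 * c * w + suc h) ≤ 2 ^ (2 * g)) where

    m r M Λ : ℕ
    m = 2 ^ (h + e)
    Λ = 4 * c * w + suc h
    instance
      w≢0 : NonZero w
      w≢0 = >-nonZero 0<w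
      cw≢0 : NonZero (c * w)
      cw≢0 = >-nonZero (*-mono-≤ 0<c 0<w)
    r = m * h / (c * w)
    M = κ * (m * h) / w

    0<γ : 0 < γ
    0<γ = *-mono-≤ {1} {2 * κ} (*-mono-≤ {1} {2} (s≤s z≤n) 0<κ) 0<c

    0<R : 0 < R
    0<R = *-mono-≤ {1} {8 * γ} (*-mono-≤ {1} {8} (s≤s z≤n) 0<γ) (s≤s z≤n)

    0<K : 0 < K
    0<K = *-mono-≤ {1} {8 * γ} (*-mono-≤ {1} {8} (s≤s z≤n) 0<γ) (s≤s z≤n)

    g≤b′ : ∀ t → g ≤ b′ t
    g≤b′ zero    = ≤-refl
    g≤b′ (suc t) = ≤-trans (≤-trans (≤-reflexive (sym (*-identityˡ g)))
        (*-monoˡ-≤ g {1} {4} (s≤s z≤n)))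
      (≤-trans (≤-trans (≤-reflexive (sym (*-identityˡ (4 * g)))) (*-monoˡ-≤ (4 * g) (m^n>0 R {{>-nonZero 0<R}} t)))
        (≤-trans (≤-reflexive (sym (*-identityˡ (R ^ t * (4 * g)))))
          (*-monoˡ-≤ (R ^ t * (4 * g)) {1} {2 * γ} (*-mono-≤ {1} {2} (s≤s z≤n) 0<γ))))

    32q≤b′ : ∀ t → 32 * q ≤ b′ t
    32q≤b′ t = ≤-trans g-large (g≤b′ t)

    0<b′ : ∀ t → 1 ≤ b′ t
    0<b′ t = ≤-trans (s≤s z≤n) (32q≤b′ t)

    W≤b′ : ∀ t → W t ≤ 4 * u * b′ t
    W≤b′ zero    = ≤-trans (≤-reflexive (+-identityʳ (4 * g))) (*-monoˡ-≤ g (m≤m*n 4 u))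
    W≤b′ (suc t) = ≤-reflexive (trans (W≡ (suc t)) (l γ u (R ^ t) g))
      where
      l : ∀ γ u x g → 8 * γ * u * x * (4 * g) ≡ 4 * u * (2 * γ * (x * (4 * g)))
      l = solve-∀

    -- Windows of scale `t` fill at least a share `1/u` of all levels: their outer buffers cost only
    -- a factor `(1 + 1/q) ^ suc d`, which `buffers-cheap` bounds by `u`.
    h≤W : ∀ d t → d + t ≡ Q → h ≤ u * (K ^ suc d * W t)
    h≤W d t eq = begin
      h ≡⟨ W≡ (suc Q) ⟩
      R ^ suc Q * (4 * g) ≡⟨ cong (λ z → R ^ suc z * (4 * g)) eq ⟨
      R ^ suc (d + t) * (4 * g) ≡⟨ cong (_* (4 * g)) (^-distribˡ-+-* R (suc d) t) ⟩
      R ^ suc d * R ^ t * (4 * g) ≡⟨ cong (λ z → z * R ^ t * (4 * g)) (pow-* (8 * γ) u (suc d)) ⟩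
      (8 * γ) ^ suc d * u ^ suc d * R ^ t * (4 * g)
        ≤⟨ *-monoˡ-≤ (4 * g) (*-monoˡ-≤ (R ^ t) (*-monoʳ-≤ ((8 * γ) ^ suc d) powers)) ⟩
      (8 * γ) ^ suc d * (u * q ^ suc d) * R ^ t * (4 * g)
        ≡⟨ l ((8 * γ) ^ suc d) u (q ^ suc d) (R ^ t) (4 * g) ⟩
      u * ((8 * γ) ^ suc d * q ^ suc d * (R ^ t * (4 * g)))
        ≡⟨ cong₂ (λ x y → u * (x * y)) (pow-* (8 * γ) q (suc d)) (W≡ t) ⟨
      u * (K ^ suc d * W t) ∎
      where
      open ≤-Reasoning
      l : ∀ a b c d e → a * (b * c) * d * e ≡ b * (a * c * (d * e))
      l = solve-∀
      powers : u ^ suc d ≤ u * q ^ suc d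
      powers = ≤-trans (m≤m*n (u ^ suc d) (suc t)) (buffers-cheap q (suc d) t (cong suc eq))

    2g≤h : 2 * g ≤ h
    2g≤h = ≤-trans (*-monoˡ-≤ g {2} {4} (s≤s (s≤s z≤n)))
      (≤-trans (≤-trans (≤-reflexive (sym (*-identityˡ (4 * g))))
        (*-monoˡ-≤ (4 * g) (m^n>0 R {{>-nonZero 0<R}} (suc Q)))) (≤-reflexive (sym (W≡ (suc Q)))))

    0<h : 0 < h
    0<h = ≤-trans (≤-trans (s≤s z≤n) (*-monoʳ-≤ 2 (≤-trans (s≤s z≤n) g-large))) 2g≤h

    cw≤mh : c * w ≤ m * h
    cw≤mh = begin
      c * w ≤⟨ m≤n*m (c * w) 4 ⟩
      4 * (c * w) ≡⟨ *-assoc 4 c w ⟨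
      4 * c * w ≤⟨ m≤m+n (4 * c * w) (suc h) ⟩
      4 * c * w + suc h ≤⟨ m≤n*m (4 * c * w + suc h) (suc K) ⟩
      suc K * (4 * c * w + suc h) ≤⟨ exponent ⟩
      2 ^ (2 * g) ≤⟨ ^-monoʳ-≤ 2 (≤-trans 2g≤h (m≤m+n h e)) ⟩
      m ≤⟨ m≤m*n m h {{>-nonZero 0<h}} ⟩
      m * h ∎
      where open ≤-Reasoning

    rcw≤mh : r * (c * w) ≤ m * h
    rcw≤mh = m/n*n≤m (m * h) (c * w)

    0<r : 0 < r
    0<r = ≰⇒> λ r≤0 → <⇒≱ (m%n<n (m * h) (c * w)) (≤-trans cw≤mh (≤-reflexive
      (trans (m≡m%n+[m/n]*n (m * h) (c * w))
        (trans (cong (λ z → m * h % (c * w) + z * (c * w)) (n≤0⇒n≡0 r≤0)) (+-identityʳ _)))))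

    mh≤ : m * h ≤ 2 * (r * (c * w))
    mh≤ = begin
      m * h ≡⟨ m≡m%n+[m/n]*n (m * h) (c * w) ⟩
      m * h % (c * w) + r * (c * w)
        ≤⟨ +-monoˡ-≤ (r * (c * w)) (≤-trans (<⇒≤ (m%n<n (m * h) (c * w))) (m≤n*m (c * w) r {{>-nonZero 0<r}})) ⟩
      r * (c * w) + r * (c * w) ≡⟨ cong (r * (c * w) +_) (+-identityʳ (r * (c * w))) ⟨
      2 * (r * (c * w)) ∎
      where open ≤-Reasoning

    fresh-small : 8 * q * M ≤ r * K
    fresh-small = ≤-trans (*-monoʳ-≤ (8 * q) M≤) (≤-reflexive (l q γ r))
      where
      open ≤-Reasoning
      l : ∀ q γ r → 8 * q * (γ * r) ≡ r * (8 * γ * q)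
      l = solve-∀
      l₂ : ∀ κ r c w → κ * (2 * (r * (c * w))) ≡ 2 * κ * c * r * w
      l₂ = solve-∀
      M≤ : M ≤ γ * r
      M≤ = *-cancelʳ-≤ M (γ * r) w (begin
        M * w ≤⟨ m/n*n≤m (κ * (m * h)) w ⟩
        κ * (m * h) ≤⟨ *-monoʳ-≤ κ mh≤ ⟩
        κ * (2 * (r * (c * w))) ≡⟨ l₂ κ r c w ⟩
        γ * r * w ∎)

    load-small : suc h * m < r * suc Λ
    load-small = begin-strict
      suc h * m ≤⟨ *-monoˡ-≤ m (+-monoˡ-≤ h 0<h) ⟩
      (h + h) * m ≡⟨ l h m ⟩
      2 * (m * h) ≤⟨ *-monoʳ-≤ 2 mh≤ ⟩
      2 * (2 * (r * (c * w))) ≡⟨ l₂ r c w ⟩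
      r * (4 * c * w) <⟨ *-monoʳ-< r {{>-nonZero 0<r}} (s≤s (m≤m+n (4 * c * w) (suc h))) ⟩
      r * suc Λ ∎
      where
      open ≤-Reasoning
      l : ∀ h m → (h + h) * m ≡ 2 * (m * h)
      l = solve-∀
      l₂ : ∀ r c w → 2 * (2 * (r * (c * w))) ≡ r * (4 * c * w)
      l₂ = solve-∀

    weight-small : ∀ t → suc K * (2 ^ b′ t * 2 ^ b′ t * Λ) ≤ 2 ^ b t
    weight-small t = begin
      suc K * (2 ^ B * 2 ^ B * Λ) ≡⟨ l (suc K) (2 ^ B) Λ ⟩
      suc K * Λ * (2 ^ B * 2 ^ B) ≤⟨ *-monoˡ-≤ (2 ^ B * 2 ^ B) (≤-trans exponent (^-monoʳ-≤ 2 (*-monoʳ-≤ 2 (g≤b′ t)))) ⟩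
      2 ^ (2 * B) * (2 ^ B * 2 ^ B) ≡⟨ cong (2 ^ (2 * B) *_) (^-distribˡ-+-* 2 B B) ⟨
      2 ^ (2 * B) * 2 ^ (B + B) ≡⟨ ^-distribˡ-+-* 2 (2 * B) (B + B) ⟨
      2 ^ (2 * B + (B + B)) ≡⟨ cong (2 ^_) (l₂ B) ⟩
      2 ^ b t ∎
      where
      open ≤-Reasoning
      B = b′ t
      l : ∀ a x c → a * (x * x * c) ≡ a * c * (x * x)
      l = solve-∀
      l₂ : ∀ B → 2 * B + (B + B) ≡ 4 * B
      l₂ = solve-∀

    -- `X` is the mean number of collisions that a round can afford. `E` is one less, as the mean
    -- bound is `suc (E t)`; this makes `loss-small` an equality.
    X E : ℕ → ℕ
    X d = m * γ * K ^ d
    E t = X (Q ∸ t) ∸ 1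

    0<X : ∀ d → 0 < X d
    0<X d = *-mono-≤ {1} {m * γ} (*-mono-≤ (m^n>0 2 (h + e)) 0<γ) (m^n>0 K {{>-nonZero 0<K}} d)

    E≡ : ∀ d t → d + t ≡ Q → suc (E t) ≡ X d
    E≡ d t eq = trans (m+[n∸m]≡n (0<X (Q ∸ t))) (cong X (trans (cong (_∸ t) (sym eq)) (m+n∸n≡m d t)))

    loss-small : ∀ d t → d + t ≡ Q → 8 * suc Q * suc (E t) ≤ m * K ^ suc d
    loss-small d t eq = ≤-reflexive (trans (cong (8 * q *_) (E≡ d t eq)) (l q m γ (K ^ d)))
      where
      l : ∀ q m γ k → 8 * q * (m * γ * k) ≡ m * (8 * γ * q * k)
      l = solve-∀

    budget : ∀ d t → d + t ≡ Q → w * (r + r) * t + K ^ suc d * m ≤ b′ t * E t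
    budget d t eq = *-cancelˡ-≤ 2 (begin
      2 * (w * (r + r) * t + K ^ suc d * m) ≤⟨ *-monoʳ-≤ 2 (+-monoˡ-≤ (K ^ suc d * m) (*-monoʳ-≤ (w * (r + r)) t≤Q)) ⟩
      2 * (w * (r + r) * Q + K ^ suc d * m) ≤⟨ halves ⟩
      B * X d ≤⟨ *-monoʳ-≤ B X≤2E ⟩
      B * (2 * E t) ≡⟨ l₁ B (E t) ⟩
      2 * (B * E t) ∎)
      where
      open ≤-Reasoning
      B = b′ t
      t≤Q : t ≤ Q
      t≤Q = ≤-trans (m≤n+m t d) (≤-reflexive eq)
      l₁ : ∀ b e → b * (2 * e) ≡ 2 * (b * e)
      l₁ = solve-∀
      2≤X : 2 ≤ X d
      2≤X = ≤-trans (*-mono-≤ {2} {m * (2 * κ)} (*-mono-≤ {1} {m} (m^n>0 2 (h + e)) (*-monoʳ-≤ 2 0<κ))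
          (*-mono-≤ 0<c (m^n>0 K {{>-nonZero 0<K}} d))) (≤-reflexive (l m κ c (K ^ d)))
        where
        l : ∀ m κ c k → m * (2 * κ) * (c * k) ≡ m * (2 * κ * c) * k
        l = solve-∀
      X≤2E : X d ≤ 2 * E t
      X≤2E = ≤-trans (≤-reflexive (sym (E≡ d t eq))) (≤-trans
        (+-monoˡ-≤ (E t) (s≤s⁻¹ (≤-trans 2≤X (≤-reflexive (sym (E≡ d t eq))))))
        (≤-reflexive (cong (E t +_) (sym (+-identityʳ (E t))))))
      -- The bits of one greedy choice are at most a share `1/c` of `m * h`, and `h` is at most
      -- `4 * u * u * K ^ suc d * b′ t`. Together with the factors `q` and `Q` this makes `c` of the
      -- order of the fourth power of `u`.
      publishing : 8 * (w * r * Q) ≤ B * X d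
      publishing = *-cancelˡ-≤ (32 * (q * (u * u))) (begin
        32 * (q * (u * u)) * (8 * (w * r * Q)) ≡⟨ l q u w r Q ⟩
        256 * (q * (u * u) * Q) * (w * r) ≤⟨ *-monoˡ-≤ (w * r) c-large ⟩
        c * (w * r) ≡⟨ l₂ c w r ⟩
        r * (c * w) ≤⟨ rcw≤mh ⟩
        m * h ≤⟨ *-monoʳ-≤ m (≤-trans (h≤W d t eq) (*-monoʳ-≤ u (*-monoʳ-≤ (K ^ suc d) (W≤b′ t)))) ⟩
        m * (u * (K ^ suc d * (4 * u * B))) ≡⟨ l₃ m u γ q (K ^ d) B ⟩
        32 * (q * (u * u)) * (B * X d) ∎)
        where
        l : ∀ q u w r Q → 32 * (q * (u * u)) * (8 * (w * r * Q)) ≡ 256 * (q * (u * u) * Q) * (w * r)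
        l = solve-∀
        l₂ : ∀ c w r → c * (w * r) ≡ r * (c * w)
        l₂ = solve-∀
        l₃ : ∀ m u γ q k B → m * (u * (8 * γ * q * k * (4 * u * B))) ≡ 32 * (q * (u * u)) * (B * (m * γ * k))
        l₃ = solve-∀
      union : 4 * (K ^ suc d * m) ≤ B * X d
      union = ≤-trans (≤-reflexive (l γ q (K ^ d) m)) (*-monoˡ-≤ (X d) (32q≤b′ t))
        where
        l : ∀ γ q k m → 4 * (8 * γ * q * k * m) ≡ 32 * q * (m * γ * k)
        l = solve-∀
      halves : 2 * (w * (r + r) * Q + K ^ suc d * m) ≤ B * X d
      halves = *-cancelˡ-≤ 2 (≤-trans (≤-reflexive (l w r Q (K ^ suc d * m)))
        (≤-trans (+-mono-≤ publishing union) (≤-reflexive (cong (B * X d +_) (sym (+-identityʳ (B * X d)))))))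
        where
        l : ∀ w r Q k → 2 * (2 * (w * (r + r) * Q + k)) ≡ 8 * (w * r * Q) + 4 * k
        l = solve-∀

    open Text e h using (text; number; number-injective; rank; SA-answers)

    impossible : (D : CellProbeStructure w (List Bool) ℕ ℕ) →
      (∀ n → AnswersSA D (text n) Q) →
      (∀ n → length (preprocess D (text n)) * w ≤ κ * (m * h)) → ⊥
    impossible D answers space = Core.contradictory b b′ E K Q w e r M Λ
      (λ i y → query D (suc (rank i y))) (λ n → preprocess D (text n)) (λ i x → suc (number i x))
      short (λ i x x′ _ → number-injective i x x′) (λ n i x → SA-answers D Q n (answers n) i x)
      0<r 0<K 0<b′ fresh-small load-small (m≤n+m (suc h) (4 * c * w)) weight-small loss-small budget
      where
      short : ∀ n → length (preprocess D (text n)) ≤ M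
      short n = ≤-trans (≤-reflexive (sym (m*n/n≡m _ w))) (/-monoˡ-≤ w (space n))

-- Fitting the hard strings into length N

log₂-floor : ∀ n → 0 < n → ∃[ l ] 2 ^ l ≤ n × n < 2 ^ suc l
log₂-floor (suc zero)    _ = 0 , ≤-refl , ≤-refl
log₂-floor (suc (suc n)) _ with log₂-floor (suc n) (s≤s z≤n)
... | l , p , q with suc (suc n) <? 2 ^ suc l
...   | yes r = l , m≤n⇒m≤1+n p , r
...   | no ¬r = suc l , ≮⇒≥ ¬r , ≤-trans (s≤s q)
  (≤-trans (+-monoˡ-≤ (2 ^ suc l) (m^n>0 2 (suc l))) (≤-reflexive (cong (2 ^ suc l +_) (sym (+-identityʳ (2 ^ suc l))))))

cube≤2^ : ∀ n → 10 ≤ n → n * (n * n) ≤ 2 ^ n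
cube≤2^ n 10≤n = subst (λ n → n * (n * n) ≤ 2 ^ n) (m+[n∸m]≡n 10≤n) (go (n ∸ 10))
  where
  go : ∀ k → (10 + k) * ((10 + k) * (10 + k)) ≤ 2 ^ (10 + k)
  go zero    = ≤ᵇ⇒≤ 1000 1024 tt
  go (suc k) = begin
    (11 + k) * ((11 + k) * (11 + k)) ≤⟨ m≤m+n _ (k * (k * k) + 27 * (k * k) + 237 * k + 669) ⟩
    (11 + k) * ((11 + k) * (11 + k)) + (k * (k * k) + 27 * (k * k) + 237 * k + 669)
      ≡⟨ l k ⟩
    2 * ((10 + k) * ((10 + k) * (10 + k))) ≤⟨ *-monoʳ-≤ 2 (go k) ⟩
    2 * 2 ^ (10 + k) ∎
    where
    open ≤-Reasoning
    l : ∀ k → (11 + k) * ((11 + k) * (11 + k)) + (k * (k * k) + 27 * (k * k) + 237 * k + 669) ≡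
        2 * ((10 + k) * ((10 + k) * (10 + k)))
    l = solve-∀

2^-cancel-≤ : ∀ m n → 2 ^ m < 2 ^ suc n → m ≤ n
2^-cancel-≤ m n p = ≮⇒≥ λ n<m → <⇒≱ p (^-monoʳ-≤ 2 n<m)

0<* : ∀ m n → 0 < m → 0 < n → 0 < m * n
0<* m n = *-mono-≤ {1} {m} {1} {n}

-- Abstract, since unfolding the numeral is expensive.
abstract
  leastLog : ℕ
  leastLog = 8 * 2 * 128 * 256

  leastLog-≤ : ∀ {n} → leastLog ≤ n → 8 * 2 * 128 * 256 ≤ n
  leastLog-≤ p = p

-- `ℓ` and `l` are the integer parts of log N and log log N. `J` stands for the integer part of a
-- rational above (S/N) log log N, so that `suc J * N` bounds the bits of the memory.
module Choice (N ℓ l J Q w C : ℕ) (0<Q : 0 < Q) (0<w : 0 < w)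
  (2^ℓ≤N : 2 ^ ℓ ≤ N) (N<2^ : N < 2 ^ suc ℓ) (2^l≤ℓ : 2 ^ l ≤ ℓ) (ℓ<2^ : ℓ < 2 ^ suc l)
  (w≤ : w ≤ C * ℓ) (J^≤ℓ : J ^ (56 * Q) ≤ ℓ) (l≤J² : l ≤ J * J) (2≤J : 2 ≤ J)
  (leastLog≤l : leastLog ≤ l) (C-small : 8 * C + 4 ≤ l) where

  u c κ : ℕ
  u = 2 + Q
  c = 256 * (u * u * (u * u))
  -- By `N<m`, `N` is at most `128 * (m * h)`.
  κ = 128 * suc J

  instance
    J≢0 : NonZero J
    J≢0 = >-nonZero (≤-trans (s≤s z≤n) 2≤J)

  l-large : 8 * 2 * 128 * 256 ≤ l
  l-large = leastLog-≤ leastLog≤l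

  10≤l : 10 ≤ l
  10≤l = ≤-trans (≤ᵇ⇒≤ 10 (8 * 2 * 128 * 256) tt) l-large

  l≤ℓ : l ≤ ℓ
  l≤ℓ = ≤-trans (<⇒≤ (n<2^n l)) 2^l≤ℓ

  0<ℓ : 0 < ℓ
  0<ℓ = ≤-trans (≤-trans (s≤s z≤n) 10≤l) l≤ℓ

  Q≤l : 56 * Q ≤ l
  Q≤l = 2^-cancel-≤ (56 * Q) l (≤-<-trans (^-monoˡ-≤ (56 * Q) 2≤J) (≤-<-trans J^≤ℓ ℓ<2^))

  u≤l : u ≤ l
  u≤l = ≤-trans (+-monoˡ-≤ Q (≤-trans (*-monoʳ-≤ 2 0<Q) (*-monoˡ-≤ Q (≤ᵇ⇒≤ 2 55 tt))))
    (≤-trans (≤-reflexive (+-comm (55 * Q) Q)) Q≤l)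

  1+J≤J² : suc J ≤ J * J
  1+J≤J² = ≤-trans (+-monoˡ-≤ J (≤-trans (s≤s z≤n) 2≤J))
    (≤-trans (≤-reflexive (cong (J +_) (sym (+-identityʳ J)))) (*-monoˡ-≤ J 2≤J))

  0<κ : 0 < κ
  0<κ = 0<* 128 (suc J) (s≤s z≤n) (s≤s z≤n)

  0<c : 0 < c
  0<c = 0<* 256 (u * u * (u * u)) (s≤s z≤n) (s≤s z≤n)

  R₀ : ℕ
  R₀ = 8 * (2 * κ * c) * u

  R≤ : R₀ ≤ J ^ 14
  R≤ = begin
    8 * (2 * (128 * suc J) * (256 * (u * u * (u * u)))) * u ≡⟨ l₁ 8 2 128 256 (suc J) u ⟩
    8 * 2 * 128 * 256 * (suc J * (u * (u * (u * (u * u)))))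
      ≤⟨ *-mono-≤ (≤-trans l-large l≤J²) (*-mono-≤ 1+J≤J² (*-mono-≤ u≤ (*-mono-≤ u≤ (*-mono-≤ u≤ (*-mono-≤ u≤ u≤))))) ⟩
    J * J * (J * J * (J * J * (J * J * (J * J * (J * J * (J * J))))))
      ≡⟨ l₂ J ⟩
    J ^ 14 ∎
    where
    open ≤-Reasoning
    u≤ : u ≤ J * J
    u≤ = ≤-trans u≤l l≤J²
    l₁ : ∀ a b c d j u → a * (b * (c * j) * (d * (u * u * (u * u)))) * u ≡ a * b * c * d * (j * (u * (u * (u * (u * u)))))
    l₁ = solve-∀
    l₂ : ∀ J → J * J * (J * J * (J * J * (J * J * (J * J * (J * J * (J * J)))))) ≡
         J * (J * (J * (J * (J * (J * (J * (J * (J * (J * (J * (J * (J * (J * 1)))))))))))))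
    l₂ = solve-∀

  P : ℕ
  P = R₀ ^ suc Q

  0<R : 0 < R₀
  0<R = 0<* (8 * (2 * κ * c)) u (0<* 8 (2 * κ * c) (s≤s z≤n) (0<* (2 * κ) c (0<* 2 κ (s≤s z≤n) 0<κ) 0<c)) (s≤s z≤n)

  0<P : 0 < P
  0<P = m^n>0 R₀ {{>-nonZero 0<R}} (suc Q)

  P²≤ℓ : P * P ≤ ℓ
  P²≤ℓ = begin
    P * P ≡⟨ pow-* R₀ R₀ (suc Q) ⟨
    (R₀ * R₀) ^ suc Q ≤⟨ ^-monoˡ-≤ (suc Q) (*-mono-≤ R≤ R≤) ⟩
    (J ^ 14 * J ^ 14) ^ suc Q ≡⟨ cong (_^ suc Q) (^-distribˡ-+-* J 14 14) ⟨
    (J ^ 28) ^ suc Q ≡⟨ ^-*-assoc J 28 (suc Q) ⟩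
    J ^ (28 * suc Q) ≤⟨ ^-monoʳ-≤ J (≤-trans (*-monoʳ-≤ 28 {suc Q} {2 * Q} (≤-trans (+-monoˡ-≤ Q 0<Q)
                                          (≤-reflexive (cong (Q +_) (sym (+-identityʳ Q)))))) (≤-reflexive (sym (*-assoc 28 2 Q)))) ⟩
    J ^ (56 * Q) ≤⟨ J^≤ℓ ⟩
    ℓ ∎
    where open ≤-Reasoning

  R≤ℓ : R₀ ≤ ℓ
  R≤ℓ = ≤-trans (≤-trans (≤-trans (≤-reflexive (sym (*-identityʳ R₀))) (^-monoʳ-≤ R₀ {{>-nonZero 0<R}} {1} {suc Q} (s≤s z≤n)))
    (m≤m*n P P {{>-nonZero 0<P}})) P²≤ℓ

  instance
    4P≢0 : NonZero (4 * P)
    4P≢0 = >-nonZero (0<* 4 P (s≤s z≤n) 0<P)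

  L g : ℕ
  -- A block has at most `16 * 2 ^ l` characters, so `2 ^ L` blocks fit into `2 ^ ℓ`. The choice of
  -- `g` then lets at least half of the `L` coordinates be layers of the network.
  L = ℓ ∸ (l + 4)
  g = L / (4 * P)

  l³≤ℓ : l * (l * l) ≤ ℓ
  l³≤ℓ = ≤-trans (cube≤2^ l 10≤l) 2^l≤ℓ

  4l≤ℓ : 4 * l ≤ ℓ
  4l≤ℓ = ≤-trans (≤-trans (≤-reflexive (*-comm 4 l)) (*-monoʳ-≤ l (≤-trans (≤-trans (≤ᵇ⇒≤ 4 10 tt) 10≤l)
    (m≤m*n l l {{>-nonZero (≤-trans (s≤s z≤n) 10≤l)}})))) l³≤ℓ

  ℓ≡ : L + (l + 4) ≡ ℓ
  ℓ≡ = m∸n+n≡m (≤-trans (+-monoʳ-≤ l (≤-trans (≤ᵇ⇒≤ 4 10 tt) 10≤l))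
    (≤-trans (≤-trans (≤-reflexive (cong (l +_) (sym (+-identityʳ l)))) (*-monoˡ-≤ l {2} {4} (s≤s (s≤s z≤n)))) 4l≤ℓ))

  ℓ≤2L : ℓ ≤ 2 * L
  ℓ≤2L = +-cancelʳ-≤ (2 * (l + 4)) ℓ (2 * L) (begin
    ℓ + 2 * (l + 4) ≤⟨ +-monoʳ-≤ ℓ (≤-trans (*-monoʳ-≤ 2 (+-monoʳ-≤ l (≤-trans (≤ᵇ⇒≤ 4 10 tt) 10≤l)))
                                          (≤-trans (≤-reflexive (l₁ l)) 4l≤ℓ)) ⟩
    ℓ + ℓ ≡⟨ cong₂ _+_ ℓ≡ ℓ≡ ⟨
    L + (l + 4) + (L + (l + 4)) ≡⟨ l₂ L (l + 4) ⟩
    2 * L + 2 * (l + 4) ∎)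
    where
    open ≤-Reasoning
    l₁ : ∀ l → 2 * (l + l) ≡ 4 * l
    l₁ = solve-∀
    l₂ : ∀ a b → a + b + (a + b) ≡ 2 * a + 2 * b
    l₂ = solve-∀

  L<4P : L < 4 * P * suc g
  L<4P = ≤-trans (≤-reflexive (cong suc (m≡m%n+[m/n]*n L (4 * P))))
    (≤-trans (+-monoˡ-≤ (g * (4 * P)) (m%n<n L (4 * P))) (≤-reflexive (trans (*-comm (suc g) (4 * P)) refl)))

  -- `g` is of order `ℓ / P`. Keeping the square of `P` below `ℓ`, and not only `P`, makes this at
  -- least of the order of the square root of `ℓ`, which exceeds any multiple of `l` needed later.
  ℓ<64 : ℓ < 64 * (suc g * suc g)
  ℓ<64 = *-cancelˡ-< ℓ ℓ _ (begin-strict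
    ℓ * ℓ <⟨ *-mono-< ℓ<8P ℓ<8P ⟩
    8 * P * suc g * (8 * P * suc g) ≡⟨ l₁ P (suc g) ⟩
    P * P * (64 * (suc g * suc g)) ≤⟨ *-monoˡ-≤ _ P²≤ℓ ⟩
    ℓ * (64 * (suc g * suc g)) ∎)
    where
    open ≤-Reasoning
    l₁ : ∀ p g → 8 * p * g * (8 * p * g) ≡ p * p * (64 * (g * g))
    l₁ = solve-∀
    l₂ : ∀ p g → 2 * (4 * p * g) ≡ 8 * p * g
    l₂ = solve-∀
    ℓ<8P : ℓ < 8 * P * suc g
    ℓ<8P = ≤-<-trans ℓ≤2L (<-≤-trans (*-monoʳ-< 2 L<4P) (≤-reflexive (l₂ P (suc g))))

  32l≤g : 32 * l ≤ g
  32l≤g = ≮⇒≥ λ g<32l → <⇒≱ ℓ<64 (begin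
    64 * (suc g * suc g) ≤⟨ *-monoʳ-≤ 64 {suc g * suc g} {32 * l * (32 * l)} (*-mono-≤ {suc g} {32 * l} g<32l g<32l) ⟩
    64 * (32 * l * (32 * l)) ≡⟨ l₁ 64 32 l ⟩
    64 * 32 * 32 * (l * l) ≤⟨ *-monoˡ-≤ (l * l) (≤-trans (≤ᵇ⇒≤ (64 * 32 * 32) (8 * 2 * 128 * 256) tt) l-large) ⟩
    l * (l * l) ≤⟨ l³≤ℓ ⟩
    ℓ ∎)
    where
    open ≤-Reasoning
    l₁ : ∀ a b l → a * (b * l * (b * l)) ≡ a * b * b * (l * l)
    l₁ = solve-∀

  module S = Parameters Q κ g c
  open S using (h; q; K)

  h≡ : h ≡ P * (4 * g)
  h≡ = S.W≡ (suc Q)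

  h≤L : h ≤ L
  h≤L = ≤-trans (≤-reflexive (trans h≡ (l₁ P g))) (m/n*n≤m L (4 * P))
    where
    l₁ : ∀ p g → p * (4 * g) ≡ g * (4 * p)
    l₁ = solve-∀

  L≤2h : L ≤ 2 * h
  L≤2h = ≤-trans (<⇒≤ L<4P) (≤-trans (*-monoʳ-≤ (4 * P) (+-monoˡ-≤ g 1≤g)) (≤-reflexive (trans (l₁ P g) (cong (2 *_) (sym h≡)))))
    where
    1≤g : 1 ≤ g
    1≤g = ≤-trans (≤-trans (≤-trans (s≤s z≤n) 10≤l) (m≤n*m l 32)) 32l≤g
    l₁ : ∀ p g → 4 * p * (g + g) ≡ 2 * (p * (4 * g))
    l₁ = solve-∀

  e m : ℕ
  e = L ∸ h
  m = 2 ^ (h + e)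

  h+e≡L : h + e ≡ L
  h+e≡L = m+[n∸m]≡n h≤L

  L≤ℓ : L ≤ ℓ
  L≤ℓ = m∸n≤m ℓ (l + 4)

  N<m : N ≤ 128 * (m * h)
  N<m = begin
    N ≤⟨ <⇒≤ N<2^ ⟩
    2 * 2 ^ ℓ ≡⟨ cong (λ z → 2 * 2 ^ z) ℓ≡ ⟨
    2 * 2 ^ (L + (l + 4)) ≡⟨ cong (2 *_) (trans (^-distribˡ-+-* 2 L (l + 4)) (cong (2 ^ L *_) (^-distribˡ-+-* 2 l 4))) ⟩
    2 * (2 ^ L * (2 ^ l * 16)) ≤⟨ *-monoʳ-≤ 2 (*-monoʳ-≤ (2 ^ L) (*-monoˡ-≤ 16
                                          (≤-trans 2^l≤ℓ (≤-trans ℓ≤2L (*-monoʳ-≤ 2 L≤2h))))) ⟩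
    2 * (2 ^ L * (2 * (2 * h) * 16)) ≡⟨ l₁ (2 ^ L) h ⟩
    128 * (2 ^ L * h) ≡⟨ cong (λ z → 128 * (2 ^ z * h)) h+e≡L ⟨
    128 * (m * h) ∎
    where
    open ≤-Reasoning
    l₁ : ∀ m h → 2 * (m * (2 * (2 * h) * 16)) ≡ 128 * (m * h)
    l₁ = solve-∀

  open Text e h using (text; length-text; blockLength)

  text≤N : ∀ n → length (text n) ≤ N
  text≤N n = begin
    length (text n) ≡⟨ length-text n ⟩
    m * (2 * h + (3 + (2 * (h + e) + 4))) ≤⟨ *-monoʳ-≤ m short ⟩
    m * (2 ^ l * 16) ≡⟨ cong (λ z → 2 ^ z * (2 ^ l * 16)) h+e≡L ⟩
    2 ^ L * (2 ^ l * 16) ≡⟨ trans (^-distribˡ-+-* 2 L (l + 4)) (cong (2 ^ L *_) (^-distribˡ-+-* 2 l 4)) ⟨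
    2 ^ (L + (l + 4)) ≡⟨ cong (2 ^_) ℓ≡ ⟩
    2 ^ ℓ ≤⟨ 2^ℓ≤N ⟩
    N ∎
    where
    open ≤-Reasoning
    short : 2 * h + (3 + (2 * (h + e) + 4)) ≤ 2 ^ l * 16
    short = begin
      2 * h + (3 + (2 * (h + e) + 4)) ≤⟨ +-mono-≤ (*-monoʳ-≤ 2 (≤-trans h≤L L≤ℓ))
                                                      (+-monoʳ-≤ 3 (+-monoˡ-≤ 4 (*-monoʳ-≤ 2 (≤-trans (≤-reflexive h+e≡L) L≤ℓ)))) ⟩
      2 * ℓ + (3 + (2 * ℓ + 4)) ≤⟨ m≤m+n _ 1 ⟩
      2 * ℓ + (3 + (2 * ℓ + 4)) + 1 ≡⟨ l₁ ℓ ⟩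
      4 * suc ℓ + 4 ≤⟨ +-mono-≤ (*-monoʳ-≤ 4 ℓ<2^) (*-monoʳ-≤ 4 (m^n>0 2 l)) ⟩
      4 * (2 * 2 ^ l) + 4 * 2 ^ l ≤⟨ m≤m+n _ (4 * 2 ^ l) ⟩
      4 * (2 * 2 ^ l) + 4 * 2 ^ l + 4 * 2 ^ l ≡⟨ l₂ (2 ^ l) ⟩
      2 ^ l * 16 ∎
      where
      l₁ : ∀ x → 2 * x + (3 + (2 * x + 4)) + 1 ≡ 4 * (1 + x) + 4
      l₁ = solve-∀
      l₂ : ∀ x → 4 * (2 * x) + 4 * x + 4 * x ≡ x * 16
      l₂ = solve-∀

  2≤text : ∀ n → 2 ≤ length (text n)
  2≤text n = ≤-trans (≤-trans (≤-trans (s≤s (s≤s z≤n)) (m≤n+m (3 + (2 * (h + e) + 4)) (2 * h)))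
    (m≤n*m blockLength m {{m^n≢0 2 (h + e)}})) (≤-reflexive (sym (length-text n)))

  c-large : 256 * (q * (u * u) * Q) ≤ c
  c-large = *-monoʳ-≤ 256 (≤-trans (*-mono-≤ (*-monoˡ-≤ (u * u) (n≤1+n q)) (m≤n+m Q 2)) (≤-reflexive (l₁ u)))
    where
    l₁ : ∀ u → u * (u * u) * u ≡ u * u * (u * u)
    l₁ = solve-∀

  g-large : 32 * q ≤ g
  g-large = ≤-trans (*-monoʳ-≤ 32 (≤-trans (n≤1+n q) u≤l)) 32l≤g

  -- The left side is polynomial in `ℓ`, at most `2 ^ (suc l * 4)`, whereas `g` is at least
  -- `32 * l`.
  exponent : suc K * (4 * c * w + suc h) ≤ 2 ^ (2 * g)
  exponent = begin
    suc K * (4 * c * w + suc h)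
      ≤⟨ *-mono-≤ (s≤s K≤ℓ) (+-mono-≤ (*-mono-≤ (*-monoʳ-≤ 4 c≤ℓ) w≤) (s≤s (≤-trans h≤L L≤ℓ))) ⟩
    suc ℓ * (4 * ℓ * (C * ℓ) + suc ℓ)
      ≤⟨ *-mono-≤ (+-monoˡ-≤ ℓ 0<ℓ) (+-monoʳ-≤ (4 * ℓ * (C * ℓ)) (≤-trans (+-monoˡ-≤ ℓ 0<ℓ)
           (≤-trans (≤-reflexive (l₁ ℓ)) (*-monoʳ-≤ 2 (m≤m*n ℓ ℓ {{>-nonZero 0<ℓ}}))))) ⟩
    (ℓ + ℓ) * (4 * ℓ * (C * ℓ) + 2 * (ℓ * ℓ))
      ≡⟨ l₂ ℓ C ⟩
    (8 * C + 4) * (ℓ * (ℓ * ℓ))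
      ≤⟨ *-monoˡ-≤ (ℓ * (ℓ * ℓ)) (≤-trans C-small l≤ℓ) ⟩
    ℓ * (ℓ * (ℓ * ℓ))
      ≡⟨ l₃ ℓ ⟩
    ℓ ^ 4
      ≤⟨ ^-monoˡ-≤ 4 (<⇒≤ ℓ<2^) ⟩
    (2 ^ suc l) ^ 4
      ≡⟨ ^-*-assoc 2 (suc l) 4 ⟩
    2 ^ (suc l * 4)
      ≤⟨ ^-monoʳ-≤ 2 (begin
           suc l * 4 ≤⟨ *-monoˡ-≤ 4 (+-monoˡ-≤ l (≤-trans (s≤s z≤n) 10≤l)) ⟩
           (l + l) * 4 ≤⟨ m≤m+n _ (56 * l) ⟩
           (l + l) * 4 + 56 * l ≡⟨ l₄ l ⟩
           2 * (32 * l) ≤⟨ *-monoʳ-≤ 2 32l≤g ⟩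
           2 * g ∎) ⟩
    2 ^ (2 * g) ∎
    where
    open ≤-Reasoning
    l₁ : ∀ x → x + x ≡ 2 * x
    l₁ = solve-∀
    l₂ : ∀ x C → (x + x) * (4 * x * (C * x) + 2 * (x * x)) ≡ (8 * C + 4) * (x * (x * x))
    l₂ = solve-∀
    l₃ : ∀ x → x * (x * (x * x)) ≡ x * (x * (x * (x * 1)))
    l₃ = solve-∀
    l₄ : ∀ x → (x + x) * 4 + 56 * x ≡ 2 * (32 * x)
    l₄ = solve-∀
    K≤ℓ : K ≤ ℓ
    K≤ℓ = ≤-trans (*-monoʳ-≤ (8 * (2 * κ * c)) (n≤1+n q)) R≤ℓ
    c≤ℓ : c ≤ ℓ
    c≤ℓ = ≤-trans (≤-trans (m≤n*m c (8 * (2 * κ) * u)) (≤-reflexive (l₅ κ c u))) R≤ℓ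
      where
      l₅ : ∀ k c u → 8 * (2 * k) * u * c ≡ 8 * (2 * k * c) * u
      l₅ = solve-∀

  refute : (D : CellProbeStructure w (List Bool) ℕ ℕ) →
    (∀ T → 2 ≤ length T → length T ≤ N → AnswersSA D T Q × length (preprocess D T) * w ≤ suc J * N) → ⊥
  refute D spec = S.Bound.impossible w e 0<w 0<κ 0<c
    c-large g-large exponent D (λ n → proj₁ (spec (text n) (2≤text n) (text≤N n)))
    (λ n → ≤-trans (proj₂ (spec (text n) (2≤text n) (text≤N n)))
      (≤-trans (*-monoʳ-≤ (suc J) N<m) (≤-reflexive (l₁ (suc J) (m * h)))))
    where
    l₁ : ∀ j x → j * (128 * x) ≡ 128 * j * x
    l₁ = solve-∀

-- Rational numbers and cuts

open import Data.Integer.Base as ℤ using (ℤ; +_; -[1+_])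
import Data.Integer.Properties as ℤ
open import Data.Rational.Base as ℚ using (ℚ; mkℚ; 0ℚ; 1ℚ; *<*; *≤*; positive; nonNegative)
import Data.Rational.Properties as ℚ
import Data.Rational.Unnormalised.Base as ℚᵘ
import Data.Rational.Unnormalised.Properties as ℚᵘ

open Algebra.Definitions.RawSemiring ℚ.+-*-rawSemiring using () renaming (_^_ to _^ᵠ_)
open Algebra.Properties.Semiring.Exp (CommutativeRing.semiring ℚ.+-*-commutativeRing) using (^-assocʳ)

ι : ℕ → ℚ
ι n = + n ℚ./ 1

coprime-1 : ∀ n → Coprime n 1
coprime-1 n = coprime-sym (1-coprimeTo n)

ι≡ : ∀ n → ι n ≡ mkℚ (+ n) 0 (coprime-1 n)
ι≡ n = ℚ.normalize-coprime (coprime-1 n)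

ι-< : ∀ {m n} → m < n → ι m ℚ.< ι n
ι-< {m} {n} p rewrite ι≡ m | ι≡ n = *<* (subst₂ ℤ._<_ (sym (ℤ.*-identityʳ (+ m))) (sym (ℤ.*-identityʳ (+ n))) (ℤ.+<+ p))

ι-≤ : ∀ {m n} → m ≤ n → ι m ℚ.≤ ι n
ι-≤ {m} {n} p rewrite ι≡ m | ι≡ n = *≤* (subst₂ ℤ._≤_ (sym (ℤ.*-identityʳ (+ m))) (sym (ℤ.*-identityʳ (+ n))) (ℤ.+≤+ p))

ι-cancel-< : ∀ {m n} → ι m ℚ.< ι n → m < n
ι-cancel-< {m} {n} p = ≰⇒> λ n≤m → ℚ.<-irrefl refl (ℚ.<-≤-trans p (ι-≤ n≤m))

ι-* : ∀ m n → ι (m * n) ≡ ι m ℚ.* ι n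
ι-* m n = sym (trans (cong₂ ℚ._*_ (ι≡ m) (ι≡ n)) (cong (ℚ._/ 1) (sym (ℤ.pos-* m n))))

ι-^ : ∀ m n → ι (m ^ n) ≡ ι m ^ᵠ n
ι-^ m zero    = refl
ι-^ m (suc n) = trans (ι-* m (m ^ n)) (cong (ι m ℚ.*_) (ι-^ m n))

2^-ι : ∀ n → 2^ (+ n) ≡ ι (2 ^ n)
2^-ι n = sym (ι-^ 2 n)

0≤ι : ∀ n → 0ℚ ℚ.≤ ι n
0≤ι n = ι-≤ {0} {n} z≤n

clear-denominator : ∀ p n → ℚ.↥ p ≡ + n → p ℚ.* ι (ℚ.↧ₙ p) ≡ ι n
clear-denominator p@(mkℚ _ d-1 _) n refl = ℚ.toℚᵘ-injective (ℚᵘ.≃-trans (ℚ.toℚᵘ-homo-* p (ι (suc d-1)))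
  (subst₂ (λ a b → ℚ.toℚᵘ p ℚᵘ.* ℚ.toℚᵘ a ℚᵘ.≃ ℚ.toℚᵘ b) (sym (ι≡ (suc d-1))) (sym (ι≡ n))
    (ℚᵘ.*≡* (trans (ℤ.*-identityʳ _) (cong ((+ n) ℤ.*_) (cong +_ (sym (*-identityʳ (suc d-1)))))))))

positive-numerator : ∀ p → 0ℚ ℚ.< p → ∃[ n ] ℚ.↥ p ≡ + suc n
positive-numerator p@(mkℚ (+ suc n) _ _)  q = n , refl
positive-numerator (mkℚ (+ zero) d c) (*<* (ℤ.+<+ ()))
positive-numerator (mkℚ -[1+ n ] d c) (*<* ())

*-monoʳ-<₊ : ∀ {r p q} → 0ℚ ℚ.< r → p ℚ.< q → r ℚ.* p ℚ.< r ℚ.* q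
*-monoʳ-<₊ {r} 0<r = ℚ.*-monoʳ-<-pos r {{positive 0<r}}

*-monoˡ-<₊ : ∀ {r p q} → 0ℚ ℚ.< r → p ℚ.< q → p ℚ.* r ℚ.< q ℚ.* r
*-monoˡ-<₊ {r} 0<r = ℚ.*-monoˡ-<-pos r {{positive 0<r}}

*-monoʳ-≤₀ : ∀ {r p q} → 0ℚ ℚ.≤ r → p ℚ.≤ q → r ℚ.* p ℚ.≤ r ℚ.* q
*-monoʳ-≤₀ {r} 0≤r = ℚ.*-monoˡ-≤-nonNeg r {{nonNegative 0≤r}}

*-monoˡ-≤₀ : ∀ {r p q} → 0ℚ ℚ.≤ r → p ℚ.≤ q → p ℚ.* r ℚ.≤ q ℚ.* r
*-monoˡ-≤₀ {r} 0≤r = ℚ.*-monoʳ-≤-nonNeg r {{nonNegative 0≤r}}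

*-positive : ∀ {p q} → 0ℚ ℚ.< p → 0ℚ ℚ.< q → 0ℚ ℚ.< p ℚ.* q
*-positive {p} {q} 0<p 0<q = subst (ℚ._< p ℚ.* q) (ℚ.*-zeroʳ p) (*-monoʳ-<₊ 0<p 0<q)

*-nonNegative : ∀ {p q} → 0ℚ ℚ.≤ p → 0ℚ ℚ.≤ q → 0ℚ ℚ.≤ p ℚ.* q
*-nonNegative {p} {q} 0≤p 0≤q = subst (ℚ._≤ p ℚ.* q) (ℚ.*-zeroʳ p) (*-monoʳ-≤₀ 0≤p 0≤q)

positive-right : ∀ {p q} → 0ℚ ℚ.< p → 0ℚ ℚ.< p ℚ.* q → 0ℚ ℚ.< q
positive-right {p} {q} 0<p 0<pq = ℚ.*-cancelˡ-<-nonNeg p {{nonNegative (ℚ.<⇒≤ 0<p)}}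
  (subst (ℚ._< p ℚ.* q) (sym (ℚ.*-zeroʳ p)) 0<pq)

positive-left : ∀ {p q} → 0ℚ ℚ.< q → 0ℚ ℚ.< p ℚ.* q → 0ℚ ℚ.< p
positive-left {p} {q} 0<q 0<pq = positive-right 0<q (subst (0ℚ ℚ.<_) (ℚ.*-comm p q) 0<pq)

^-nonNegative : ∀ {x} n → 0ℚ ℚ.≤ x → 0ℚ ℚ.≤ x ^ᵠ n
^-nonNegative zero    _   = 0≤ι 1
^-nonNegative (suc n) 0≤x = *-nonNegative 0≤x (^-nonNegative n 0≤x)

^-mono-≤ᵠ : ∀ {x y} n → 0ℚ ℚ.≤ x → x ℚ.≤ y → x ^ᵠ n ℚ.≤ y ^ᵠ n
^-mono-≤ᵠ zero    0≤x x≤y = ℚ.≤-refl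
^-mono-≤ᵠ (suc n) 0≤x x≤y = ℚ.≤-trans (*-monoʳ-≤₀ 0≤x (^-mono-≤ᵠ n 0≤x x≤y))
  (*-monoˡ-≤₀ (^-nonNegative n (ℚ.≤-trans 0≤x x≤y)) x≤y)

^-positive : ∀ {x} n → 0ℚ ℚ.< x → 0ℚ ℚ.< x ^ᵠ n
^-positive zero    _   = ι-< {0} {1} (s≤s z≤n)
^-positive (suc n) 0<x = *-positive 0<x (^-positive n 0<x)

^-mono-<ᵠ : ∀ {x y} n → 0ℚ ℚ.< x → x ℚ.< y → x ^ᵠ suc n ℚ.< y ^ᵠ suc n
^-mono-<ᵠ {x} {y} n 0<x x<y = ℚ.≤-<-trans (*-monoʳ-≤₀ (ℚ.<⇒≤ 0<x) (^-mono-≤ᵠ n (ℚ.<⇒≤ 0<x) (ℚ.<⇒≤ x<y)))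
  (*-monoˡ-<₊ (^-positive n (ℚ.<-trans 0<x x<y)) x<y)

^-cancel-≤ᵠ : ∀ {x y} n → 0ℚ ℚ.< y → x ^ᵠ suc n ℚ.≤ y ^ᵠ suc n → x ℚ.≤ y
^-cancel-≤ᵠ n 0<y p = ℚ.≮⇒≥ λ y<x → ℚ.<-irrefl refl (ℚ.<-≤-trans (^-mono-<ᵠ n 0<y y<x) p)

½^≤1 : ∀ n → ℚ.½ ^ᵠ n ℚ.≤ 1ℚ
½^≤1 zero    = ℚ.≤-refl
½^≤1 (suc n) = ℚ.≤-trans (*-monoʳ-≤₀ {ℚ.½} {ℚ.½ ^ᵠ n} {1ℚ} (*≤* (ℤ.+≤+ z≤n)) (½^≤1 n)) (*≤* (ℤ.+≤+ (s≤s z≤n)))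

floor : ∀ p → 0ℚ ℚ.< p → ∃[ k ] ι k ℚ.≤ p × p ℚ.< ι (suc k)
floor p@(mkℚ (+ n) d-1 c) _ = k , low , high
  where
  d = suc d-1
  k = n / d
  low : ι k ℚ.≤ p
  low rewrite ι≡ k = *≤* (subst₂ ℤ._≤_ (ℤ.pos-* k d) (sym (ℤ.*-identityʳ (+ n))) (ℤ.+≤+ (m/n*n≤m n d)))
  high : p ℚ.< ι (suc k)
  high rewrite ι≡ (suc k) = *<* (subst₂ ℤ._<_ (sym (ℤ.*-identityʳ (+ n))) (ℤ.pos-* (suc k) d)
    (ℤ.+<+ (≤-<-trans (≤-reflexive (m≡m%n+[m/n]*n n d)) (+-monoˡ-< (k * d) (m%n<n n d)))))
floor (mkℚ -[1+ n ] d-1 c) (*<* ())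

numerator-<ι : ∀ {p n k} → ℚ.↥ p ≡ + n → n < k * ℚ.↧ₙ p → p ℚ.< ι k
numerator-<ι {p@(mkℚ _ d-1 _)} {n} {k} refl q rewrite ι≡ k =
  *<* (subst₂ ℤ._<_ (sym (ℤ.*-identityʳ (+ n))) (ℤ.pos-* k (suc d-1)) (ℤ.+<+ q))

numerator->ι : ∀ {p n k} → ℚ.↥ p ≡ + n → k * ℚ.↧ₙ p < n → ι k ℚ.< p
numerator->ι {p@(mkℚ _ d-1 _)} {n} {k} refl q rewrite ι≡ k =
  *<* (subst₂ ℤ._<_ (ℤ.pos-* k (suc d-1)) (sym (ℤ.*-identityʳ (+ n))) (ℤ.+<+ q))

2^-cancel-< : ∀ {m n} → 2 ^ m < 2 ^ n → m < n
2^-cancel-< {m} {n} p = ≰⇒> λ n≤m → <⇒≱ p (^-monoʳ-≤ 2 n≤m)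

-- For a bound n/d the comparison is one of powers, `2 ^ n < r ^ d ≤ 2 ^ (L * d)`. Integer bounds on
-- the logarithms are all that the estimates need.
log₂-lower : ∀ x B L {ρ} → (∀ {r} → lower x r → r ℚ.< ι B) → B ≤ 2 ^ L → lower (log₂ x) ρ → ρ ℚ.< ι L
log₂-lower x B L {ρ@(mkℚ (+ n) d-1 _)} bound B≤ (r , r∈ , 0<r , p) = numerator-<ι {ρ} {n} {L} refl (2^-cancel-< {n} {L * suc d-1}
  (ι-cancel-< {2 ^ n} {2 ^ (L * suc d-1)} (ℚ.<-≤-trans (subst (ℚ._< r ^ᵠ suc d-1) (2^-ι n) p)
    (ℚ.≤-trans (^-mono-≤ᵠ (suc d-1) (ℚ.<⇒≤ 0<r) (ℚ.<⇒≤ (bound r∈)))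
      (subst (ℚ._≤ ι (2 ^ (L * suc d-1))) (ι-^ B (suc d-1)) (ι-≤ {B ^ suc d-1} {2 ^ (L * suc d-1)} (≤-trans
        (^-monoˡ-≤ (suc d-1) B≤)
        (≤-reflexive (^-*-assoc 2 L (suc d-1))))))))))
log₂-lower x B L {ρ@(mkℚ -[1+ n ] d-1 c)} bound B≤ _ = ℚ.<-≤-trans
  (*<* {ρ} {0ℚ} ℤ.-<+) (0≤ι L)

log₂-upper : ∀ x B L {ρ} → (∀ {r} → upper x r → ι B ℚ.< r) → 2 ^ L ≤ B → upper (log₂ x) ρ → ι L ℚ.< ρ
log₂-upper x B L {ρ} bound ≤B (r , r∈ , 0<r , p) = result ρ refl
  where
  above : ∀ d → ι (2 ^ (L * d)) ℚ.≤ r ^ᵠ d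
  above d = ℚ.≤-trans (subst (ι (2 ^ (L * d)) ℚ.≤_) (ι-^ B d)
    (ι-≤ {2 ^ (L * d)} {B ^ d} (≤-trans (≤-reflexive (sym (^-*-assoc 2 L d)))
    (^-monoˡ-≤ d ≤B)))) (^-mono-≤ᵠ d (0≤ι B) (ℚ.<⇒≤ (bound r∈)))
  result : ∀ σ → σ ≡ ρ → ι L ℚ.< ρ
  result (mkℚ (+ n) d-1 _) refl = numerator->ι {ρ} {n} {L} refl (2^-cancel-< {L * suc d-1} {n}
    (ι-cancel-< {2 ^ (L * suc d-1)} {2 ^ n} (ℚ.≤-<-trans (above (suc d-1)) (subst (r ^ᵠ suc d-1 ℚ.<_) (2^-ι n) p))))
  result (mkℚ -[1+ n ] d-1 _) refl = contradiction
    (ℚ.≤-<-trans (ℚ.≤-trans (ι-≤ {1} {2 ^ (L * suc d-1)} (m^n>0 2 (L * suc d-1))) (above (suc d-1)))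
    (ℚ.<-≤-trans p (½^≤1 (suc n)))) (ℚ.<-irrefl refl)

-- If k log₂ ρ₃ < log₂ ρ, as witnessed by the rationals r > log₂ ρ₃ and a < log₂ ρ.
compare-logs : ∀ k r a {ρ₃ ρ} → 0ℚ ℚ.< r → 0ℚ ℚ.< a → 0ℚ ℚ.< ρ₃ → 0ℚ ℚ.< ρ → ι k ℚ.* r ℚ.< a →
  ρ₃ ^ᵠ ℚ.↧ₙ r ℚ.< 2^ (ℚ.↥ r) → 2^ (ℚ.↥ a) ℚ.< ρ ^ᵠ ℚ.↧ₙ a → ρ₃ ^ᵠ k ℚ.≤ ρ
compare-logs k r@(mkℚ _ e _) a@(mkℚ _ f _) {ρ₃} {ρ} 0<r 0<a 0<ρ₃ 0<ρ kr<a p q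
  with positive-numerator r 0<r | positive-numerator a 0<a
-- The successor of this exponent is `d * d′`, the product of the denominators of `r` and `a`.
... | n , refl | o , refl = ^-cancel-≤ᵠ (f + e * suc f) 0<ρ (begin
  (ρ₃ ^ᵠ k) ^ᵠ (d * d′) ≡⟨ ^-assocʳ ρ₃ k (d * d′) ⟩
  ρ₃ ^ᵠ (k * (d * d′)) ≡⟨ cong (ρ₃ ^ᵠ_) (l₁ k d d′) ⟩
  ρ₃ ^ᵠ (d * (k * d′)) ≡⟨ ^-assocʳ ρ₃ d (k * d′) ⟨
  (ρ₃ ^ᵠ d) ^ᵠ (k * d′) ≤⟨ ^-mono-≤ᵠ (k * d′) (^-nonNegative d (ℚ.<⇒≤ 0<ρ₃)) (ℚ.<⇒≤ p) ⟩
  2^ (+ suc n) ^ᵠ (k * d′) ≡⟨ cong (_^ᵠ (k * d′)) (2^-ι (suc n)) ⟩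
  ι (2 ^ suc n) ^ᵠ (k * d′) ≡⟨ ι-^ (2 ^ suc n) (k * d′) ⟨
  ι ((2 ^ suc n) ^ (k * d′)) ≡⟨ cong ι (^-*-assoc 2 (suc n) (k * d′)) ⟩
  ι (2 ^ (suc n * (k * d′))) ≤⟨ ι-≤ {2 ^ (suc n * (k * d′))} {2 ^ (suc o * d)} (^-monoʳ-≤ 2 (<⇒≤ exponents)) ⟩
  ι (2 ^ (suc o * d)) ≡⟨ cong ι (^-*-assoc 2 (suc o) d) ⟨
  ι ((2 ^ suc o) ^ d) ≡⟨ ι-^ (2 ^ suc o) d ⟩
  ι (2 ^ suc o) ^ᵠ d ≡⟨ cong (_^ᵠ d) (2^-ι (suc o)) ⟨
  2^ (+ suc o) ^ᵠ d ≤⟨ ^-mono-≤ᵠ d (subst (0ℚ ℚ.≤_) (sym (2^-ι (suc o))) (0≤ι (2 ^ suc o))) (ℚ.<⇒≤ q) ⟩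
  (ρ ^ᵠ d′) ^ᵠ d ≡⟨ ^-assocʳ ρ d′ d ⟩
  ρ ^ᵠ (d′ * d) ≡⟨ cong (ρ ^ᵠ_) (*-comm d′ d) ⟩
  ρ ^ᵠ (d * d′) ∎)
  where
  open ℚ.≤-Reasoning
  d = suc e
  d′ = suc f
  l₁ : ∀ k d d′ → k * (d * d′) ≡ d * (k * d′)
  l₁ = solve-∀
  l₂ : ∀ n k d′ → n * (k * d′) ≡ k * n * d′
  l₂ = solve-∀
  exponents : suc n * (k * d′) < suc o * d
  exponents = ι-cancel-< {suc n * (k * d′)} {suc o * d} (begin-strict
    ι (suc n * (k * d′)) ≡⟨ cong ι (l₂ (suc n) k d′) ⟩
    ι (k * suc n * d′) ≡⟨ trans (ι-* (k * suc n) d′) (cong (ℚ._* ι d′) (ι-* k (suc n))) ⟩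
    ι k ℚ.* ι (suc n) ℚ.* ι d′ ≡⟨ cong (λ z → ι k ℚ.* z ℚ.* ι d′) (clear-denominator r (suc n) refl) ⟨
    ι k ℚ.* (r ℚ.* ι d) ℚ.* ι d′ ≡⟨ cong (ℚ._* ι d′) (ℚ.*-assoc (ι k) r (ι d)) ⟨
    ι k ℚ.* r ℚ.* ι d ℚ.* ι d′ <⟨ *-monoˡ-<₊ (ι-< {0} {d′} (s≤s z≤n)) (*-monoˡ-<₊ (ι-< {0} {d} (s≤s z≤n)) kr<a) ⟩
    a ℚ.* ι d ℚ.* ι d′
      ≡⟨ trans (ℚ.*-assoc a (ι d) (ι d′)) (trans (cong (a ℚ.*_) (ℚ.*-comm (ι d) (ι d′))) (sym (ℚ.*-assoc a (ι d′) (ι d)))) ⟩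
    a ℚ.* ι d′ ℚ.* ι d ≡⟨ cong (ℚ._* ι d) (clear-denominator a (suc o) refl) ⟩
    ι (suc o) ℚ.* ι d ≡⟨ ι-* (suc o) d ⟨
    ι (suc o * d) ∎)

fromℚ-real : ∀ p → Real (fromℚ p)
fromℚ-real p = record
  { lower-inhabited = p ℚ.+ ℚ.- 1ℚ , subst (p ℚ.+ ℚ.- 1ℚ ℚ.<_) (ℚ.+-identityʳ p)
      (ℚ.+-monoʳ-< p (toWitness {a? = ℚ.- 1ℚ ℚ.<? 0ℚ} tt))
  ; upper-inhabited = p ℚ.+ 1ℚ , subst (ℚ._< p ℚ.+ 1ℚ) (ℚ.+-identityʳ p) (ℚ.+-monoʳ-< p (toWitness {a? = 0ℚ ℚ.<? 1ℚ} tt))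
  ; lower-rounded = mk⇔ (λ q<p → ℚ.<-dense q<p) (λ (r , q<r , r<p) → ℚ.<-trans q<r r<p)
  ; upper-rounded = mk⇔ (λ p<q → let r , p<r , r<q = ℚ.<-dense p<q in r , r<q , p<r) (λ (r , r<q , p<r) → ℚ.<-trans p<r r<q)
  ; disjoint = ℚ.<-asym
  ; located = located
  }
  where
  located : ∀ {q r} → q ℚ.< r → q ℚ.< p ⊎ p ℚ.< r
  located {q} q<r with q ℚ.<? p
  ... | yes q<p = inj₁ q<p
  ... | no q≮p  = inj₂ (ℚ.≤-<-trans (ℚ.≮⇒≥ q≮p) q<r)

lower<upper : ∀ {x p q} → Real x → lower x p → upper x q → p ℚ.< q
lower<upper {x} {p} {q} rx l u with p ℚ.<? q
... | yes p<q = p<q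
... | no p≮q with Equivalence.to (Real.lower-rounded rx) l
...   | r , p<r , lr = ⊥-elim (Real.disjoint rx
  (Equivalence.from (Real.lower-rounded rx) (r , ℚ.≤-<-trans (ℚ.≮⇒≥ p≮q) p<r , lr)) u)

-- Without probes the answer cannot depend on the string, but SA distinguishes 01 and 10.
no-zero-probe : ∀ {w} (D : CellProbeStructure w (List Bool) ℕ ℕ) →
  AnswersSA D (false ∷ true ∷ []) 0 → AnswersSA D (true ∷ false ∷ []) 0 → ⊥
no-zero-probe D ans₀₁ ans₁₀ with ans₀₁ zero | ans₁₀ zero
... | _ , run₀₁ , t≤0 | _ , run₁₀ , t′≤0 = contradiction
  (trans (sym (first₀₁ (SA s₀₁ ⟨$⟩ʳ zero) (SA s₀₁ ⟨$⟩ʳ suc zero) (SA-isSuffixArray s₀₁ {zero} {suc zero} (s≤s z≤n))))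
    (trans (suc-injective same) (first₁₀ (SA s₁₀ ⟨$⟩ʳ zero) (SA s₁₀ ⟨$⟩ʳ suc zero)
      (SA-isSuffixArray s₁₀ {zero} {suc zero} (s≤s z≤n))))) (λ ())
  where
  s₀₁ s₁₀ : List Bool
  s₀₁ = false ∷ true ∷ []
  s₁₀ = true ∷ false ∷ []
  constant : ∀ {w} (alg : Algorithm w ℕ) {M M′ y y′ t t′} → run alg M ≡ just (y , t) → t ≤ 0 →
             run alg M′ ≡ just (y′ , t′) → y ≡ y′
  constant (output y)  refl _ refl = refl
  constant (probe a k) {M} e t≤0 _ with run-probe a k M e
  constant (probe a k) e () _ | _ , _ , refl , _
  same = constant (query D 1) run₀₁ t≤0 run₁₀
  first₀₁ : ∀ (i j : Fin 2) → suffix (false ∷ true ∷ []) i ≺ suffix (false ∷ true ∷ []) j → toℕ i ≡ 0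
  first₀₁ zero       j          _ = refl
  first₀₁ (suc zero) zero       (this ())
  first₀₁ (suc zero) zero       (next () _)
  first₀₁ (suc zero) (suc zero) (this ())
  first₀₁ (suc zero) (suc zero) (next _ (base ()))
  first₁₀ : ∀ (i j : Fin 2) → suffix (true ∷ false ∷ []) i ≺ suffix (true ∷ false ∷ []) j → toℕ i ≡ 1
  first₁₀ (suc zero) j          _ = refl
  first₁₀ zero       zero       (this ())
  first₁₀ zero       zero       (next _ (this ()))
  first₁₀ zero       zero       (next _ (next _ (base ())))
  first₁₀ zero       (suc zero) (this ())
  first₁₀ zero       (suc zero) (next () _)

-- From the real bounds to the choice of the parameters

abstract
  threshold : ℕ → ℕ
  threshold k = 2 ^ (2 ^ k)

  above-threshold : ∀ k N → threshold k ≤ N → ∃[ ℓ ] ∃[ l ] k ≤ l ×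
    (2 ^ ℓ ≤ N × N < 2 ^ suc ℓ) × (2 ^ l ≤ ℓ × ℓ < 2 ^ suc l)
  above-threshold k N big with log₂-floor N (≤-trans (m^n>0 2 (2 ^ k)) big)
  ... | ℓ , p , q with log₂-floor ℓ (≤-trans (m^n>0 2 k) (2^-cancel-≤ (2 ^ k) ℓ (≤-<-trans big q)))
  ...   | l , p′ , q′ = ℓ , l , 2^-cancel-≤ k l (≤-<-trans (2^-cancel-≤ (2 ^ k) ℓ (≤-<-trans big q)) q′) , (p , q) , (p′ , q′)

-- Choice.refute needs J^(56 Q) ≤ log N, since R^(Q+1) ≤ J^(28 Q) and its square
-- has to stay below log N.
c₀ : ℚ
c₀ = + 1 ℚ./ 56

cells-bounded : ∀ {ρ b J l N} → 0ℚ ℚ.≤ b → 1 ≤ l → ρ ℚ.< ι (suc J) → b ℚ.* ι l ℚ.< ρ ℚ.* ι N →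
                ∀ k → ι k ℚ.≤ b → k ≤ suc J * N
cells-bounded {ρ} {b} {J} {l} {N} 0≤b 1≤l ρ<J b<ρ k k≤b = <⇒≤ (ι-cancel-< {k} {suc J * N} (begin-strict
  ι k ≤⟨ k≤b ⟩
  b ≡⟨ ℚ.*-identityʳ b ⟨
  b ℚ.* 1ℚ ≤⟨ *-monoʳ-≤₀ {b} 0≤b (ι-≤ {1} {l} 1≤l) ⟩
  b ℚ.* ι l <⟨ b<ρ ⟩
  ρ ℚ.* ι N ≤⟨ *-monoˡ-≤₀ {ι N} (0≤ι N) (ℚ.<⇒≤ ρ<J) ⟩
  ι (suc J) ℚ.* ι N ≡⟨ ι-* (suc J) N ⟨
  ι (suc J * N) ∎))
  where open ℚ.≤-Reasoning

-- Since S is at least a constant multiple of N, the ratio (S/N) log log N is at least of order `l`.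
-- This is what lets powers of `J` absorb the terms in `l`.
log-bounded : ∀ {q ρ b J l N N′} → 0ℚ ℚ.< q → 0ℚ ℚ.< ρ → ρ ℚ.< ι (suc J) → N ≤ 2 * N′ →
              q ℚ.* ι N′ ℚ.< b → b ℚ.* ι l ℚ.< ρ ℚ.* ι N → l < suc J * (2 * ℚ.↧ₙ q)
log-bounded {q} {ρ} {b} {J} {l} {N} {N′} 0<q 0<ρ ρ<J N≤ q<b b<ρ = go (positive-numerator q 0<q)
  where
  open ℚ.≤-Reasoning
  d = ℚ.↧ₙ q
  half : q ℚ.* ι l ℚ.< ρ ℚ.* ι 2
  half = ℚ.*-cancelʳ-<-nonNeg (ι N′) {{nonNegative (0≤ι N′)}} (begin-strict
    q ℚ.* ι l ℚ.* ι N′ ≡⟨ ℚ.*-assoc q (ι l) (ι N′) ⟩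
    q ℚ.* (ι l ℚ.* ι N′) ≡⟨ cong (q ℚ.*_) (ℚ.*-comm (ι l) (ι N′)) ⟩
    q ℚ.* (ι N′ ℚ.* ι l) ≡⟨ ℚ.*-assoc q (ι N′) (ι l) ⟨
    q ℚ.* ι N′ ℚ.* ι l ≤⟨ *-monoˡ-≤₀ {ι l} (0≤ι l) (ℚ.<⇒≤ q<b) ⟩
    b ℚ.* ι l <⟨ b<ρ ⟩
    ρ ℚ.* ι N ≤⟨ *-monoʳ-≤₀ (ℚ.<⇒≤ 0<ρ) (ι-≤ {N} {2 * N′} N≤) ⟩
    ρ ℚ.* ι (2 * N′) ≡⟨ cong (ρ ℚ.*_) (ι-* 2 N′) ⟩
    ρ ℚ.* (ι 2 ℚ.* ι N′) ≡⟨ ℚ.*-assoc ρ (ι 2) (ι N′) ⟨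
    ρ ℚ.* ι 2 ℚ.* ι N′ ∎)
  go : ∃[ n ] ℚ.↥ q ≡ ℤ.+ suc n → l < suc J * (2 * d)
  go (n , eq) = ι-cancel-< {l} {suc J * (2 * d)} (begin-strict
    ι l ≤⟨ ι-≤ {l} {l * suc n} (m≤m*n l (suc n)) ⟩
    ι (l * suc n) ≡⟨ ι-* l (suc n) ⟩
    ι l ℚ.* ι (suc n) ≡⟨ cong (ι l ℚ.*_) (clear-denominator q (suc n) eq) ⟨
    ι l ℚ.* (q ℚ.* ι d) ≡⟨ ℚ.*-assoc (ι l) q (ι d) ⟨
    ι l ℚ.* q ℚ.* ι d ≡⟨ cong (ℚ._* ι d) (ℚ.*-comm (ι l) q) ⟩
    q ℚ.* ι l ℚ.* ι d <⟨ *-monoˡ-<₊ {ι d} (ι-< {0} {d} (s≤s z≤n)) half ⟩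
    ρ ℚ.* ι 2 ℚ.* ι d ≤⟨ *-monoˡ-≤₀ {ι d} (0≤ι d) (*-monoˡ-≤₀ {ι 2} (0≤ι 2) (ℚ.<⇒≤ ρ<J)) ⟩
    ι (suc J) ℚ.* ι 2 ℚ.* ι d ≡⟨ cong (ℚ._* ι d) (ι-* (suc J) 2) ⟨
    ι (suc J * 2) ℚ.* ι d ≡⟨ ι-* (suc J * 2) d ⟨
    ι (suc J * 2 * d) ≡⟨ cong ι (*-assoc (suc J) 2 d) ⟩
    ι (suc J * (2 * d)) ∎)

above-lg : ∀ N → ∃[ d ] 0ℚ ℚ.< d × upper (log₂ (fromℕ N)) d
above-lg N = mkℚ (+ suc N) 0 (coprime-1 (suc N)) , *<* (ℤ.+<+ (s≤s z≤n)) , ι (suc N) , ι-< {N} {suc N} ≤-refl ,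
  ι-< {0} {suc N} (s≤s z≤n) , subst₂ ℚ._<_ (sym (ℚ.*-identityʳ (ι (suc N)))) (sym (2^-ι (suc N)))
    (ι-< {suc N} {2 ^ suc N} (n<2^n (suc N)))

below-lg : ∀ {N} → 4 ≤ N → lower (log₂ (fromℕ N)) 1ℚ
below-lg {N} 4≤N = ι 3 , ι-< {3} {N} 4≤N , ι-< {0} {3} (s≤s z≤n) , toWitness {a? = (2^ (+ 1)) ℚ.<? (ι 3 ℚ.* 1ℚ)} tt

word-positive : ∀ {a N w} → Real a → 0ᴿ <ᴿ a → 4 ≤ N → a *ᴿ log₂ (fromℕ N) ≤ᴿ fromℕ w → 0 < w
word-positive {N = N} {w} ra (q , 0<q , lq) 4≤N hyp = ι-cancel-< {0} {w} (hyp 0ℚ (q , b , 1ℚ , d ,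
  (lq , proj₂ (Real.upper-inhabited ra) , below-lg 4≤N , proj₂ (proj₂ (above-lg N))) ,
  (*-positive 0<q 0<1 , *-positive 0<q 0<d , *-positive 0<b 0<1 , *-positive 0<b 0<d)))
  where
  b d : ℚ
  b = proj₁ (Real.upper-inhabited ra)
  d = proj₁ (above-lg N)
  0<1 : 0ℚ ℚ.< 1ℚ
  0<1 = ι-< {0} {1} (s≤s z≤n)
  0<d : 0ℚ ℚ.< d
  0<d = proj₁ (proj₂ (above-lg N))
  0<b : 0ℚ ℚ.< b
  0<b = ℚ.<-trans 0<q (lower<upper ra lq (proj₂ (Real.upper-inhabited ra)))

natural-upper : ∀ {a} → Real a → 0ᴿ <ᴿ a → ∃[ k ] (∀ {p} → lower a p → p ℚ.< ι (suc k))
natural-upper {a} ra (q , 0<q , lq) = go (Real.upper-inhabited ra)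
  where
  go : ∃[ b ] upper a b → ∃[ k ] (∀ {p} → lower a p → p ℚ.< ι (suc k))
  go (b , ub) = proj₁ next-natural , λ lp → ℚ.<-trans (lower<upper ra lp ub) (proj₂ (proj₂ next-natural))
    where
    next-natural : ∃[ k ] ι k ℚ.≤ b × b ℚ.< ι (suc k)
    next-natural = floor b (ℚ.<-trans 0<q (lower<upper ra lq ub))

module Logarithms (N ℓ l : ℕ) (2^ℓ≤N : 2 ^ ℓ ≤ N) (N<2^ : N < 2 ^ suc ℓ) (2^l≤ℓ : 2 ^ l ≤ ℓ) (4≤N : 4 ≤ N)
  (1≤ℓ : 1 ≤ ℓ) where

  lg X : Cut
  lg = log₂ (fromℕ N)
  X = log₂ lg

  lg-upper : ∀ {ρ} → upper lg ρ → ι ℓ ℚ.< ρ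
  lg-upper = log₂-upper (fromℕ N) N ℓ (λ p → p) 2^ℓ≤N

  X-upper : ∀ {ρ} → upper X ρ → ι l ℚ.< ρ
  X-upper = log₂-upper lg ℓ l lg-upper 2^l≤ℓ

  lg-lower : ∀ {ρ} → lower lg ρ → ρ ℚ.< ι (suc ℓ)
  lg-lower = log₂-lower (fromℕ N) N (suc ℓ) (λ p → p) (<⇒≤ N<2^)

  word-bounded : ∀ {a k} w → Real a → 0ᴿ <ᴿ a → (∀ {p} → lower a p → p ℚ.< ι (suc k)) →
                 fromℕ w ≤ᴿ a *ᴿ lg → w ≤ suc k * 2 * ℓ
  word-bounded zero    _  _           _     _   = z≤n
  word-bounded {a} {k} (suc w) ra (q , 0<q , lq) bound hyp = go (hyp (ι w) (ι-< {w} {suc w} ≤-refl))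
    where
    l₁ : ∀ k ℓ → k * (ℓ + ℓ) ≡ k * 2 * ℓ
    l₁ = solve-∀
    go : lower (a *ᴿ lg) (ι w) → suc w ≤ suc k * 2 * ℓ
    go (p , b , c , d , (la , ub , lc , _) , (w<pc , _ , w<bc , _)) =
      ≤-trans (ι-cancel-< {w} {suc k * suc ℓ} bounded) (≤-trans (*-monoʳ-≤ (suc k) (+-monoˡ-≤ ℓ 1≤ℓ))
        (≤-reflexive (l₁ (suc k) ℓ)))
      where
      0<b : 0ℚ ℚ.< b
      0<b = ℚ.<-trans 0<q (lower<upper ra lq ub)
      0<c : 0ℚ ℚ.< c
      0<c = positive-right 0<b (ℚ.≤-<-trans (0≤ι w) w<bc)
      bounded : ι w ℚ.< ι (suc k * suc ℓ)
      bounded = begin-strict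
        ι w <⟨ w<pc ⟩
        p ℚ.* c <⟨ *-monoˡ-<₊ 0<c (bound la) ⟩
        ι (suc k) ℚ.* c <⟨ *-monoʳ-<₊ {ι (suc k)} (ι-< {0} {suc k} (s≤s z≤n)) (lg-lower lc) ⟩
        ι (suc k) ℚ.* ι (suc ℓ) ≡⟨ ι-* (suc k) (suc ℓ) ⟨
        ι (suc k * suc ℓ) ∎
        where open ℚ.≤-Reasoning

  space-large : ∀ {a q S b N′} → Real a → 0ℚ ℚ.< q → lower a q → Real S → a *ᴿ fromℕ N ≤ᴿ S →
                0 < N′ → N′ < N → upper S b → q ℚ.* ι N′ ℚ.< b
  space-large {a} {q} {S} {b} {N′} ra 0<q lq rS S-large 0<N′ N′<N ub =
    go (Equivalence.to (Real.lower-rounded ra) lq) (Real.upper-inhabited ra)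
    where
    step₁ : ∀ {p} → q ℚ.< p → q ℚ.* ι N′ ℚ.< p ℚ.* ι N′
    step₁ = *-monoˡ-<₊ {ι N′} (ι-< {0} {N′} 0<N′)
    step₂ : ∀ {p} → q ℚ.< p → q ℚ.* ι N′ ℚ.< p ℚ.* ι (suc N)
    step₂ q<p = ℚ.<-trans (step₁ q<p) (*-monoʳ-<₊ (ℚ.<-trans 0<q q<p) (ι-< {N′} {suc N} (m≤n⇒m≤1+n N′<N)))
    go : ∃[ p ] q ℚ.< p × lower a p → ∃[ p ] upper a p → q ℚ.* ι N′ ℚ.< b
    go (p , q<p , lp) (p′ , up′) = lower<upper rS (S-large (q ℚ.* ι N′)
      (p , p′ , ι N′ , ι (suc N) , (lp , up′ , ι-< {N′} {N} N′<N , ι-< {N} {suc N} ≤-refl) ,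
        (step₁ q<p , step₂ q<p , step₁ q<p′ , step₂ q<p′))) ub
      where
      q<p′ : q ℚ.< p′
      q<p′ = lower<upper ra lq up′

  -- All factors are positive, so of the four corner products only that of the upper ends is used;
  -- chaining them through the reciprocal leads back to a rational above S itself.
  ratio : ∀ {S ρ} → (∀ {b} → upper S b → 0ℚ ℚ.< b) → upper ((S /ᴿ fromℕ N) *ᴿ X) ρ →
          ∃[ b ] upper S b × b ℚ.* ι l ℚ.< ρ ℚ.* ι N
  ratio {S} {ρ} S-positive
    (_ , b₂ , _ , d₂ , (_ , (_ , b , _ , d , (_ , ub , _ , (r , r<N , 0<r , 1<dr)) , (_ , _ , _ , bd<b₂)) , _ , ud₂) ,
    (_ , _ , _ , b₂d₂<ρ)) = b , ub , (begin-strict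
    b ℚ.* ι l ≡⟨ cong (ℚ._* ι l) (ℚ.*-identityʳ b) ⟨
    b ℚ.* 1ℚ ℚ.* ι l ≤⟨ *-monoˡ-≤₀ {ι l} (0≤ι l) (*-monoʳ-≤₀ (ℚ.<⇒≤ 0<b) (ℚ.<⇒≤ 1<dr)) ⟩
    b ℚ.* (d ℚ.* r) ℚ.* ι l ≡⟨ cong (ℚ._* ι l) (ℚ.*-assoc b d r) ⟨
    b ℚ.* d ℚ.* r ℚ.* ι l ≤⟨ *-monoˡ-≤₀ {ι l} (0≤ι l) (*-monoʳ-≤₀ (ℚ.<⇒≤ 0<bd) (ℚ.<⇒≤ r<N)) ⟩
    b ℚ.* d ℚ.* ι N ℚ.* ι l ≤⟨ *-monoˡ-≤₀ {ι l} (0≤ι l) (*-monoˡ-≤₀ {ι N} (0≤ι N) (ℚ.<⇒≤ bd<b₂)) ⟩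
    b₂ ℚ.* ι N ℚ.* ι l ≡⟨ ℚ.*-assoc b₂ (ι N) (ι l) ⟩
    b₂ ℚ.* (ι N ℚ.* ι l) ≡⟨ cong (b₂ ℚ.*_) (ℚ.*-comm (ι N) (ι l)) ⟩
    b₂ ℚ.* (ι l ℚ.* ι N) ≡⟨ ℚ.*-assoc b₂ (ι l) (ι N) ⟨
    b₂ ℚ.* ι l ℚ.* ι N ≤⟨ *-monoˡ-≤₀ {ι N} (0≤ι N) (*-monoʳ-≤₀ (ℚ.<⇒≤ 0<b₂) (ℚ.<⇒≤ (X-upper ud₂))) ⟩
    b₂ ℚ.* d₂ ℚ.* ι N <⟨ *-monoˡ-<₊ {ι N} (ι-< {0} {N} (≤-trans (s≤s z≤n) 4≤N)) b₂d₂<ρ ⟩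
    ρ ℚ.* ι N ∎)
    where
    open ℚ.≤-Reasoning
    0<b : 0ℚ ℚ.< b
    0<b = S-positive ub
    0<d : 0ℚ ℚ.< d
    0<d = positive-left 0<r (ℚ.<-trans (ι-< {0} {1} (s≤s z≤n)) 1<dr)
    0<bd : 0ℚ ℚ.< b ℚ.* d
    0<bd = *-positive 0<b 0<d
    0<b₂ : 0ℚ ℚ.< b₂
    0<b₂ = ℚ.<-trans 0<bd bd<b₂

  -- Exponentiating Q ≤ (1/56) log log N / log W bounds W^(56Q) by log N. The witnesses inside the
  -- cut operations are unpacked, and `Q ≥ 0` makes first `c` and then `c₁` and `a₁` positive.
  quotient : ∀ {W Q q} → lower (fromℚ c₀ *ᴿ (X /ᴿ log₂ W)) q → ι Q ℚ.≤ q →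
             ∃[ ρ ] 0ℚ ℚ.< ρ × upper W ρ × ρ ^ᵠ (56 * Q) ℚ.< ι (suc ℓ)
  quotient {W} {Q} {q}
    (a , b , c , d , (a<c₀ , c₀<b ,
      (a₁ , b₁ , c₁ , d₁ , ((ρ , lρ , 0<ρ , aρ) , ub₁ ,
        (r , (ρ₃ , uρ₃ , 0<ρ₃ , rρ₃) , 0<r , cr<1) , _) , (c<ac , _ , c<bc , _)) , _) ,
      (q<ac , _ , q<bc , _)) Q≤q =
    ρ₃ , 0<ρ₃ , uρ₃ , ℚ.≤-<-trans (compare-logs (56 * Q) r a₁ 0<r 0<a₁ 0<ρ₃ 0<ρ exponent rρ₃ aρ) (lg-lower lρ)
    where
    open ℚ.≤-Reasoning
    0<b : 0ℚ ℚ.< b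
    0<b = ℚ.<-trans (toWitness {a? = 0ℚ ℚ.<? c₀} tt) c₀<b
    0≤q : 0ℚ ℚ.≤ q
    0≤q = ℚ.≤-trans (0≤ι Q) Q≤q
    0<c : 0ℚ ℚ.< c
    0<c = positive-right 0<b (ℚ.≤-<-trans 0≤q q<bc)
    0<b₁ : 0ℚ ℚ.< b₁
    0<b₁ = ℚ.≤-<-trans (0≤ι l) (X-upper ub₁)
    0<c₁ : 0ℚ ℚ.< c₁
    0<c₁ = positive-right 0<b₁ (ℚ.<-trans 0<c c<bc)
    0<a₁ : 0ℚ ℚ.< a₁
    0<a₁ = positive-left 0<c₁ (ℚ.<-trans 0<c c<ac)
    cr<a : c ℚ.* r ℚ.< a₁
    cr<a = begin-strict
      c ℚ.* r <⟨ *-monoˡ-<₊ 0<r c<ac ⟩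
      a₁ ℚ.* c₁ ℚ.* r ≡⟨ ℚ.*-assoc a₁ c₁ r ⟩
      a₁ ℚ.* (c₁ ℚ.* r) <⟨ *-monoʳ-<₊ 0<a₁ cr<1 ⟩
      a₁ ℚ.* 1ℚ ≡⟨ ℚ.*-identityʳ a₁ ⟩
      a₁ ∎
    Qr<ca : ι Q ℚ.* r ℚ.< c₀ ℚ.* a₁
    Qr<ca = begin-strict
      ι Q ℚ.* r ≤⟨ *-monoˡ-≤₀ (ℚ.<⇒≤ 0<r) Q≤q ⟩
      q ℚ.* r <⟨ *-monoˡ-<₊ 0<r q<ac ⟩
      a ℚ.* c ℚ.* r <⟨ *-monoˡ-<₊ 0<r (*-monoˡ-<₊ 0<c a<c₀) ⟩
      c₀ ℚ.* c ℚ.* r ≡⟨ ℚ.*-assoc c₀ c r ⟩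
      c₀ ℚ.* (c ℚ.* r) <⟨ *-monoʳ-<₊ {c₀} (toWitness {a? = 0ℚ ℚ.<? c₀} tt) cr<a ⟩
      c₀ ℚ.* a₁ ∎
    exponent : ι (56 * Q) ℚ.* r ℚ.< a₁
    exponent = begin-strict
      ι (56 * Q) ℚ.* r ≡⟨ cong (ℚ._* r) (ι-* 56 Q) ⟩
      ι 56 ℚ.* ι Q ℚ.* r ≡⟨ ℚ.*-assoc (ι 56) (ι Q) r ⟩
      ι 56 ℚ.* (ι Q ℚ.* r) <⟨ *-monoʳ-<₊ {ι 56} (ι-< {0} {56} (s≤s z≤n)) Qr<ca ⟩
      ι 56 ℚ.* (c₀ ℚ.* a₁) ≡⟨ ℚ.*-assoc (ι 56) c₀ a₁ ⟨
      ι 56 ℚ.* c₀ ℚ.* a₁ ≡⟨ ℚ.*-identityˡ a₁ ⟩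
      a₁ ∎

-- `l` is at most linear in `J` with constant `A`; the lower bound on `l` forces `J` to be at least
-- `2 * A`, and a second factor `J` absorbs the constant.
large-ratio : ∀ A J l → 2 ≤ A → l < suc J * A → A * (2 * A + 1) ≤ l → 2 ≤ J × l ≤ J * J
large-ratio A J l 2≤A l< ≤l = ≤-trans 2≤A (≤-trans (m≤m+n A (A + 0)) 2A≤J) , (begin
  l ≤⟨ <⇒≤ l< ⟩
  suc J * A ≤⟨ *-monoˡ-≤ A (+-monoˡ-≤ J 1≤J) ⟩
  (J + J) * A ≡⟨ l₁ J A ⟩
  J * (2 * A) ≤⟨ *-monoʳ-≤ J 2A≤J ⟩
  J * J ∎)
  where
  open ≤-Reasoning
  l₁ : ∀ J A → (J + J) * A ≡ J * (2 * A)
  l₁ = solve-∀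
  2A<J : 2 * A + 1 < suc J
  2A<J = *-cancelˡ-< A (2 * A + 1) (suc J) (≤-<-trans ≤l (<-≤-trans l< (≤-reflexive (*-comm (suc J) A))))
  2A≤J : 2 * A ≤ J
  2A≤J = ≤-trans (m≤m+n (2 * A) 1) (s≤s⁻¹ 2A<J)
  1≤J : 1 ≤ J
  1≤J = ≤-trans (≤-trans (s≤s z≤n) 2≤A) (≤-trans (m≤m+n A (A + 0)) 2A≤J)

summands : ∀ x y z {n} → x + y + z ≤ n → x ≤ n × y ≤ n × z ≤ n
summands x y z p = ≤-trans (≤-trans (m≤m+n x y) (m≤m+n (x + y) z)) p , ≤-trans (≤-trans (m≤n+m y x) (m≤m+n (x + y) z)) p ,
  ≤-trans (m≤n+m z (x + y)) p

abstract
  minimum : ℕ → ℕ → ℕ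
  minimum A C = leastLog + (8 * C + 4) + A * (2 * A + 1)

  minimum-≤ : ∀ A C {n} → minimum A C ≤ n → leastLog ≤ n × 8 * C + 4 ≤ n × A * (2 * A + 1) ≤ n
  minimum-≤ A C = summands leastLog (8 * C + 4) (A * (2 * A + 1))

module Conclusion {a₁ a₂ a₃ : Cut} (ra₁ : Real a₁) (ra₂ : Real a₂) (ra₃ : Real a₃)
  (pa₁ : 0ᴿ <ᴿ a₁) (pa₂ : 0ᴿ <ᴿ a₂) (q₃ : ℚ) (0<q₃ : 0ℚ ℚ.< q₃) (lq₃ : lower a₃ q₃)
  (k : ℕ) (a₂<k : ∀ {p} → lower a₂ p → p ℚ.< ι (suc k))
  (N ℓ l : ℕ) (large : minimum (2 * ℚ.↧ₙ q₃) (suc k * 2) ≤ l)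
  (2^ℓ≤N : 2 ^ ℓ ≤ N) (N<2^ : N < 2 ^ suc ℓ) (2^l≤ℓ : 2 ^ l ≤ ℓ) (ℓ<2^ : ℓ < 2 ^ suc l) where

  d A C : ℕ
  d = ℚ.↧ₙ q₃
  A = 2 * d
  C = suc k * 2

  4≤l : 4 ≤ l
  4≤l = ≤-trans (m≤n+m 4 (8 * C)) (proj₁ (proj₂ (minimum-≤ A C large)))

  l≤ℓ : l ≤ ℓ
  l≤ℓ = ≤-trans (<⇒≤ (n<2^n l)) 2^l≤ℓ

  4≤N : 4 ≤ N
  4≤N = ≤-trans (≤-trans 4≤l l≤ℓ) (≤-trans (<⇒≤ (n<2^n ℓ)) 2^ℓ≤N)

  open Logarithms N ℓ l 2^ℓ≤N N<2^ 2^l≤ℓ 4≤N (≤-trans (s≤s z≤n) (≤-trans 4≤l l≤ℓ))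

  N′ : ℕ
  -- The lower cut of `fromℕ N` contains only rationals strictly below `N`; this one is still at
  -- least half of `N`.
  N′ = N ∸ 1

  1+N′ : suc N′ ≡ N
  1+N′ = m+[n∸m]≡n (≤-trans (s≤s z≤n) 4≤N)

  0<N′ : 0 < N′
  0<N′ = s≤s⁻¹ (≤-trans (≤-trans (s≤s (s≤s z≤n)) 4≤N) (≤-reflexive (sym 1+N′)))

  N≤2N′ : N ≤ 2 * N′
  N≤2N′ = ≤-trans (≤-reflexive (sym 1+N′)) (≤-trans (+-monoˡ-≤ N′ 0<N′) (≤-reflexive (l₁ N′)))
    where
    l₁ : ∀ n → n + n ≡ 2 * n
    l₁ = solve-∀

  module Refutation {w : ℕ} (w-lower : a₁ *ᴿ lg ≤ᴿ fromℕ w) (w-upper : fromℕ w ≤ᴿ a₂ *ᴿ lg)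
    {S : Cut} (rS : Real S) (S-large : a₃ *ᴿ fromℕ N ≤ᴿ S) (Q : ℕ) (0<Q : 0 < Q)
    (D : CellProbeStructure w (List Bool) ℕ ℕ)
    (spec : ∀ T → 2 ≤ length T → length T ≤ N → fromℕ (bits (preprocess D T)) ≤ᴿ S × AnswersSA D T Q) where

    q₃-bound : ∀ {b} → upper S b → q₃ ℚ.* ι N′ ℚ.< b
    q₃-bound ub = space-large ra₃ 0<q₃ lq₃ rS S-large 0<N′ (≤-reflexive 1+N′) ub

    S-positive : ∀ {b} → upper S b → 0ℚ ℚ.< b
    S-positive ub = ℚ.<-trans (*-positive {q₃} {ι N′} 0<q₃ (ι-< {0} {N′} 0<N′)) (q₃-bound ub)

    refute-floor : ∀ {ρ b J} → 0ℚ ℚ.< ρ → ρ ^ᵠ (56 * Q) ℚ.< ι (suc ℓ) → upper S b → b ℚ.* ι l ℚ.< ρ ℚ.* ι N →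
                   ι J ℚ.≤ ρ → ρ ℚ.< ι (suc J) → ⊥
    refute-floor {ρ} {b} {J} 0<ρ power ub b<ρ J≤ρ ρ<J = Choice.refute N ℓ l J Q w C 0<Q (word-positive ra₁ pa₁ 4≤N w-lower)
      2^ℓ≤N N<2^ 2^l≤ℓ ℓ<2^ (word-bounded {a₂} {k} w ra₂ pa₂ a₂<k w-upper) J^≤ℓ (proj₂ ratio-large) (proj₁ ratio-large)
      (proj₁ (minimum-≤ A C large)) (proj₁ (proj₂ (minimum-≤ A C large))) D
      (λ T 2≤T T≤N → proj₂ (spec T 2≤T T≤N) , ≤-trans (≤-reflexive (*-comm (length (preprocess D T)) w))
        (cells-bounded {ρ} {b} {J} {l} {N} (ℚ.<⇒≤ (S-positive ub)) (≤-trans (s≤s z≤n) 4≤l) ρ<J b<ρ (bits (preprocess D T))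
          (ℚ.≮⇒≥ λ b<bits → Real.disjoint rS (proj₁ (spec T 2≤T T≤N) b b<bits) ub)))
      where
      ratio-large : 2 ≤ J × l ≤ J * J
      ratio-large = large-ratio A J l (*-monoʳ-≤ 2 {1} {d} (s≤s z≤n))
        (log-bounded {q₃} {ρ} {b} {J} {l} {N} {N′} 0<q₃ 0<ρ ρ<J N≤2N′ (q₃-bound ub) b<ρ)
        (proj₂ (proj₂ (minimum-≤ A C large)))
      J^≤ℓ : J ^ (56 * Q) ≤ ℓ
      J^≤ℓ = s≤s⁻¹ (ι-cancel-< {J ^ (56 * Q)} {suc ℓ} (ℚ.≤-<-trans
        (subst (ℚ._≤ ρ ^ᵠ (56 * Q)) (sym (ι-^ J (56 * Q))) (^-mono-≤ᵠ (56 * Q) (0≤ι J) J≤ρ)) power))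

    refute-ratio : ∀ {ρ} → 0ℚ ℚ.< ρ → ρ ^ᵠ (56 * Q) ℚ.< ι (suc ℓ) →
                   ∃[ b ] upper S b × b ℚ.* ι l ℚ.< ρ ℚ.* ι N → ∃[ J ] ι J ℚ.≤ ρ × ρ ℚ.< ι (suc J) → ⊥
    refute-ratio {ρ} 0<ρ power (b , ub , b<ρ) (J , J≤ρ , ρ<J) = refute-floor {ρ} {b} {J} 0<ρ power ub b<ρ J≤ρ ρ<J

    refute-quotient : ∃[ ρ ] 0ℚ ℚ.< ρ × upper ((S /ᴿ fromℕ N) *ᴿ X) ρ × ρ ^ᵠ (56 * Q) ℚ.< ι (suc ℓ) → ⊥
    refute-quotient (ρ , 0<ρ , uρ , power) = refute-ratio {ρ} 0<ρ power (ratio {S} {ρ} S-positive uρ) (floor ρ 0<ρ)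

    refutation : ∀ q → lower (fromℚ c₀ *ᴿ (X /ᴿ log₂ ((S /ᴿ fromℕ N) *ᴿ X))) q → ι Q ℚ.≤ q → ⊥
    refutation q lq Q≤q = refute-quotient (quotient {(S /ᴿ fromℕ N) *ᴿ X} {Q} {q} lq Q≤q)

theorem1p1 : (a₁ a₂ a₃ : Cut) → Real a₁ → Real a₂ → Real a₃ →
    0ᴿ <ᴿ a₁ → 0ᴿ <ᴿ a₂ → 0ᴿ <ᴿ a₃ →
    ∃[ c ] Real c × 0ᴿ <ᴿ c × (∃[ N₀ ]
    ((N : ℕ) → N₀ ≤ N →
    (w : ℕ) → a₁ *ᴿ log₂ (fromℕ N) ≤ᴿ fromℕ w → fromℕ w ≤ᴿ a₂ *ᴿ log₂ (fromℕ N) →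
    (S : Cut) → Real S → a₃ *ᴿ fromℕ N ≤ᴿ S →
    (Q : ℕ) (D : CellProbeStructure w (List Bool) ℕ ℕ) →
    (∀ T → 2 ≤ length T → length T ≤ N →
    fromℕ (bits (preprocess D T)) ≤ᴿ S × AnswersSA D T Q) →
    c *ᴿ (log₂ (log₂ (fromℕ N))
    /ᴿ log₂ ((S /ᴿ fromℕ N) *ᴿ log₂ (log₂ (fromℕ N))))
    ≤ᴿ fromℕ Q))
theorem1p1 a₁ a₂ a₃ ra₁ ra₂ ra₃ pa₁ pa₂ (q₃ , 0<q₃ , lq₃) = fromℚ c₀ , fromℚ-real c₀ ,
  ℚ.<-dense (toWitness {a? = 0ℚ ℚ.<? c₀} tt) , threshold λ₀ , bound
  where
  k-bound : ∃[ k ] (∀ {p} → lower a₂ p → p ℚ.< ι (suc k))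
  k-bound = natural-upper ra₂ pa₂
  k = proj₁ k-bound
  λ₀ : ℕ
  λ₀ = minimum (2 * ℚ.↧ₙ q₃) (suc k * 2)
  bound : (N : ℕ) → threshold λ₀ ≤ N →
    (w : ℕ) → a₁ *ᴿ log₂ (fromℕ N) ≤ᴿ fromℕ w → fromℕ w ≤ᴿ a₂ *ᴿ log₂ (fromℕ N) →
    (S : Cut) → Real S → a₃ *ᴿ fromℕ N ≤ᴿ S →
    (Q : ℕ) (D : CellProbeStructure w (List Bool) ℕ ℕ) →
    (∀ T → 2 ≤ length T → length T ≤ N → fromℕ (bits (preprocess D T)) ≤ᴿ S × AnswersSA D T Q) →
    fromℚ c₀ *ᴿ (log₂ (log₂ (fromℕ N)) /ᴿ log₂ ((S /ᴿ fromℕ N) *ᴿ log₂ (log₂ (fromℕ N)))) ≤ᴿ fromℕ Q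
  -- The order of the rationals is decidable, so `q < Q` may be proved by refuting `Q ≤ q`.
  bound N big w w-lower w-upper S rS S-large Q D spec q lq = decide (q ℚ.<? ι Q) (above-threshold λ₀ N big)
    where
    refute : ∀ {ℓ l} → λ₀ ≤ l → 2 ^ ℓ ≤ N → N < 2 ^ suc ℓ → 2 ^ l ≤ ℓ → ℓ < 2 ^ suc l → ∀ Q′ → Q′ ≡ Q → ι Q ℚ.≤ q → ⊥
    -- `Choice` estimates `suc Q` by `2 * Q`, so the case of no probes is excluded separately by two
    -- strings of length 2.
    refute {ℓ} {l} large 2^ℓ≤N N<2^ 2^l≤ℓ ℓ<2^ zero refl Q≤q = no-zero-probe D
      (proj₂ (spec (false ∷ true ∷ []) ≤-refl 2≤N)) (proj₂ (spec (true ∷ false ∷ []) ≤-refl 2≤N))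
      where
      2≤N : 2 ≤ N
      2≤N = ≤-trans (s≤s (s≤s z≤n))
        (Conclusion.4≤N ra₁ ra₂ ra₃ pa₁ pa₂ q₃ 0<q₃ lq₃ k (proj₂ k-bound) N ℓ l large 2^ℓ≤N N<2^ 2^l≤ℓ ℓ<2^)
    refute {ℓ} {l} large 2^ℓ≤N N<2^ 2^l≤ℓ ℓ<2^ (suc Q′) eq Q≤q =
      Conclusion.Refutation.refutation ra₁ ra₂ ra₃ pa₁ pa₂ q₃ 0<q₃ lq₃ k (proj₂ k-bound) N ℓ l large 2^ℓ≤N N<2^ 2^l≤ℓ ℓ<2^
        w-lower w-upper rS S-large Q (subst (0 <_) eq (s≤s z≤n)) D spec q lq Q≤q
    decide : Dec (q ℚ.< ι Q) → ∃[ ℓ ] ∃[ l ] λ₀ ≤ l × (2 ^ ℓ ≤ N × N < 2 ^ suc ℓ) × (2 ^ l ≤ ℓ × ℓ < 2 ^ suc l) → q ℚ.< ι Q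
    decide (yes q<Q) _ = q<Q
    decide (no q≮Q) (ℓ , l , large , (2^ℓ≤N , N<2^) , (2^l≤ℓ , ℓ<2^)) =
      ⊥-elim (refute large 2^ℓ≤N N<2^ 2^l≤ℓ ℓ<2^ Q refl (ℚ.≮⇒≥ q≮Q))
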